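{- There exists a positive constant $C$ such that for infinitely many positive integers $n$ one has $\omega(n-k) \le \Omega(n-k) \le C\log k$ for every integer $k$ with $1<k<n$.
   Context: $\omega(m)$ is the number of distinct prime factors of $m$, and $\Omega(m)$ is the number of prime factors of $m$ counted with multiplicity. -}

module Defs where

open import Data.Nat using (ℕ; zero; suc)
open import Data.Nat.Properties using (_≟_)
open import Data.List using (length; deduplicate)
open import Data.Nat.Primality.Factorisation using (factorise; factors)

-- Ω m : number of prime factors of m counted with multiplicity
-- (length of the prime factorisation); convention Ω 0 = 0 (never used).
Ω : ℕ → ℕ
Ω zero = 0
Ω (suc m) = length (factors (factorise (suc m)))

-- ω m : number of distinct prime factors of m; convention ω 0 = 0 (never used).
ω : ℕ → ℕ
ω zero = 0
ω (suc m) = length (deduplicate _≟_ (factors (factorise (suc m))))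

{-# OPTIONS --safe #-}
module Submission where

open import Defs
open import Data.Nat using (ℕ; zero; suc; _+_; _*_; _∸_; _^_; _≤_; _<_; z≤n; s≤s; pred; _!; NonZero; >-nonZero; ≢-nonZero; nonTrivial⇒n>1)
open import Data.Nat.Properties
open import Data.Nat.Divisibility
open import Data.Nat.DivMod using (_/_; m/n*n≡m; m*[n/m]≡n)
open import Data.Nat.GCD using (gcd; gcd[m,n]∣m; gcd[m,n]∣n; gcd-greatest; gcd[m,n]≡0⇒m≡0; module Bézout)
open import Data.Nat.Coprimality using (Coprime; coprime-Bézout; coprime-divisor; coprime-/gcd)
import Data.Nat.Coprimality as Coprimality
open import Data.Nat.Combinatorics using (nCk+nC[k+1]≡[n+1]C[k+1]; k![n∸k]!∣n!; nCk≡n!/k![n-k]!; k>n⇒nCk≡0) renaming (_C_ to _choose_)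
open import Data.Nat.Primality using (Prime; prime?; euclidsLemma; prime⇒irreducible; prime⇒nonZero; prime⇒nonTrivial; ¬prime[1])
open import Data.Nat.Primality.Factorisation using (PrimeFactorisation; factorise; factors; factorisationUnique; factorisationHasAllPrimeFactors)
open import Data.Nat.ListAction using (sum; product)
open import Data.Nat.ListAction.Properties using (sum-++; product-++; product-↭; ∈⇒∣product)
open import Data.Nat.Tactic.RingSolver using (solve-∀)
open import Data.Integer as ℤ using (ℤ; +_; -_; ∣_∣; 0ℤ; 1ℤ; -1ℤ)
import Data.Integer.Properties as ℤₚ
import Data.Integer.Tactic.RingSolver as ℤ-Solver
open import Data.List using (List; []; _∷_; _++_; map; filter; length; take; drop)
open import Data.List.Properties using (map-++; map-∘; map-cong; length-++; length-take; length-drop; length-filter; length-deduplicate; take++drop≡id; filter-++; filter-accept; filter-reject; filter-all)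
open import Data.List.Membership.Propositional using (_∈_)
open import Data.List.Membership.DecPropositional _≟_ using (_∈?_)
open import Data.List.Membership.Propositional.Properties using (∈-filter⁺; ∈-++⁺ˡ; ∈-++⁺ʳ; ∈-map⁺; ∈-∃++)
open import Data.List.Relation.Unary.Any using (here; there)
open import Data.List.Relation.Unary.All as All using (All; []; _∷_)
import Data.List.Relation.Unary.All.Properties as Allₚ
open import Data.List.Relation.Unary.AllPairs as AllPairs using (AllPairs; []; _∷_)
import Data.List.Relation.Unary.AllPairs.Properties as AllPairsₚ
open import Data.List.Relation.Binary.Permutation.Propositional.Properties using (shift; ↭-length)
open import Data.Product using (∃; ∃₂; ∃-syntax; _×_; _,_; proj₁; proj₂)
open import Data.Sum using (_⊎_; inj₁; inj₂)
open import Data.Unit using (⊤; tt)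
open import Function using (_∘_; case_of_)
open import Relation.Nullary using (Dec; yes; no; ¬_; contradiction)
open import Relation.Nullary.Decidable using (¬?)
open import Relation.Binary.PropositionalEquality

-- A Brun–Hooley sieve. Take n ≡ 0 mod P with P = (y!)² and n between X and 2X. For k ≤ y the primes
-- up to y then divide n - k only as they divide k. The primes between y and D₀ = X^(1/470) are cut
-- into J blocks (2^(s 4^i), 2^(s 4^(i+1))], and in the j-th block from the top n is required to avoid
-- the classes 1, …, 2^(j+1); so n - k has no prime factor between y and about D₀^(1/k²). Each block is
-- sieved by an even truncation of inclusion–exclusion of order proportional to 2^j; the weight w(n)
-- obtained in this way has total mass close to the expected one, because ∑ 1/p over a block is bounded
-- (Chebyshev) and the sum of order times log p over the blocks stays below log X.
--
-- If Ω((n - k)/gcd(P, k)) ≥ 471 T with T a large multiple of log k, then (n - k)/gcd(P, k) has a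
-- divisor d ≤ D₀ which is a product of T primes from the remaining range for k. Rankin's trick bounds
-- the w-mass of all n for which such a d exists by a constant times k^(-2), so that some n in the
-- support of w has no such divisor for any k < D₀. For k ≥ D₀ the bound is trivial, since n < D₀^471.

-- Indicators, sums and residue classes

-- The weight and the condition that d divides n - k are not independent, since d may contain primes
-- that are sieved. The mass belonging to d is therefore measured with the sieve from which the
-- primes of d are omitted. At an n that no item hits both weights equal 1, so a vanishing mass
-- still excludes d there. Omitting a prime p costs a factor (1 - κ/p)⁻¹ ≤ 4/3. Rankin's trick is
-- run with 3/2 for each prime, and 4/3 · 2/3 = 8/9 remains for each of the T primes of d. This
-- saving pays for everything else, and (9/8)^6 > 2 explains the 6 in T. As an upper-bound sieve,
-- the weight can also be positive at an n that is hit. A second polynomial dominates it there, and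
-- n is found where the weight exceeds this polynomial plus the bad mass. Probabilities and
-- logarithms never occur as such: densities are multiplied by their modulus, and Ω ≤ C log k is
-- read as 2^Ω ≤ k^C.

⟦_⟧ : {A : Set} → Dec A → ℕ
⟦ yes _ ⟧ = 1
⟦ no _ ⟧ = 0

⟦⟧-true : {A : Set} (a? : Dec A) → A → ⟦ a? ⟧ ≡ 1
⟦⟧-true (yes _) _ = refl
⟦⟧-true (no ¬a) a = contradiction a ¬a

⟦⟧-false : {A : Set} (a? : Dec A) → ¬ A → ⟦ a? ⟧ ≡ 0
⟦⟧-false (yes a) ¬a = contradiction a ¬a
⟦⟧-false (no _) _ = refl

⟦⟧-× : {A B C : Set} (a? : Dec A) (b? : Dec B) (c? : Dec C) →
       (A → B → C) → (C → A × B) → ⟦ a? ⟧ * ⟦ b? ⟧ ≡ ⟦ c? ⟧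
⟦⟧-× (yes a) (yes b) c? f g = sym (⟦⟧-true c? (f a b))
⟦⟧-× (yes a) (no ¬b) c? f g = sym (⟦⟧-false c? (¬b ∘ proj₂ ∘ g))
⟦⟧-× (no ¬a) b?      c? f g = sym (⟦⟧-false c? (¬a ∘ proj₁ ∘ g))

∑ℤ : ℕ → ℕ → (ℕ → ℤ) → ℤ
∑ℤ a zero f = 0ℤ
∑ℤ a (suc l) f = f a ℤ.+ ∑ℤ (suc a) l f

∑ℤ-cong : ∀ a l {f g} → (∀ n → f n ≡ g n) → ∑ℤ a l f ≡ ∑ℤ a l g
∑ℤ-cong a zero eq = refl
∑ℤ-cong a (suc l) eq = cong₂ ℤ._+_ (eq a) (∑ℤ-cong (suc a) l eq)

∑ℤ-+ : ∀ a l f g → ∑ℤ a l (λ n → f n ℤ.+ g n) ≡ ∑ℤ a l f ℤ.+ ∑ℤ a l g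
∑ℤ-+ a zero f g = refl
∑ℤ-+ a (suc l) f g rewrite ∑ℤ-+ (suc a) l f g = shuffle (f a) (g a) _ _
  where
  shuffle : ∀ x y u v → (x ℤ.+ y) ℤ.+ (u ℤ.+ v) ≡ (x ℤ.+ u) ℤ.+ (y ℤ.+ v)
  shuffle = ℤ-Solver.solve-∀

∑ℤ-* : ∀ a l f c → ∑ℤ a l (λ n → f n ℤ.* c) ≡ ∑ℤ a l f ℤ.* c
∑ℤ-* a zero f c = refl
∑ℤ-* a (suc l) f c rewrite ∑ℤ-* (suc a) l f c = sym (ℤₚ.*-distribʳ-+ c (f a) _)

∑ℤ-neg : ∀ a l f → ∑ℤ a l (λ n → - f n) ≡ - ∑ℤ a l f
∑ℤ-neg a zero f = refl
∑ℤ-neg a (suc l) f rewrite ∑ℤ-neg (suc a) l f = sym (ℤₚ.neg-distrib-+ (f a) _)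

∑ : ℕ → ℕ → (ℕ → ℕ) → ℕ
∑ a zero f = 0
∑ a (suc l) f = f a + ∑ (suc a) l f

∑-∑ℤ : ∀ a l f → ∑ℤ a l (λ n → + f n) ≡ + ∑ a l f
∑-∑ℤ a zero f = refl
∑-∑ℤ a (suc l) f rewrite ∑-∑ℤ (suc a) l f = refl

-- Residue classes are written {n : D ∣ n + c}: no subtraction, and c ranges over all of ℕ.

crt-step : ∀ D p c c′ x y → 0 < p → D * x ≡ 1 + p * y →
           ∃₂ λ u v → c + D * u ≡ c′ + p * v
crt-step D (suc q) c c′ x y _ Dx≡1+py =
  -- `q` = p - 1 stands for -1 modulo p, so c′ + c q plays the part of c′ - c; the factor `x` is the
  -- inverse of `D` modulo p.
  x * (c′ + c * q) , y * (c′ + c * q) + c , (begin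
  c + D * (x * (c′ + c * q))               ≡⟨ cong (_+_ c) (*-assoc D x _) ⟨
  c + (D * x) * (c′ + c * q)               ≡⟨ cong (λ z → c + z * (c′ + c * q)) Dx≡1+py ⟩
  c + (1 + suc q * y) * (c′ + c * q)     ≡⟨ identity c c′ q y ⟩
  c′ + suc q * (y * (c′ + c * q) + c)    ∎)
  where
  open ≡-Reasoning
  identity : ∀ c c′ q y → c + (1 + (1 + q) * y) * (c′ + c * q)
                        ≡ c′ + (1 + q) * (y * (c′ + c * q) + c)
  identity = solve-∀

crt : ∀ D p c c′ → 0 < D → 0 < p → Coprime D p → ∃₂ λ u v → c + D * u ≡ c′ + p * v
crt D p c c′ D>0 p>0 cop with coprime-Bézout cop
... | Bézout.+- x y eq = crt-step D p c c′ x y p>0 (trans (*-comm D x) (trans (sym eq) (cong suc (*-comm y p))))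
... | Bézout.-+ x y eq with crt-step p D c′ c y x D>0 (trans (*-comm p y) (trans (sym eq) (cong suc (*-comm x D))))
...   | u , v , e = v , u , sym e

coprime⇒*∣ : ∀ {D p n} → Coprime D p → D ∣ n → p ∣ n → D * p ∣ n
coprime⇒*∣ {D} {p} cop D∣n@(divides q refl) p∣n =
  subst (_∣ q * D) (*-comm p D) (*-monoˡ-∣ D (coprime-divisor (Coprimality.sym cop) (subst (p ∣_) (*-comm q D) p∣n)))

private
  ∣-shift : ∀ {D n} c u → D ∣ n + c → D ∣ n + (c + D * u)
  ∣-shift {D} {n} c u d = subst (D ∣_) (+-assoc n c _) (∣m∣n⇒∣m+n d (m∣m*n u))

  ∣-unshift : ∀ {D n} c u → D ∣ n + (c + D * u) → D ∣ n + c
  ∣-unshift {D} {n} c u d = ∣m+n∣n⇒∣m (subst (D ∣_) (sym (+-assoc n c _)) d) (m∣m*n u)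
    where
    ∣m+n∣n⇒∣m : ∀ {m n} → D ∣ m + n → D ∣ n → D ∣ m
    ∣m+n∣n⇒∣m {m} {n} d = ∣m+n∣m⇒∣n (subst (D ∣_) (+-comm m n) d)

class-∩ : ∀ D p c c′ → 0 < D → 0 < p → Coprime D p →
          ∃ λ c″ → ∀ n → ⟦ D ∣? n + c ⟧ * ⟦ p ∣? n + c′ ⟧ ≡ ⟦ D * p ∣? n + c″ ⟧
class-∩ D p c c′ D>0 p>0 cop with crt D p c c′ D>0 p>0 cop
... | u , v , eq = c + D * u , λ n → ⟦⟧-× (D ∣? n + c) (p ∣? n + c′) (D * p ∣? _)
  (λ D∣ p∣ → coprime⇒*∣ cop (∣-shift {n = n} c u D∣) (subst (λ z → p ∣ n + z) (sym eq) (∣-shift {n = n} c′ v p∣)))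
  (λ Dp∣ → ∣-unshift {n = n} c u (∣-trans (m∣m*n p) Dp∣)
         , ∣-unshift {n = n} c′ v (subst (λ z → p ∣ n + z) eq (∣-trans (n∣m*n D) Dp∣)))

-- r is the distance from a + c up to the next multiple of D.
class-count-step : ∀ D c a l r → r < D → D ∣ (a + c) + r →
  ∃ λ r′ → r′ < D × D * ∑ a l (λ n → ⟦ D ∣? n + c ⟧) + r ≡ l + r′
class-count-step D c a zero r r<D _ = r , r<D , cong (_+ r) (*-zeroʳ D)
class-count-step D@(suc E) c a (suc l) zero r<D D∣ with class-count-step D c (suc a) l E (n<1+n E)
     (subst (D ∣_) (trans (cong (_+ D) (+-identityʳ _)) (+-suc (a + c) E)) (∣m∣n⇒∣m+n D∣ ∣-refl))
... | r′ , r′<D , eq = r′ , r′<D , (begin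
  D * (⟦ D ∣? a + c ⟧ + S) + 0 ≡⟨ cong (λ z → D * (z + S) + 0) (⟦⟧-true (D ∣? a + c) (subst (D ∣_) (+-identityʳ _) D∣)) ⟩
  D * (1 + S) + 0                ≡⟨ identity E S ⟩
  1 + (D * S + E)                ≡⟨ cong suc eq ⟩
  suc l + r′                         ∎)
  where
  open ≡-Reasoning
  S = ∑ (suc a) l (λ n → ⟦ D ∣? n + c ⟧)
  identity : ∀ E S → (1 + E) * (1 + S) + 0 ≡ 1 + ((1 + E) * S + E)
  identity = solve-∀
class-count-step D c a (suc l) (suc r) r<D D∣ with class-count-step D c (suc a) l r (<-trans (n<1+n r) r<D)
     (subst (D ∣_) (+-suc (a + c) r) D∣)
... | r′ , r′<D , eq = r′ , r′<D , (begin
  D * (⟦ D ∣? a + c ⟧ + S) + suc r ≡⟨ cong (λ z → D * (z + S) + suc r) (⟦⟧-false (D ∣? a + c) D∤) ⟩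
  D * S + suc r                        ≡⟨ +-suc _ r ⟩
  suc (D * S + r)                      ≡⟨ cong suc eq ⟩
  suc l + r′                             ∎)
  where
  open ≡-Reasoning
  S = ∑ (suc a) l (λ n → ⟦ D ∣? n + c ⟧)
  D∤ : ¬ D ∣ a + c
  D∤ d = <⇒≱ r<D (∣⇒≤ (∣m+n∣m⇒∣n D∣ d))

next-multiple : ∀ D m → 0 < D → ∃ λ r → r < D × D ∣ m + r
next-multiple D zero D>0 = 0 , D>0 , D ∣0
next-multiple D@(suc E) (suc m) D>0 with next-multiple D m D>0
... | zero , _ , d = E , n<1+n E , subst (D ∣_) (trans (cong (_+ D) (+-identityʳ m)) (+-suc m E)) (∣m∣n⇒∣m+n d ∣-refl)
... | suc r , r<D , d = r , <-trans (n<1+n r) r<D , subst (D ∣_) (+-suc m r) d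

-- The difference is r′ - r, where r and r′ are the distances to the next multiple of `D` at both
-- ends; both are below `D`.
class-count : ∀ D c a l → 0 < D →
  ∣ (+ D ℤ.* + ∑ a l (λ n → ⟦ D ∣? n + c ⟧)) ℤ.- + l ∣ ≤ D
class-count D c a l D>0 with next-multiple D (a + c) D>0
... | r , r<D , d with class-count-step D c a l r r<D d
...   | r′ , r′<D , eq = subst (λ z → ∣ z ∣ ≤ D) (sym difference) (bound (<⇒≤ r<D) (<⇒≤ r′<D))
  where
  S = ∑ a l (λ n → ⟦ D ∣? n + c ⟧)
  eqℤ : (+ D ℤ.* + S) ℤ.+ + r ≡ + l ℤ.+ + r′
  eqℤ = trans (cong (ℤ._+ + r) (sym (ℤₚ.pos-* D S))) (cong +_ eq)
  difference : (+ D ℤ.* + S) ℤ.- + l ≡ + r′ ℤ.- + r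
  difference = trans (identity₁ (+ D ℤ.* + S) (+ l) (+ r)) (trans (cong (λ z → z ℤ.- (+ l ℤ.+ + r)) eqℤ) (identity₂ (+ l) (+ r) (+ r′)))
    where
    identity₁ : ∀ x l r → x ℤ.- l ≡ (x ℤ.+ r) ℤ.- (l ℤ.+ r)
    identity₁ = ℤ-Solver.solve-∀
    identity₂ : ∀ l r r′ → (l ℤ.+ r′) ℤ.- (l ℤ.+ r) ≡ r′ ℤ.- r
    identity₂ = ℤ-Solver.solve-∀
  bound : r ≤ D → r′ ≤ D → ∣ + r′ ℤ.- + r ∣ ≤ D
  bound r≤D r′≤D rewrite ℤₚ.m-n≡m⊖n r′ r with ≤-total r r′
  ... | inj₁ r≤r′ rewrite ℤₚ.⊖-≥ r≤r′ = ≤-trans (m∸n≤m r′ r) r′≤D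
  ... | inj₂ r′≤r rewrite ℤₚ.∣⊖∣-≤ r′≤r = ≤-trans (m∸n≤m r r′) r≤D

-- Counting in residue classes

-- An item (p , κ) is a prime p together with the number κ of classes 1, …, κ to be avoided modulo p.
Item : Set
Item = ℕ × ℕ

-- Multilinear polynomials in the hits of the items. Evaluation under `at n` substitutes the hits of the
-- integer n; evaluation under `model` gives the mean value over independent residues, scaled by the
-- modulus (item (p , κ) is hit with probability κ / p).
data Poly : List Item → Set where
  con  : ℤ → Poly []
  _⊕_  : ∀ {is} → Poly is → Poly is → Poly is
  ⊖_   : ∀ {is} → Poly is → Poly is
  read : ∀ {is} i → Poly is → Poly is → Poly (i ∷ is)

eval : (Item → ℕ × ℕ) → ∀ {is} → Poly is → ℤ
eval α (con z) = z
eval α (e ⊕ f) = eval α e ℤ.+ eval α f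
eval α (⊖ e) = - eval α e
eval α (read i e f) = + proj₁ (α i) ℤ.* eval α e ℤ.+ + proj₂ (α i) ℤ.* eval α f

-- Sum of the absolute coefficients after every hit is expanded into its κ residue classes. Each
-- class is counted with an error of at most 1, so this bounds the total error.
size : ∀ {is} → Poly is → ℕ
size (con z) = ∣ z ∣
size (e ⊕ f) = size e + size f
size (⊖ e) = size e
size (read (_ , κ) e f) = size e + κ * size f

-- The number of k in 1, …, κ with p ∣ n - k, where n - k is replaced by n + (p - k).
hit : ℕ → ℕ → ℕ → ℕ
hit n p zero = 0
hit n p (suc k) = ⟦ p ∣? n + (p ∸ suc k) ⟧ + hit n p k

model : Item → ℕ × ℕ
model i = i

at : ℕ → Item → ℕ × ℕ
at n (p , κ) = 1 , hit n p κ

modulus : List Item → ℕ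
modulus [] = 1
modulus ((p , _) ∷ is) = p * modulus is

Sieving : List Item → Set
Sieving is = All (λ i → 0 < proj₁ i) is × AllPairs (λ i j → Coprime (proj₁ i) (proj₁ j)) is

CoprimeTo : ℕ → List Item → Set
CoprimeTo D = All (λ i → Coprime D (proj₁ i))

coprime-* : ∀ {D p q} → Coprime D q → Coprime p q → Coprime (D * p) q
coprime-* {D} {p} {q} Dq pq {d} (d∣Dp , d∣q) =
  pq (coprime-divisor (λ {e} (e∣d , e∣D) → Dq (e∣D , ∣-trans e∣d d∣q)) d∣Dp , d∣q)

coprimeTo-* : ∀ {D p is} → CoprimeTo D is → CoprimeTo p is → CoprimeTo (D * p) is
coprimeTo-* [] [] = []
coprimeTo-* (Dq ∷ Ds) (pq ∷ ps) = coprime-* Dq pq ∷ coprimeTo-* Ds ps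

triangle : ∀ x y {a b} → ∣ x ∣ ≤ a → ∣ y ∣ ≤ b → ∣ x ℤ.+ y ∣ ≤ a + b
triangle x y p q = ≤-trans (ℤₚ.∣i+j∣≤∣i∣+∣j∣ x y) (+-mono-≤ p q)

module Count (a l : ℕ) where

  class-sum : ℕ → ℕ → (ℕ → ℤ) → ℤ
  class-sum D c f = ∑ℤ a l (λ n → + ⟦ D ∣? n + c ⟧ ℤ.* f n)

  class-sum-+ : ∀ D c f g → class-sum D c (λ n → f n ℤ.+ g n) ≡ class-sum D c f ℤ.+ class-sum D c g
  class-sum-+ D c f g = trans (∑ℤ-cong a l (λ n → ℤₚ.*-distribˡ-+ (+ ⟦ D ∣? n + c ⟧) (f n) (g n))) (∑ℤ-+ a l _ _)

  -- Actual sum minus expected value, multiplied by `modulus is * D` so that no fraction occurs.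
  discrepancy : ∀ {is} → ℕ → ℕ → Poly is → ℤ
  discrepancy {is} D c e =
    + (modulus is * D) ℤ.* class-sum D c (λ n → eval (at n) e) ℤ.- + l ℤ.* eval model e

  -- The induction needs an arbitrary class modulo a `D` coprime to the unread items: reading a hit
  -- of p refines the class to one modulo D p by the Chinese remainder theorem, and the recursion
  -- ends in plain class counts.
  count : ∀ {is} (e : Poly is) D c → 0 < D → Sieving is → CoprimeTo D is →
          ∣ discrepancy D c e ∣ ≤ modulus is * D * size e

  count-hits : ∀ {is} (f : Poly is) p κ D c → 0 < D → 0 < p → Coprime D p → Sieving is → CoprimeTo (D * p) is →
          ∣ + (modulus is * (D * p)) ℤ.* class-sum D c (λ n → + hit n p κ ℤ.* eval (at n) f)
            ℤ.- + l ℤ.* (+ κ ℤ.* eval model f) ∣ ≤ modulus is * (D * p) * (κ * size f)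
  count-hits {is} f p zero D c D>0 p>0 cop siev cops = ≤-trans (≤-reflexive (cong ∣_∣ zero-eq)) z≤n
    where
    zero-eq : + (modulus is * (D * p)) ℤ.* class-sum D c (λ n → 0ℤ ℤ.* eval (at n) f)
            ℤ.- + l ℤ.* (0ℤ ℤ.* eval model f) ≡ 0ℤ
    zero-eq = trans (cong (λ z → + (modulus is * (D * p)) ℤ.* z ℤ.- + l ℤ.* 0ℤ) sum0) (identity (+ (modulus is * (D * p))) (+ l))
      where
      sum0 : class-sum D c (λ n → 0ℤ ℤ.* eval (at n) f) ≡ 0ℤ ℤ.* 0ℤ
      sum0 = trans (∑ℤ-cong a l (λ n → cong (λ z → + ⟦ D ∣? n + c ⟧ ℤ.* z) (ℤₚ.*-zeroˡ (eval (at n) f)))) 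
             (trans (∑ℤ-* a l (λ n → + ⟦ D ∣? n + c ⟧) 0ℤ) (ℤₚ.*-zeroʳ (∑ℤ a l (λ n → + ⟦ D ∣? n + c ⟧))))
      identity : ∀ q l → q ℤ.* 0ℤ ℤ.- l ℤ.* 0ℤ ≡ 0ℤ
      identity = ℤ-Solver.solve-∀
  count-hits {is} f p (suc κ) D c D>0 p>0 cop siev cops with class-∩ D p c (p ∸ suc κ) D>0 p>0 cop
  ... | c″ , ∩-eq = subst₂ (λ x y → ∣ x ∣ ≤ y) (sym split) (sym sizes)
        (triangle (discrepancy (D * p) c″ f) _ (count f (D * p) c″ (*-mono-≤ D>0 p>0) siev cops)
                      (count-hits f p κ D c D>0 p>0 cop siev cops))
    where
    q = modulus is * (D * p)
    g : ℕ → ℤ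
    g n = eval (at n) f
    one-class : class-sum D c (λ n → + ⟦ p ∣? n + (p ∸ suc κ) ⟧ ℤ.* g n) ≡ class-sum (D * p) c″ g
    one-class = ∑ℤ-cong a l λ n → trans (sym (ℤₚ.*-assoc (+ ⟦ D ∣? n + c ⟧) (+ ⟦ p ∣? n + (p ∸ suc κ) ⟧) (g n)))
      (cong (ℤ._* g n) (trans (sym (ℤₚ.pos-* ⟦ D ∣? n + c ⟧ ⟦ p ∣? n + (p ∸ suc κ) ⟧)) (cong +_ (∩-eq n))))
    sums : class-sum D c (λ n → + hit n p (suc κ) ℤ.* g n)
         ≡ class-sum (D * p) c″ g ℤ.+ class-sum D c (λ n → + hit n p κ ℤ.* g n)
    sums = trans (∑ℤ-cong a l (λ n → cong (+ ⟦ D ∣? n + c ⟧ ℤ.*_)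
             (ℤₚ.*-distribʳ-+ (g n) (+ ⟦ p ∣? n + (p ∸ suc κ) ⟧) (+ hit n p κ))))
           (trans (class-sum-+ D c _ _) (cong (ℤ._+ class-sum D c (λ n → + hit n p κ ℤ.* g n)) one-class))
    m = eval model f
    split : + q ℤ.* class-sum D c (λ n → + hit n p (suc κ) ℤ.* g n) ℤ.- + l ℤ.* (+ suc κ ℤ.* m)
          ≡ (+ q ℤ.* class-sum (D * p) c″ g ℤ.- + l ℤ.* m)
            ℤ.+ (+ q ℤ.* class-sum D c (λ n → + hit n p κ ℤ.* g n) ℤ.- + l ℤ.* (+ κ ℤ.* m))
    split = trans (cong (λ z → + q ℤ.* z ℤ.- + l ℤ.* (+ suc κ ℤ.* m)) sums) (identity (+ q) _ _ (+ l) (+ κ) m)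
      where
      identity : ∀ q x y l k m → q ℤ.* (x ℤ.+ y) ℤ.- l ℤ.* ((1ℤ ℤ.+ k) ℤ.* m)
               ≡ (q ℤ.* x ℤ.- l ℤ.* m) ℤ.+ (q ℤ.* y ℤ.- l ℤ.* (k ℤ.* m))
      identity = ℤ-Solver.solve-∀
    sizes : q * (suc κ * size f) ≡ q * size f + q * (κ * size f)
    sizes = *-distribˡ-+ q (size f) (κ * size f)

  count (con z) D c D>0 siev cops = ≤-trans (≤-reflexive (trans (cong ∣_∣ eq) (ℤₚ.abs-* (+ D ℤ.* + S ℤ.- + l) z)))
      (≤-trans (*-monoˡ-≤ ∣ z ∣ (class-count D c a l D>0)) (≤-reflexive (cong (_* ∣ z ∣) (sym (+-identityʳ D)))))
    where
    S = ∑ a l (λ n → ⟦ D ∣? n + c ⟧)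
    eq : discrepancy D c (con z) ≡ (+ D ℤ.* + S ℤ.- + l) ℤ.* z
    eq = trans (cong₂ (λ u v → + u ℤ.* v ℤ.- + l ℤ.* z) (*-identityˡ D)
           (trans (∑ℤ-* a l (λ n → + ⟦ D ∣? n + c ⟧) z) (cong (ℤ._* z) (∑-∑ℤ a l _)))) (identity (+ D) (+ S) (+ l) z)
      where
      identity : ∀ d s l z → d ℤ.* (s ℤ.* z) ℤ.- l ℤ.* z ≡ (d ℤ.* s ℤ.- l) ℤ.* z
      identity = ℤ-Solver.solve-∀
  count {is} (e ⊕ f) D c D>0 siev cops = subst₂ (λ x y → ∣ x ∣ ≤ y) (sym split) (sym (*-distribˡ-+ q (size e) (size f)))
      (triangle (discrepancy D c e) (discrepancy D c f) (count e D c D>0 siev cops) (count f D c D>0 siev cops))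
    where
    q = modulus is * D
    split : discrepancy D c (e ⊕ f) ≡ discrepancy D c e ℤ.+ discrepancy D c f
    split = trans (cong (λ z → + q ℤ.* z ℤ.- + l ℤ.* (eval model e ℤ.+ eval model f)) (class-sum-+ D c _ _)) (identity (+ q) (+ l) _ _ _ _)
      where
      identity : ∀ q l x y m n → q ℤ.* (x ℤ.+ y) ℤ.- l ℤ.* (m ℤ.+ n) ≡ (q ℤ.* x ℤ.- l ℤ.* m) ℤ.+ (q ℤ.* y ℤ.- l ℤ.* n)
      identity = ℤ-Solver.solve-∀
  count {is} (⊖ e) D c D>0 siev cops = subst (_≤ modulus is * D * size e)
      (sym (trans (cong ∣_∣ negated) (ℤₚ.∣-i∣≡∣i∣ (discrepancy D c e)))) (count e D c D>0 siev cops)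
    where
    q = modulus is * D
    negated : discrepancy D c (⊖ e) ≡ - discrepancy D c e
    negated = trans (cong (λ z → + q ℤ.* z ℤ.- + l ℤ.* (- eval model e))
                (trans (∑ℤ-cong a l (λ n → sym (ℤₚ.neg-distribʳ-* (+ ⟦ D ∣? n + c ⟧) (eval (at n) e)))) (∑ℤ-neg a l _)))
              (identity (+ q) (+ l) _ _)
      where
      identity : ∀ q l x m → q ℤ.* (- x) ℤ.- l ℤ.* (- m) ≡ - (q ℤ.* x ℤ.- l ℤ.* m)
      identity = ℤ-Solver.solve-∀
  count {(p , κ) ∷ is} (read (p , κ) e f) D c D>0 (p>0 ∷ pos , cop-p ∷ pairs) (Dp ∷ cops) =
      subst₂ (λ x y → ∣ x ∣ ≤ y) (sym split) (sym sizes)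
        (triangle (+ p ℤ.* discrepancy D c e) _
          (≤-trans (≤-reflexive (ℤₚ.abs-* (+ p) (discrepancy D c e))) (*-monoʳ-≤ p (count e D c D>0 (pos , pairs) cops)))
          (count-hits f p κ D c D>0 p>0 Dp (pos , pairs) (coprimeTo-* cops cop-p)))
    where
    Q = modulus is
    x = class-sum D c (λ n → eval (at n) e)
    y = class-sum D c (λ n → + hit n p κ ℤ.* eval (at n) f)
    sums : class-sum D c (λ n → + 1 ℤ.* eval (at n) e ℤ.+ + hit n p κ ℤ.* eval (at n) f) ≡ x ℤ.+ y
    sums = trans (class-sum-+ D c _ _) (cong (ℤ._+ y) (∑ℤ-cong a l λ n → cong (+ ⟦ D ∣? n + c ⟧ ℤ.*_) (ℤₚ.*-identityˡ _)))
    split : discrepancy D c (read (p , κ) e f) ≡ + p ℤ.* discrepancy D c e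
            ℤ.+ (+ (Q * (D * p)) ℤ.* y ℤ.- + l ℤ.* (+ κ ℤ.* eval model f))
    split = trans (cong₂ (λ u z → u ℤ.* z ℤ.- + l ℤ.* (+ p ℤ.* eval model e ℤ.+ + κ ℤ.* eval model f))
                    (trans (ℤₚ.pos-* (p * Q) D) (cong (ℤ._* + D) (ℤₚ.pos-* p Q))) sums)
            (trans (identity (+ p) (+ Q) (+ D) x y (+ l) (eval model e) (+ κ) (eval model f))
              (cong₂ (λ u v → + p ℤ.* (u ℤ.* x ℤ.- + l ℤ.* eval model e) ℤ.+ (v ℤ.* y ℤ.- + l ℤ.* (+ κ ℤ.* eval model f)))
                (sym (ℤₚ.pos-* Q D)) (sym (trans (ℤₚ.pos-* Q (D * p)) (cong (+ Q ℤ.*_) (ℤₚ.pos-* D p))))))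
      where
      identity : ∀ p q d x y l m k n → ((p ℤ.* q) ℤ.* d) ℤ.* (x ℤ.+ y) ℤ.- l ℤ.* (p ℤ.* m ℤ.+ k ℤ.* n)
               ≡ p ℤ.* ((q ℤ.* d) ℤ.* x ℤ.- l ℤ.* m) ℤ.+ ((q ℤ.* (d ℤ.* p)) ℤ.* y ℤ.- l ℤ.* (k ℤ.* n))
      identity = ℤ-Solver.solve-∀
    sizes : p * Q * D * (size e + κ * size f)
          ≡ p * (Q * D * size e) + Q * (D * p) * (κ * size f)
    sizes = identity p Q D (size e) κ (size f)
      where
      identity : ∀ p q d s k t → p * q * d * (s + k * t) ≡ p * (q * d * s) + q * (d * p) * (k * t)
      identity = solve-∀

-- The block sieve

zeroP : ∀ is → Poly is
zeroP [] = con 0ℤ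
zeroP (i ∷ is) = read i (zeroP is) (zeroP is)

-- U R and E R are the polynomials ∑_{i < R} (-1)^i e_i and e_R in the hits of a block.
U : ∀ {js} → ℕ → (is : List Item) → Poly js → Poly (is ++ js)
U zero is c = zeroP _
U (suc R) [] c = c
U (suc R) (i ∷ is) c = read i (U (suc R) is c) (⊖ U R is c)

E : ∀ {js} → ℕ → (is : List Item) → Poly js → Poly (is ++ js)
E zero [] c = c
E (suc R) [] c = zeroP _
E zero (i ∷ is) c = read i (E zero is c) (zeroP _)
E (suc R) (i ∷ is) c = read i (E (suc R) is c) (E R is c)

module Values (α : Item → ℕ × ℕ) where

  -- void is the (scaled) probability of no hit, and excess (1 + r) is the Bonferroni remainder:
  -- ∑_{i ≤ r} (-1)^i e_i = void + (-1)^r excess (1 + r).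
  void : List Item → ℕ
  void [] = 1
  void (i ∷ is) = (proj₁ (α i) ∸ proj₂ (α i)) * void is

  excess : ℕ → List Item → ℕ
  excess zero is = void is
  excess (suc R) [] = 0
  excess (suc R) (i ∷ is) = proj₁ (α i) * excess (suc R) is + proj₂ (α i) * excess R is

  elem : ℕ → List Item → ℕ
  elem zero [] = 1
  elem (suc R) [] = 0
  elem zero (i ∷ is) = proj₁ (α i) * elem zero is
  elem (suc R) (i ∷ is) = proj₁ (α i) * elem (suc R) is + proj₂ (α i) * elem R is

  Proper : List Item → Set
  Proper = All (λ i → proj₂ (α i) ≤ proj₁ (α i))

  void≤elem : ∀ is → void is ≤ elem 0 is
  void≤elem [] = ≤-refl
  void≤elem (i ∷ is) = *-mono-≤ (m∸n≤m (proj₁ (α i)) (proj₂ (α i))) (void≤elem is)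

  -- Both obey the same recursion and differ only at order 0, where `void` stands for the full
  -- product. This is Bonferroni's bound by the first omitted term.
  excess≤elem : ∀ R is → excess R is ≤ elem R is
  excess≤elem zero is = void≤elem is
  excess≤elem (suc R) [] = z≤n
  excess≤elem (suc R) (i ∷ is) = +-mono-≤ (*-monoʳ-≤ (proj₁ (α i)) (excess≤elem (suc R) is)) (*-monoʳ-≤ (proj₂ (α i)) (excess≤elem R is))

  eval-zeroP : ∀ is → eval α (zeroP is) ≡ 0ℤ
  eval-zeroP [] = refl
  eval-zeroP (i ∷ is) rewrite eval-zeroP is = identity (+ proj₁ (α i)) (+ proj₂ (α i))
    where
    identity : ∀ a b → a ℤ.* 0ℤ ℤ.+ b ℤ.* 0ℤ ≡ 0ℤ
    identity = ℤ-Solver.solve-∀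

  sign : ℕ → ℤ
  sign zero = 1ℤ
  sign (suc R) = - sign R

  void-∷ : ∀ i is → proj₂ (α i) ≤ proj₁ (α i) → + void (i ∷ is) ≡ (+ proj₁ (α i) ℤ.- + proj₂ (α i)) ℤ.* + void is
  void-∷ i is b≤a = trans (ℤₚ.pos-* (proj₁ (α i) ∸ proj₂ (α i)) (void is))
    (cong (ℤ._* + void is) (sym (trans (ℤₚ.m-n≡m⊖n (proj₁ (α i)) (proj₂ (α i))) (ℤₚ.⊖-≥ b≤a))))

  pos-lin : ∀ a x b y → + (a * x + b * y) ≡ + a ℤ.* + x ℤ.+ + b ℤ.* + y
  pos-lin a x b y = cong₂ ℤ._+_ (ℤₚ.pos-* a x) (ℤₚ.pos-* b y)

  -- Bonferroni's inequality as an identity with explicit remainder; `Proper` makes the truncated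
  -- subtraction in `void` a true one.
  eval-U : ∀ {js} R is (c : Poly js) → Proper is →
           eval α (U R is c) ≡ (+ void is ℤ.- sign R ℤ.* + excess R is) ℤ.* eval α c
  eval-U {js} zero is c _ = trans (eval-zeroP (is ++ js)) (identity (+ void is) (eval α c))
    where
    identity : ∀ v c → 0ℤ ≡ (v ℤ.- 1ℤ ℤ.* v) ℤ.* c
    identity = ℤ-Solver.solve-∀
  eval-U (suc R) [] c _ = identity (sign (suc R)) (eval α c)
    where
    identity : ∀ s c → c ≡ (1ℤ ℤ.- s ℤ.* 0ℤ) ℤ.* c
    identity = ℤ-Solver.solve-∀
  eval-U (suc R) (i ∷ is) c (b≤a ∷ proper) = trans
    (cong₂ (λ x y → + proj₁ (α i) ℤ.* x ℤ.+ + proj₂ (α i) ℤ.* (- y)) (eval-U (suc R) is c proper) (eval-U R is c proper))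
    (trans (identity (+ proj₁ (α i)) (+ proj₂ (α i)) (+ void is) (sign R) (+ excess (suc R) is) (+ excess R is) (eval α c))
      (cong₂ (λ x y → (x ℤ.- sign (suc R) ℤ.* y) ℤ.* eval α c) (sym (void-∷ i is b≤a))
        (sym (pos-lin (proj₁ (α i)) (excess (suc R) is) (proj₂ (α i)) (excess R is)))))
    where
    identity : ∀ a b v s x y c →
      a ℤ.* ((v ℤ.- (- s) ℤ.* x) ℤ.* c) ℤ.+ b ℤ.* (- ((v ℤ.- s ℤ.* y) ℤ.* c))
      ≡ ((a ℤ.- b) ℤ.* v ℤ.- (- s) ℤ.* (a ℤ.* x ℤ.+ b ℤ.* y)) ℤ.* c
    identity = ℤ-Solver.solve-∀

  eval-E : ∀ {js} R is (c : Poly js) → eval α (E R is c) ≡ + elem R is ℤ.* eval α c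
  eval-E zero [] c = sym (ℤₚ.*-identityˡ _)
  eval-E {js} (suc R) [] c = trans (eval-zeroP js) (sym (ℤₚ.*-zeroˡ (eval α c)))
  eval-E zero (i ∷ is) c = trans
    (cong₂ (λ x y → + proj₁ (α i) ℤ.* x ℤ.+ + proj₂ (α i) ℤ.* y) (eval-E zero is c) (eval-zeroP (is ++ _)))
    (trans (identity (+ proj₁ (α i)) (+ proj₂ (α i)) (+ elem 0 is) (eval α c))
      (cong (ℤ._* eval α c) (sym (ℤₚ.pos-* (proj₁ (α i)) (elem 0 is)))))
    where
    identity : ∀ a b x c → a ℤ.* (x ℤ.* c) ℤ.+ b ℤ.* 0ℤ ≡ (a ℤ.* x) ℤ.* c
    identity = ℤ-Solver.solve-∀
  eval-E (suc R) (i ∷ is) c = trans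
    (cong₂ (λ x y → + proj₁ (α i) ℤ.* x ℤ.+ + proj₂ (α i) ℤ.* y) (eval-E (suc R) is c) (eval-E R is c))
    (trans (identity (+ proj₁ (α i)) (+ proj₂ (α i)) (+ elem (suc R) is) (+ elem R is) (eval α c))
      (cong (ℤ._* eval α c) (sym (pos-lin (proj₁ (α i)) (elem (suc R) is) (proj₂ (α i)) (elem R is)))))
    where
    identity : ∀ a b x y c → a ℤ.* (x ℤ.* c) ℤ.+ b ℤ.* (y ℤ.* c) ≡ (a ℤ.* x ℤ.+ b ℤ.* y) ℤ.* c
    identity = ℤ-Solver.solve-∀

  sign-odd : ∀ m → sign (suc (m + m)) ≡ -1ℤ
  sign-odd m = cong -_ (go m)
    where
    go : ∀ m → sign (m + m) ≡ 1ℤ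
    go zero = refl
    go (suc m) rewrite +-suc m m = trans (ℤₚ.neg-involutive _) (go m)

Block : Set
Block = ℕ × List Item

-- (m , is) is sieved with U (2m + 1). Only odd orders occur, so that the truncated sums are nonnegative.
order : Block → ℕ
order (m , _) = suc (m + m)

flat : List Block → List Item
flat [] = []
flat ((_ , is) ∷ bs) = is ++ flat bs

-- The product of the truncated sums of all blocks. Each `U` receives the polynomial of the later
-- blocks as its continuation, so polynomials need not be multiplied.
W : (bs : List Block) → Poly (flat bs)
W [] = con 1ℤ
W (b@(_ , is) ∷ bs) = U (order b) is (W bs)

-- Bounds W from above at every n that is hit.
H : (bs : List Block) → Poly (flat bs)
H [] = con 0ℤ
H (b@(_ , is) ∷ bs) = E (order b) is (W bs) ⊕ U (order b) is (H bs)

module BlockValues (α : Item → ℕ × ℕ) where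
  open Values α public

  factor : Block → ℕ
  factor b = void (proj₂ b) + excess (order b) (proj₂ b)

  weight : List Block → ℕ
  weight [] = 1
  weight (b ∷ bs) = factor b * weight bs

  defect : List Block → ℕ
  defect [] = 0
  defect (b ∷ bs) = elem (order b) (proj₂ b) * weight bs + factor b * defect bs

  eval-factor : ∀ {js} b (c : Poly js) → Proper (proj₂ b) → eval α (U (order b) (proj₂ b) c) ≡ + factor b ℤ.* eval α c
  eval-factor b@(m , is) c proper = trans (eval-U (order b) is c proper) (cong (ℤ._* eval α c)
    (trans (cong (λ s → + void is ℤ.- s ℤ.* + excess (order b) is) (sign-odd m)) (identity (+ void is) (+ excess (order b) is))))
    where
    identity : ∀ v x → v ℤ.- -1ℤ ℤ.* x ≡ v ℤ.+ x
    identity = ℤ-Solver.solve-∀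

  eval-W : ∀ bs → Proper (flat bs) → eval α (W bs) ≡ + weight bs
  eval-W [] _ = refl
  eval-W (b ∷ bs) proper = trans (eval-factor b (W bs) (Allₚ.++⁻ˡ (proj₂ b) proper))
    (trans (cong (+ factor b ℤ.*_) (eval-W bs (Allₚ.++⁻ʳ (proj₂ b) proper))) (sym (ℤₚ.pos-* (factor b) (weight bs))))

  eval-H : ∀ bs → Proper (flat bs) → eval α (H bs) ≡ + defect bs
  eval-H [] _ = refl
  eval-H (b ∷ bs) proper = trans (cong₂ ℤ._+_
      (trans (eval-E (order b) (proj₂ b) (W bs)) (cong (+ elem (order b) (proj₂ b) ℤ.*_) (eval-W bs rest)))
      (trans (eval-factor b (H bs) (Allₚ.++⁻ˡ (proj₂ b) proper)) (cong (+ factor b ℤ.*_) (eval-H bs rest))))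
    (sym (pos-lin (elem (order b) (proj₂ b)) (weight bs) (factor b) (defect bs)))
    where rest = Allₚ.++⁻ʳ (proj₂ b) proper

  void-++ : ∀ is js → void (is ++ js) ≡ void is * void js
  void-++ [] js = sym (*-identityˡ _)
  void-++ (i ∷ is) js = trans (cong ((proj₁ (α i) ∸ proj₂ (α i)) *_) (void-++ is js)) (sym (*-assoc (proj₁ (α i) ∸ proj₂ (α i)) (void is) (void js)))

  void≤weight : ∀ bs → void (flat bs) ≤ weight bs
  void≤weight [] = ≤-refl
  void≤weight (b ∷ bs) = ≤-trans (≤-reflexive (void-++ (proj₂ b) (flat bs))) (*-mono-≤ (m≤m+n (void (proj₂ b)) (excess (order b) (proj₂ b))) (void≤weight bs))

  -- Some block has `void` 0. Its factor then consists of the excess alone, which is at most the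
  -- elementary function that replaces this factor in one summand of `defect`.
  void≡0⇒weight≤defect : ∀ bs → void (flat bs) ≡ 0 → weight bs ≤ defect bs
  void≡0⇒weight≤defect (b ∷ bs) eq with m*n≡0⇒m≡0∨n≡0 (void (proj₂ b)) (trans (sym (void-++ (proj₂ b) (flat bs))) eq)
  ... | inj₁ v≡0 = ≤-trans (*-monoˡ-≤ (weight bs) (≤-trans (≤-reflexive (cong (_+ excess (order b) (proj₂ b)) v≡0)) (excess≤elem (order b) (proj₂ b))))
                     (m≤m+n _ _)
  ... | inj₂ v≡0 = ≤-trans (*-monoʳ-≤ (factor b) (void≡0⇒weight≤defect bs v≡0)) (m≤n+m _ _)

load : List Item → ℕ
load [] = 0
load ((_ , κ) ∷ is) = κ + load is

size-zeroP : ∀ is → size (zeroP is) ≡ 0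
size-zeroP [] = refl
size-zeroP ((_ , κ) ∷ is) rewrite size-zeroP is = *-zeroʳ κ

power-step : ∀ κ k R s → (1 + k) ^ suc R * s + κ * ((1 + k) ^ R * s) ≤ (1 + (κ + k)) ^ suc R * s
power-step κ k R s = begin
  (1 + k) ^ suc R * s + κ * ((1 + k) ^ R * s) ≡⟨ identity κ k ((1 + k) ^ R) s ⟩
  (1 + (κ + k)) * (1 + k) ^ R * s             ≤⟨ *-monoˡ-≤ s (*-monoʳ-≤ (1 + (κ + k)) (^-monoˡ-≤ R (s≤s (m≤n+m k κ)))) ⟩
  (1 + (κ + k)) ^ suc R * s                   ∎
  where
  open ≤-Reasoning
  identity : ∀ κ k x s → (1 + k) * x * s + κ * (x * s) ≡ (1 + (κ + k)) * x * s
  identity = solve-∀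

-- The block has `load is` residue classes, and a truncation of order `R` expands into products of
-- at most `R` of them.
size-U : ∀ {js} R is (c : Poly js) → size (U R is c) ≤ (1 + load is) ^ R * size c
size-U {js} zero is c = ≤-trans (≤-reflexive (size-zeroP (is ++ js))) z≤n
size-U (suc R) [] c = ≤-reflexive (sym (trans (cong (_* size c) (^-zeroˡ (suc R))) (*-identityˡ (size c))))
size-U (suc R) ((p , κ) ∷ is) c = ≤-trans (+-mono-≤ (size-U (suc R) is c) (*-monoʳ-≤ κ (size-U R is c))) (power-step κ (load is) R (size c))

size-E : ∀ {js} R is (c : Poly js) → size (E R is c) ≤ (1 + load is) ^ R * size c
size-E zero [] c = ≤-reflexive (sym (*-identityˡ _))
size-E {js} (suc R) [] c = ≤-trans (≤-reflexive (size-zeroP js)) z≤n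
size-E {js} zero ((p , κ) ∷ is) c rewrite size-zeroP (is ++ js) | *-zeroʳ κ | +-identityʳ (size (E zero is c)) = size-E zero is c
size-E (suc R) ((p , κ) ∷ is) c = ≤-trans (+-mono-≤ (size-E (suc R) is c) (*-monoʳ-≤ κ (size-E R is c))) (power-step κ (load is) R (size c))

hit-witness : ∀ n p κ → hit n p κ ≡ 0 ⊎ ∃ λ k → 1 ≤ k × k ≤ κ × p ∣ n + (p ∸ k)
hit-witness n p zero = inj₁ refl
hit-witness n p (suc κ) with p ∣? n + (p ∸ suc κ)
... | yes d = inj₂ (suc κ , s≤s z≤n , ≤-refl , d)
... | no _ with hit-witness n p κ
...   | inj₁ eq = inj₁ eq
...   | inj₂ (k , 1≤k , k≤κ , d) = inj₂ (k , 1≤k , m≤n⇒m≤1+n k≤κ , d)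

hit≡0⇒∤ : ∀ n p κ k → hit n p κ ≡ 0 → 1 ≤ k → k ≤ κ → ¬ p ∣ n + (p ∸ k)
hit≡0⇒∤ n p zero zero eq () k≤κ d
hit≡0⇒∤ n p (suc κ) k eq 1≤k k≤κ d with p ∣? n + (p ∸ suc κ) | m≤n⇒m<n∨m≡n k≤κ
... | no ¬d | inj₂ refl = ¬d d
... | no ¬d | inj₁ (s≤s k≤κ′) = hit≡0⇒∤ n p κ k eq 1≤k k≤κ′ d

-- Two hits would make p divide the difference of two distinct numbers from 1, ..., κ, which is
-- smaller than p.
hit≤1 : ∀ n p κ → κ < p → hit n p κ ≤ 1
hit≤1 n p zero κ<p = z≤n
hit≤1 n p (suc κ) κ<p with p ∣? n + (p ∸ suc κ)
... | no _ = hit≤1 n p κ (<-trans (n<1+n κ) κ<p)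
... | yes d with hit-witness n p κ
...   | inj₁ eq rewrite eq = ≤-refl
...   | inj₂ (k , 1≤k , k≤κ , d′) = contradiction (∣⇒≤ {{>-nonZero gap>0}} gap∣) (<⇒≱ gap<p)
  where
  gap = suc κ ∸ k
  gap>0 : 0 < gap
  gap>0 = m<n⇒0<n∸m (s≤s k≤κ)
  gap<p : gap < p
  gap<p = ≤-<-trans (m∸n≤m (suc κ) k) κ<p
  split : n + (p ∸ k) ≡ (n + (p ∸ suc κ)) + gap
  split = trans (cong (λ z → n + z) eq) (sym (+-assoc n _ gap))
    where
    eq : p ∸ k ≡ (p ∸ suc κ) + gap
    eq = begin
      p ∸ k                       ≡⟨ cong (_∸ k) (m∸n+n≡m (<⇒≤ κ<p)) ⟨
      (p ∸ suc κ) + suc κ ∸ k     ≡⟨ +-∸-assoc (p ∸ suc κ) (m≤n⇒m≤1+n k≤κ) ⟩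
      (p ∸ suc κ) + gap           ∎
      where open ≡-Reasoning
  gap∣ : p ∣ gap
  gap∣ = ∣m+n∣m⇒∣n (subst (p ∣_) split d′) d

Unhit : ℕ → List Item → Set
Unhit n = All (λ (p , κ) → hit n p κ ≡ 0)

module _ (n : ℕ) where
  open BlockValues (at n)

  unhit-or-void : ∀ is → Unhit n is ⊎ void is ≡ 0
  unhit-or-void [] = inj₁ []
  unhit-or-void ((p , κ) ∷ is) with hit n p κ in eq | unhit-or-void is
  ... | zero | inj₁ u = inj₁ (eq ∷ u)
  ... | zero | inj₂ v rewrite v = inj₂ refl
  ... | suc h | _ = inj₂ (cong (_* void is) (0∸n≡0 h))

  unhit⇒void : ∀ is → Unhit n is → void is ≡ 1
  unhit⇒void [] [] = refl
  unhit⇒void ((p , κ) ∷ is) (eq ∷ u) rewrite eq | unhit⇒void is u = refl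

  unhit⇒excess : ∀ R is → Unhit n is → excess (suc R) is ≡ 0
  unhit⇒excess R [] [] = refl
  unhit⇒excess R ((p , κ) ∷ is) (eq ∷ u) rewrite eq | unhit⇒excess R is u = refl

  unhit⇒weight : ∀ bs → Unhit n (flat bs) → weight bs ≡ 1
  unhit⇒weight [] _ = refl
  unhit⇒weight (b@(m , is) ∷ bs) u rewrite unhit⇒void is (Allₚ.++⁻ˡ is u) | unhit⇒excess (m + m) is (Allₚ.++⁻ˡ is u)
    | unhit⇒weight bs (Allₚ.++⁻ʳ is u) = refl

  defect<weight⇒unhit : ∀ bs → defect bs < weight bs → Unhit n (flat bs)
  defect<weight⇒unhit bs lt with unhit-or-void (flat bs)
  ... | inj₁ u = u
  ... | inj₂ v = contradiction (void≡0⇒weight≤defect bs v) (<⇒≱ lt)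

  proper-at : ∀ {is} → All (λ (p , κ) → κ < p) is → Proper is
  proper-at [] = []
  proper-at {(p , κ) ∷ _} (lt ∷ lts) = hit≤1 n p κ lt ∷ proper-at lts

-- The scaled product ∏ (1 + 2κ/p). It controls both the elementary functions and the inverse of the
-- void density.
grow : List Item → ℕ
grow [] = 1
grow ((p , κ) ∷ is) = (p + 2 * κ) * grow is

module Model where
  open BlockValues model public

  proper-model : ∀ {is} → All (λ (p , κ) → κ < p) is → Proper is
  proper-model = All.map <⇒≤

  -- `grow` is the generating function ∑ 2^R e_R, and every term is nonnegative.
  elem≤grow : ∀ R is → 2 ^ R * elem R is ≤ grow is
  elem≤grow zero [] = ≤-refl
  elem≤grow (suc R) [] = ≤-trans (≤-reflexive (*-zeroʳ (2 ^ suc R))) z≤n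
  elem≤grow zero ((p , κ) ∷ is) = begin
    1 * (p * elem 0 is)   ≡⟨ identity p (elem 0 is) ⟩
    p * (1 * elem 0 is)   ≤⟨ *-mono-≤ (m≤m+n p (2 * κ)) (elem≤grow 0 is) ⟩
    (p + 2 * κ) * grow is ∎
    where
    open ≤-Reasoning
    identity : ∀ p x → 1 * (p * x) ≡ p * (1 * x)
    identity = solve-∀
  elem≤grow (suc R) ((p , κ) ∷ is) = begin
    2 ^ suc R * (p * elem (suc R) is + κ * elem R is)             ≡⟨ identity (2 ^ R) p _ κ _ ⟩
    p * (2 ^ suc R * elem (suc R) is) + 2 * κ * (2 ^ R * elem R is) ≤⟨ +-mono-≤ (*-monoʳ-≤ p (elem≤grow (suc R) is)) (*-monoʳ-≤ (2 * κ) (elem≤grow R is)) ⟩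
    p * grow is + 2 * κ * grow is                                 ≡⟨ *-distribʳ-+ (grow is) p (2 * κ) ⟨
    (p + 2 * κ) * grow is                                         ∎
    where
    open ≤-Reasoning
    identity : ∀ t p x κ y → 2 * t * (p * x + κ * y) ≡ p * (2 * t * x) + 2 * κ * (t * y)
    identity = solve-∀

  -- This is (1 - x)⁻¹ ≤ 1 + 2x for x = κ/p ≤ 1/2.
  square-bound : ∀ p κ → 2 * κ ≤ p → p * p ≤ (p ∸ κ) * (p + 2 * κ)
  square-bound p κ 2κ≤p = go (p ∸ κ) κ≤ (sym (m∸n+n≡m κ≤p))
    where
    κ≤p : κ ≤ p
    κ≤p = ≤-trans (m≤m+n κ _) 2κ≤p
    κ≤ : κ ≤ p ∸ κ
    κ≤ = ≤-trans (≤-reflexive (trans (sym (+-identityʳ κ)) (sym (m+n∸m≡n κ (κ + 0))))) (∸-monoˡ-≤ κ 2κ≤p)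
    go : ∀ d → κ ≤ d → p ≡ d + κ → p * p ≤ d * (p + 2 * κ)
    go d κ≤d refl = begin
      (d + κ) * (d + κ)         ≡⟨ identity₁ d κ ⟩
      d * d + 2 * d * κ + κ * κ ≤⟨ +-monoʳ-≤ (d * d + 2 * d * κ) (*-monoˡ-≤ κ κ≤d) ⟩
      d * d + 2 * d * κ + d * κ ≡⟨ identity₂ d κ ⟩
      d * (d + κ + 2 * κ)       ∎
      where
      open ≤-Reasoning
      identity₁ : ∀ d κ → (d + κ) * (d + κ) ≡ d * d + 2 * d * κ + κ * κ
      identity₁ = solve-∀
      identity₂ : ∀ d κ → d * d + 2 * d * κ + d * κ ≡ d * (d + κ + 2 * κ)
      identity₂ = solve-∀

  modulus²≤void*grow : ∀ is → All (λ (p , κ) → 2 * κ ≤ p) is → modulus is * modulus is ≤ void is * grow is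
  modulus²≤void*grow [] [] = ≤-refl
  modulus²≤void*grow ((p , κ) ∷ is) (le ∷ les) = begin
    p * modulus is * (p * modulus is)               ≡⟨ *-interchange p (modulus is) p (modulus is) ⟩
    p * p * (modulus is * modulus is)               ≤⟨ *-mono-≤ (square-bound p κ le) (modulus²≤void*grow is les) ⟩
    (p ∸ κ) * (p + 2 * κ) * (void is * grow is)     ≡⟨ *-interchange (p ∸ κ) (p + 2 * κ) (void is) (grow is) ⟩
    (p ∸ κ) * void is * ((p + 2 * κ) * grow is)     ∎
    where
    open ≤-Reasoning
    *-interchange : ∀ a b c d → a * b * (c * d) ≡ a * c * (b * d)
    *-interchange = solve-∀

  modulus>0 : ∀ {is} → All (λ (p , κ) → 0 < p) is → 0 < modulus is
  modulus>0 [] = s≤s z≤n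
  modulus>0 (p>0 ∷ ps) = *-mono-≤ p>0 (modulus>0 ps)

  -- `growth` says ∏ (1 + 2κ/p) ≤ 2^(24κ), which expresses that ∑ 1/p over the block is bounded; 24
  -- is the 12 of `mertens` applied to 2κ. `wide` keeps the cost of omitting a prime at 4/3.
  record Good (κ : ℕ) (is : List Item) : Set where
    field
      wide   : All (λ i → 0 < proj₁ i × 4 * proj₂ i ≤ proj₁ i) is
      growth : grow is ≤ 2 ^ (24 * κ) * modulus is

  open Good public

  modulus≤void : ∀ {κ is} → Good κ is → modulus is ≤ 2 ^ (24 * κ) * void is
  modulus≤void {κ} {is} g = *-cancelˡ-≤ (modulus is) {{>-nonZero (modulus>0 (All.map proj₁ (wide g)))}} (begin
    modulus is * modulus is                     ≤⟨ modulus²≤void*grow is (All.map (λ {i} (_ , le) → ≤-trans (*-monoˡ-≤ (proj₂ i) {2} {4} (s≤s (s≤s z≤n))) le) (wide g)) ⟩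
    void is * grow is                           ≤⟨ *-monoʳ-≤ (void is) (growth g) ⟩
    void is * (2 ^ (24 * κ) * modulus is)       ≡⟨ identity (void is) (2 ^ (24 * κ)) (modulus is) ⟩
    modulus is * (2 ^ (24 * κ) * void is)       ∎)
    where
    open ≤-Reasoning
    identity : ∀ v t q → v * (t * q) ≡ q * (t * v)
    identity = solve-∀

  -- Passing from 2^R e_R to the modulus costs 2^(24κ), and passing from the modulus to `void` costs
  -- the same again; whatever `R` has beyond 48κ is gain.
  elem≤void : ∀ {κ is} → Good κ is → ∀ R t → 48 * κ + t ≤ R → 2 ^ t * elem R is ≤ void is
  elem≤void {κ} {is} g R t le = *-cancelˡ-≤ (2 ^ (48 * κ)) {{m^n≢0 2 (48 * κ)}} (begin
    2 ^ (48 * κ) * (2 ^ t * elem R is)                 ≡⟨ *-assoc (2 ^ (48 * κ)) (2 ^ t) (elem R is) ⟨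
    2 ^ (48 * κ) * 2 ^ t * elem R is                   ≡⟨ cong (_* elem R is) (^-distribˡ-+-* 2 (48 * κ) t) ⟨
    2 ^ (48 * κ + t) * elem R is                       ≤⟨ *-monoˡ-≤ (elem R is) (^-monoʳ-≤ 2 le) ⟩
    2 ^ R * elem R is                                  ≤⟨ elem≤grow R is ⟩
    grow is                                            ≤⟨ growth g ⟩
    2 ^ (24 * κ) * modulus is                          ≤⟨ *-monoʳ-≤ (2 ^ (24 * κ)) (modulus≤void g) ⟩
    2 ^ (24 * κ) * (2 ^ (24 * κ) * void is)            ≡⟨ *-assoc (2 ^ (24 * κ)) _ _ ⟨
    2 ^ (24 * κ) * 2 ^ (24 * κ) * void is              ≡⟨ cong (_* void is) (^-distribˡ-+-* 2 (24 * κ) (24 * κ)) ⟨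
    2 ^ (24 * κ + 24 * κ) * void is                    ≡⟨ cong (λ z → 2 ^ z * void is) (*-distribʳ-+ κ 24 24) ⟨
    2 ^ (48 * κ) * void is                             ∎)
    where open ≤-Reasoning

  -- The factors 2^(3+j) make the relative errors of the blocks summable to 1/4.
  Tame : ℕ → List Block → Set
  Tame j [] = ⊤
  Tame j (b ∷ bs) = 2 ^ (3 + j) * elem (order b) (proj₂ b) ≤ void (proj₂ b) × Tame (suc j) bs

  -- With t = 2^j the relative error is 1/(2t); the induction closes because (1 + 1/(8t))(1 +
  -- 1/(4t)) ≤ 1 + 1/(2t).
  weight≤void : ∀ j bs → Tame j bs → 2 * 2 ^ j * weight bs ≤ (2 * 2 ^ j + 1) * void (flat bs)
  weight≤void j [] _ = *-monoˡ-≤ 1 (m≤m+n (2 * 2 ^ j) 1)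
  weight≤void j (b@(m , is) ∷ bs) (tame , tames) = *-cancelˡ-≤ (16 * t) {{>-nonZero (*-mono-≤ {1} {16} (s≤s z≤n) t>0)}} (begin
    16 * t * (2 * t * (factor b * weight bs))                     ≡⟨ identity₁ t (factor b) (weight bs) ⟩
    (8 * t * factor b) * (2 * (2 * t) * weight bs)                ≤⟨ *-mono-≤ fb (weight≤void (suc j) bs tames) ⟩
    ((8 * t + 1) * void is) * ((2 * (2 * t) + 1) * void (flat bs)) ≡⟨ identity₂ t (void is) (void (flat bs)) ⟩
    (32 * t * t + 12 * t + 1) * (void is * void (flat bs))        ≤⟨ *-monoˡ-≤ (void is * void (flat bs)) (+-monoʳ-≤ (32 * t * t + 12 * t) (≤-trans t>0 (m≤m+n t (3 * t)))) ⟩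
    (32 * t * t + 12 * t + (t + 3 * t)) * (void is * void (flat bs)) ≡⟨ identity₃ t (void is * void (flat bs)) ⟩
    16 * t * ((2 * t + 1) * (void is * void (flat bs)))           ≡⟨ cong (λ z → 16 * t * ((2 * t + 1) * z)) (void-++ is (flat bs)) ⟨
    16 * t * ((2 * t + 1) * void (is ++ flat bs))                 ∎)
    where
    open ≤-Reasoning
    t = 2 ^ j
    t>0 : 0 < t
    t>0 = m^n>0 2 j
    fb : 8 * t * factor b ≤ (8 * t + 1) * void is
    fb = begin
      8 * t * (void is + excess (order b) is)     ≡⟨ *-distribˡ-+ (8 * t) (void is) _ ⟩
      8 * t * void is + 8 * t * excess (order b) is ≤⟨ +-monoʳ-≤ (8 * t * void is) (≤-trans (*-monoʳ-≤ (8 * t) (excess≤elem (order b) is))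
                                                      (≤-trans (≤-reflexive (cong (_* elem (order b) is) (eight t))) tame)) ⟩
      8 * t * void is + void is                   ≡⟨ identity t (void is) ⟩
      (8 * t + 1) * void is                       ∎
      where
      eight : ∀ t → 8 * t ≡ 2 * (2 * (2 * t))
      eight = solve-∀
      identity : ∀ t v → 8 * t * v + v ≡ (8 * t + 1) * v
      identity = solve-∀
    identity₁ : ∀ t f w → 16 * t * (2 * t * (f * w)) ≡ (8 * t * f) * (2 * (2 * t) * w)
    identity₁ = solve-∀
    identity₂ : ∀ t v u → ((8 * t + 1) * v) * ((2 * (2 * t) + 1) * u) ≡ (32 * t * t + 12 * t + 1) * (v * u)
    identity₂ = solve-∀
    identity₃ : ∀ t v → (32 * t * t + 12 * t + (t + 3 * t)) * v ≡ 16 * t * ((2 * t + 1) * v)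
    identity₃ = solve-∀

  -- With t = 2^j the first block and all later blocks contribute at most 1/(8t) of the weight each.
  defect≤weight : ∀ j bs → Tame j bs → 4 * 2 ^ j * defect bs ≤ weight bs
  defect≤weight j [] _ = ≤-trans (≤-reflexive (*-zeroʳ (4 * 2 ^ j))) z≤n
  defect≤weight j (b@(m , is) ∷ bs) (tame , tames) = *-cancelˡ-≤ 2 (begin
    2 * (4 * t * (elem (order b) is * weight bs + factor b * defect bs))  ≡⟨ identity₁ t (elem (order b) is) (weight bs) (factor b) (defect bs) ⟩
    (2 * (2 * (2 * t)) * elem (order b) is) * weight bs + factor b * (4 * (2 * t) * defect bs) ≤⟨ +-mono-≤ (*-monoˡ-≤ (weight bs) (≤-trans tame (m≤m+n _ _))) (*-monoʳ-≤ (factor b) (defect≤weight (suc j) bs tames)) ⟩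
    factor b * weight bs + factor b * weight bs                            ≡⟨ identity₂ (factor b * weight bs) ⟩
    2 * (factor b * weight bs)                                             ∎)
    where
    open ≤-Reasoning
    t = 2 ^ j
    identity₁ : ∀ t e w f d → 2 * (4 * t * (e * w + f * d)) ≡ (2 * (2 * (2 * t)) * e) * w + f * (4 * (2 * t) * d)
    identity₁ = solve-∀
    identity₂ : ∀ x → x + x ≡ 2 * x
    identity₂ = solve-∀

-- Omitting primes from the sieve

remove : ℕ → List Item → List Item
remove q = filter (λ i → ¬? (proj₁ i ≟ q))

removeB : ℕ → List Block → List Block
removeB q = map (λ (m , is) → m , remove q is)

-- Omits the items of the primes in qs, making the sieve independent of divisibility by product qs.
keep : List ℕ → List Block → List Block
keep [] bs = bs
keep (q ∷ qs) bs = removeB q (keep qs bs)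

flat-removeB : ∀ q bs → flat (removeB q bs) ≡ remove q (flat bs)
flat-removeB q [] = refl
flat-removeB q ((m , is) ∷ bs) = trans (cong (remove q is ++_) (flat-removeB q bs)) (sym (filter-++ _ is (flat bs)))

All-keep : ∀ {P : Item → Set} qs bs → All P (flat bs) → All P (flat (keep qs bs))
All-keep [] bs ps = ps
All-keep (q ∷ qs) bs ps = subst (All _) (sym (flat-removeB q (keep qs bs))) (Allₚ.filter⁺ _ (All-keep qs bs ps))

AllPairs-keep : ∀ {R : Item → Item → Set} qs bs → AllPairs R (flat bs) → AllPairs R (flat (keep qs bs))
AllPairs-keep [] bs ps = ps
AllPairs-keep (q ∷ qs) bs ps = subst (AllPairs _) (sym (flat-removeB q (keep qs bs))) (AllPairsₚ.filter⁺ _ (AllPairs-keep qs bs ps))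

keep-avoids : ∀ qs bs → All (λ i → All (λ q → proj₁ i ≢ q) qs) (flat (keep qs bs))
keep-avoids [] bs = All.universal (λ _ → []) (flat bs)
keep-avoids (q ∷ qs) bs rewrite flat-removeB q (keep qs bs) =
  All.zipWith (λ (x , y) → x ∷ y) (Allₚ.all-filter _ (flat (keep qs bs)) , Allₚ.filter⁺ _ (keep-avoids qs bs))

module Removal where
  open Model

  -- Every omitted factor 1 + 2κ/p of the ratio `grow` to `modulus` is at least 1, so goodness
  -- passes to the smaller block.
  remove-growth : ∀ q is → grow (remove q is) * modulus is ≤ grow is * modulus (remove q is)
  remove-growth q [] = ≤-refl
  remove-growth q ((p , κ) ∷ is) with p ≟ q
  ... | yes p≡q rewrite filter-reject (λ i → ¬? (proj₁ i ≟ q)) {x = p , κ} {xs = is} (λ p≢q → p≢q p≡q) = begin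
    grow (remove q is) * (p * modulus is)                   ≡⟨ identity (grow (remove q is)) p (modulus is) ⟩
    p * (grow (remove q is) * modulus is)                   ≤⟨ *-mono-≤ (m≤m+n p (2 * κ)) (remove-growth q is) ⟩
    (p + 2 * κ) * (grow is * modulus (remove q is))         ≡⟨ *-assoc (p + 2 * κ) (grow is) _ ⟨
    (p + 2 * κ) * grow is * modulus (remove q is)           ∎
    where
    open ≤-Reasoning
    identity : ∀ a b c → a * (b * c) ≡ b * (a * c)
    identity = solve-∀
  ... | no p≢q rewrite filter-accept (λ i → ¬? (proj₁ i ≟ q)) {x = p , κ} {xs = is} p≢q = begin
    (p + 2 * κ) * grow (remove q is) * (p * modulus is)     ≡⟨ identity (p + 2 * κ) (grow (remove q is)) p (modulus is) ⟩
    (p + 2 * κ) * p * (grow (remove q is) * modulus is)     ≤⟨ *-monoʳ-≤ ((p + 2 * κ) * p) (remove-growth q is) ⟩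
    (p + 2 * κ) * p * (grow is * modulus (remove q is))     ≡⟨ identity (p + 2 * κ) (grow is) p (modulus (remove q is)) ⟨
    (p + 2 * κ) * grow is * (p * modulus (remove q is))     ∎
    where
    open ≤-Reasoning
    identity : ∀ a b c d → a * b * (c * d) ≡ a * c * (b * d)
    identity = solve-∀

  good-remove : ∀ {κ is} q → Good κ is → Good κ (remove q is)
  good-remove {κ} {is} q g = record
    { wide = Allₚ.filter⁺ _ (wide g)
    ; growth = *-cancelˡ-≤ (modulus is) {{>-nonZero (modulus>0 (All.map proj₁ (wide g)))}} (begin
        modulus is * grow (remove q is)                       ≡⟨ *-comm (modulus is) _ ⟩
        grow (remove q is) * modulus is                       ≤⟨ remove-growth q is ⟩
        grow is * modulus (remove q is)                       ≤⟨ *-monoˡ-≤ (modulus (remove q is)) (growth g) ⟩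
        2 ^ (24 * κ) * modulus is * modulus (remove q is)     ≡⟨ identity (2 ^ (24 * κ)) (modulus is) (modulus (remove q is)) ⟩
        modulus is * (2 ^ (24 * κ) * modulus (remove q is))   ∎) }
    where
    open ≤-Reasoning
    identity : ∀ a b c → a * b * c ≡ b * (a * c)
    identity = solve-∀

  -- At most one item belongs to `q`, and without it the void density loses the factor 1 - κ/q ≥
  -- 3/4.
  remove-void : ∀ q is → All (λ i → 4 * proj₂ i ≤ proj₁ i) is → AllPairs (λ i j → proj₁ i ≢ proj₁ j) is →
              3 * (void (remove q is) * modulus is) ≤ 4 * (void is * modulus (remove q is))
  remove-void q [] _ _ = s≤s (s≤s (s≤s z≤n))
  remove-void q ((p , κ) ∷ is) (le ∷ les) (new ∷ pairs) with p ≟ q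
  ... | yes refl rewrite filter-reject (λ i → ¬? (proj₁ i ≟ p)) {x = p , κ} {xs = is} (λ p≢p → p≢p refl) | filter-all (λ i → ¬? (proj₁ i ≟ p)) (All.map (λ ne eq → ne (sym eq)) new) = begin
    3 * (void is * (p * modulus is))        ≡⟨ identity₁ (void is) p (modulus is) ⟩
    3 * p * (void is * modulus is)          ≤⟨ *-monoˡ-≤ (void is * modulus is) three-quarters ⟩
    4 * (p ∸ κ) * (void is * modulus is)    ≡⟨ identity₂ (p ∸ κ) (void is) (modulus is) ⟩
    4 * ((p ∸ κ) * void is * modulus is)    ∎
    where
    open ≤-Reasoning
    identity₁ : ∀ a b c → 3 * (a * (b * c)) ≡ 3 * b * (a * c)
    identity₁ = solve-∀
    identity₂ : ∀ a b c → 4 * a * (b * c) ≡ 4 * (a * b * c)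
    identity₂ = solve-∀
    three-quarters : 3 * p ≤ 4 * (p ∸ κ)
    three-quarters = begin
      3 * p             ≡⟨ m+n∸m≡n p (3 * p) ⟨
      4 * p ∸ p         ≤⟨ ∸-monoʳ-≤ (4 * p) le ⟩
      4 * p ∸ 4 * κ     ≡⟨ *-distribˡ-∸ 4 p κ ⟨
      4 * (p ∸ κ)       ∎
  ... | no p≢q rewrite filter-accept (λ i → ¬? (proj₁ i ≟ q)) {x = p , κ} {xs = is} p≢q = begin
    3 * ((p ∸ κ) * void (remove q is) * (p * modulus is))     ≡⟨ identity 3 (p ∸ κ) (void (remove q is)) p (modulus is) ⟩
    (p ∸ κ) * p * (3 * (void (remove q is) * modulus is))     ≤⟨ *-monoʳ-≤ ((p ∸ κ) * p) (remove-void q is les pairs) ⟩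
    (p ∸ κ) * p * (4 * (void is * modulus (remove q is)))     ≡⟨ identity 4 (p ∸ κ) (void is) p (modulus (remove q is)) ⟨
    4 * ((p ∸ κ) * void is * (p * modulus (remove q is)))     ∎
    where
    open ≤-Reasoning
    identity : ∀ n a b c d → n * (a * b * (c * d)) ≡ a * c * (n * (b * d))
    identity = solve-∀

-- Primes in dyadic intervals

interval : ℕ → ℕ → List ℕ
interval a zero = []
interval a (suc l) = suc a ∷ interval (suc a) l

interval-bounds : ∀ a l → All (λ n → a < n × n ≤ a + l) (interval a l)
interval-bounds a zero = []
interval-bounds a (suc l) = (≤-refl , ≤-trans (s≤s (m≤m+n a l)) (≤-reflexive (sym (+-suc a l))))
  ∷ All.map (λ (lo , hi) → <-trans (n<1+n a) lo , ≤-trans hi (≤-reflexive (sym (+-suc a l)))) (interval-bounds (suc a) l)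

∈-interval : ∀ {n} a l → a < n → n ≤ a + l → n ∈ interval a l
∈-interval a zero lo hi = contradiction (≤-trans hi (≤-reflexive (+-identityʳ a))) (<⇒≱ lo)
∈-interval {n} a (suc l) lo hi with m≤n⇒m<n∨m≡n lo
... | inj₂ refl = here refl
... | inj₁ lo′ = there (∈-interval (suc a) l lo′ (≤-trans hi (≤-reflexive (+-suc a l))))

interval-increasing : ∀ a l → AllPairs _<_ (interval a l)
interval-increasing a zero = []
interval-increasing a (suc l) = All.map proj₁ (interval-bounds (suc a) l) ∷ interval-increasing (suc a) l

length-interval : ∀ a l → length (interval a l) ≡ l
length-interval a zero = refl
length-interval a (suc l) = cong suc (length-interval (suc a) l)

dyadic : ℕ → List ℕ
dyadic i = filter prime? (interval (2 ^ i) (2 ^ i))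

span : ℕ → ℕ → List ℕ
span a zero = []
span a (suc l) = dyadic a ++ span (suc a) l

double : ∀ i → 2 ^ i + 2 ^ i ≡ 2 ^ suc i
double i = cong (_+_ (2 ^ i)) (sym (+-identityʳ _))

dyadic-bounds : ∀ i → All (λ p → 2 ^ i < p × p ≤ 2 ^ suc i) (dyadic i)
dyadic-bounds i = Allₚ.filter⁺ prime? (All.map (λ (lo , hi) → lo , ≤-trans hi (≤-reflexive (double i))) (interval-bounds (2 ^ i) (2 ^ i)))

span-bounds : ∀ a l → All (λ p → 2 ^ a < p × p ≤ 2 ^ (a + l)) (span a l)
span-bounds a zero = []
span-bounds a (suc l) = Allₚ.++⁺
  (All.map (λ (lo , hi) → lo , ≤-trans hi (^-monoʳ-≤ 2 (≤-trans (s≤s (m≤m+n a l)) (≤-reflexive (sym (+-suc a l)))))) (dyadic-bounds a))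
  (All.map (λ (lo , hi) → ≤-<-trans (^-monoʳ-≤ 2 (n≤1+n a)) lo , ≤-trans hi (≤-reflexive (cong (2 ^_) (sym (+-suc a l))))) (span-bounds (suc a) l))

span-primes : ∀ a l → All Prime (span a l)
span-primes a zero = []
span-primes a (suc l) = Allₚ.++⁺ (Allₚ.all-filter prime? (interval (2 ^ a) (2 ^ a))) (span-primes (suc a) l)

∈-span : ∀ {p} a l → Prime p → 2 ^ a < p → p ≤ 2 ^ (a + l) → p ∈ span a l
∈-span a zero pr lo hi = contradiction (≤-trans hi (≤-reflexive (cong (2 ^_) (+-identityʳ a)))) (<⇒≱ lo)
∈-span {p} a (suc l) pr lo hi with p ≤? 2 ^ suc a
... | yes le = ∈-++⁺ˡ (∈-filter⁺ prime? (∈-interval (2 ^ a) (2 ^ a) lo (≤-trans le (≤-reflexive (sym (double a))))) pr)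
... | no gt = ∈-++⁺ʳ (dyadic a) (∈-span (suc a) l pr (≰⇒> gt) (≤-trans hi (≤-reflexive (cong (2 ^_) (+-suc a l)))))

dyadic-increasing : ∀ i → AllPairs _<_ (dyadic i)
dyadic-increasing i = AllPairsₚ.filter⁺ prime? (interval-increasing (2 ^ i) (2 ^ i))

span-increasing : ∀ a l → AllPairs _<_ (span a l)
span-increasing a zero = []
span-increasing a (suc l) = AllPairsₚ.++⁺ (dyadic-increasing a) (span-increasing (suc a) l)
  (All.map (λ (_ , hi) → All.map (λ (lo , _) → ≤-<-trans hi lo) (span-bounds (suc a) l)) (dyadic-bounds a))

-- Bounds of Chebyshev and Mertens type

prime∤⇒coprime : ∀ {p n} → Prime p → ¬ p ∣ n → Coprime p n
prime∤⇒coprime pr p∤n (d∣p , d∣n) with prime⇒irreducible pr d∣p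
... | inj₁ d≡1 = d≡1
... | inj₂ refl = contradiction d∣n p∤n

distinct-primes-∣ : ∀ {n} ps → All Prime ps → AllPairs _<_ ps → All (_∣ n) ps → product ps ∣ n
distinct-primes-∣ [] _ _ _ = 1∣ _
distinct-primes-∣ (p ∷ ps) (pr ∷ prs) (p< ∷ incr) (p∣n ∷ ps∣n) =
  coprime⇒*∣ (prime∤⇒coprime pr (λ d → <-irrefl refl (All.lookup p< (factorisationHasAllPrimeFactors pr d prs))))
    p∣n (distinct-primes-∣ ps prs incr ps∣n)

n∣m! : ∀ {n m} → 0 < n → n ≤ m → n ∣ m !
n∣m! {suc n} (s≤s _) n≤m = ∣-trans (m∣m*n (n !)) (m≤n⇒m!∣n! n≤m)

prime∣!⇒≤ : ∀ {p} m → Prime p → p ∣ m ! → p ≤ m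
prime∣!⇒≤ zero pr d = contradiction (subst Prime (∣1⇒≡1 d) pr) ¬prime[1]
prime∣!⇒≤ (suc m) pr d with euclidsLemma (suc m) (m !) pr d
... | inj₁ d′ = ∣⇒≤ d′
... | inj₂ d′ = m≤n⇒m≤1+n (prime∣!⇒≤ m pr d′)

nCk≤2^n : ∀ n k → n choose k ≤ 2 ^ n
nCk≤2^n n zero = m^n>0 2 n
nCk≤2^n zero (suc k) = ≤-trans (≤-reflexive (k>n⇒nCk≡0 {zero} {suc k} (s≤s z≤n))) z≤n
nCk≤2^n (suc n) (suc k) = begin
  suc n choose suc k           ≡⟨ nCk+nC[k+1]≡[n+1]C[k+1] n k ⟨
  n choose k + n choose suc k       ≤⟨ +-mono-≤ (nCk≤2^n n k) (nCk≤2^n n (suc k)) ⟩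
  2 ^ n + 2 ^ n           ≡⟨ double n ⟩
  2 ^ suc n               ∎
  where open ≤-Reasoning

central-binomial : ∀ m → ((m + m) choose m) * (m ! * m !) ≡ (m + m) !
central-binomial m = begin
  ((m + m) choose m) * (m ! * m !)              ≡⟨ cong (λ z → ((m + m) choose m) * (m ! * z !)) (m+n∸n≡m m m) ⟨
  ((m + m) choose m) * (m ! * (m + m ∸ m) !)    ≡⟨ cong (_* (m ! * (m + m ∸ m) !)) (nCk≡n!/k![n-k]! (m≤m+n m m)) ⟩
  _                                      ≡⟨ m/n*n≡m {{m !* (m + m ∸ m) !≢0}} (k![n∸k]!∣n! (m≤m+n m m)) ⟩
  (m + m) !                              ∎
  where open ≡-Reasoning

prime∣central-binomial : ∀ {p m} → Prime p → m < p → p ≤ m + m → p ∣ (m + m) choose m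
prime∣central-binomial {p} {m} pr m<p p≤2m with euclidsLemma ((m + m) choose m) (m ! * m !) pr
    (subst (p ∣_) (sym (central-binomial m)) (n∣m! (<-≤-trans (s≤s z≤n) m<p) p≤2m))
... | inj₁ d = d
... | inj₂ d with euclidsLemma (m !) (m !) pr d
...   | inj₁ d′ = contradiction (prime∣!⇒≤ m pr d′) (<⇒≱ m<p)
...   | inj₂ d′ = contradiction (prime∣!⇒≤ m pr d′) (<⇒≱ m<p)

product-≥ : ∀ {m} ps → All (m <_) ps → m ^ length ps ≤ product ps
product-≥ [] [] = ≤-refl
product-≥ (p ∷ ps) (m<p ∷ ps>) = *-mono-≤ (<⇒≤ m<p) (product-≥ ps ps>)

^-cancelʳ-≤ : ∀ m {x y} → 1 < m → m ^ x ≤ m ^ y → x ≤ y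
^-cancelʳ-≤ m {x} {y} 1<m le with x ≤? y
... | yes x≤y = x≤y
... | no x≰y = contradiction le (<⇒≱ (^-monoʳ-< m 1<m (≰⇒> x≰y)))

^-cancelˡ-≤ : ∀ n {x y} → 0 < n → x ^ n ≤ y ^ n → x ≤ y
^-cancelˡ-≤ n {x} {y} 0<n le with x ≤? y
... | yes x≤y = x≤y
... | no x≰y = contradiction le (<⇒≱ (^-monoˡ-< n {{>-nonZero 0<n}} (≰⇒> x≰y)))

-- With m = 2^i, the primes in (m, 2m] all exceed m, and their product divides the central binomial
-- coefficient, which is at most 2^(2m).
chebyshev : ∀ i → i * length (dyadic i) ≤ 2 * 2 ^ i
chebyshev i = ^-cancelʳ-≤ 2 (s≤s (s≤s z≤n)) (begin
  2 ^ (i * length (dyadic i))       ≡⟨ ^-*-assoc 2 i (length (dyadic i)) ⟨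
  (2 ^ i) ^ length (dyadic i)       ≤⟨ product-≥ (dyadic i) (All.map proj₁ (dyadic-bounds i)) ⟩
  product (dyadic i)                ≤⟨ ∣⇒≤ {{>-nonZero binomial>0}} (distinct-primes-∣ (dyadic i) primes (dyadic-increasing i) divisors) ⟩
  (m + m) choose m                         ≤⟨ nCk≤2^n (m + m) m ⟩
  2 ^ (m + m)                       ≡⟨ cong (λ z → 2 ^ (m + z)) (+-identityʳ m) ⟨
  2 ^ (2 * m)                       ∎)
  where
  open ≤-Reasoning
  m = 2 ^ i
  primes = Allₚ.all-filter prime? (interval m m)
  divisors : All (_∣ (m + m) choose m) (dyadic i)
  divisors = All.zipWith (λ (pr , lo , hi) → prime∣central-binomial pr lo (≤-trans hi (≤-reflexive (sym (double i))))) (primes , dyadic-bounds i)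
  binomial>0 : 0 < (m + m) choose m
  binomial>0 with (m + m) choose m in eq
  ... | zero = contradiction (trans (sym (central-binomial m)) (cong (_* (m ! * m !)) eq)) λ z → m<n⇒n≢0 (1≤n! (m + m)) z
  ... | suc _ = s≤s z≤n

-- Bernoulli's inequality (1 - 1/(1 + m))^h ≥ 1 - h/(1 + m), multiplied by (1 + m)^(h + 1).
bernoulli : ∀ m h → (1 + m) ^ h * (1 + m) ≤ m ^ h * (1 + m) + h * (1 + m) ^ h
bernoulli m zero = m≤m+n _ _
bernoulli m (suc h) = begin
  (1 + m) * x * (1 + m)                                   ≡⟨ identity₁ m x ⟩
  m * (x * (1 + m)) + x * (1 + m)                         ≤⟨ +-monoˡ-≤ (x * (1 + m)) (*-monoʳ-≤ m (bernoulli m h)) ⟩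
  m * (m ^ h * (1 + m) + h * x) + x * (1 + m)             ≤⟨ m≤m+n _ (h * x) ⟩
  m * (m ^ h * (1 + m) + h * x) + x * (1 + m) + h * x     ≡⟨ identity₂ m x (m ^ h) h ⟩
  m * m ^ h * (1 + m) + suc h * ((1 + m) * x)             ∎
  where
  open ≤-Reasoning
  x = (1 + m) ^ h
  identity₁ : ∀ m x → (1 + m) * x * (1 + m) ≡ m * (x * (1 + m)) + x * (1 + m)
  identity₁ = solve-∀
  identity₂ : ∀ m x y h → m * (y * (1 + m) + h * x) + x * (1 + m) + h * x ≡ m * y * (1 + m) + (1 + h) * ((1 + m) * x)
  identity₂ = solve-∀

-- (1 + 1/m)^h ≤ 2 for m = 2h; squaring gives (1 + 1/m)^m ≤ 4.
half-power : ∀ h → (1 + 2 * h) ^ h ≤ 2 * (2 * h) ^ h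
half-power h = *-cancelʳ-≤ x (2 * (2 * h) ^ h) (1 + 2 * h) (+-cancelˡ-≤ (2 * h * x) _ _ (begin
  2 * h * x + x * (1 + 2 * h)                      ≤⟨ +-monoʳ-≤ (2 * h * x) (m≤m+n _ x) ⟩
  2 * h * x + (x * (1 + 2 * h) + x)                ≡⟨ identity₁ h x ⟩
  2 * (x * (1 + 2 * h))                            ≤⟨ *-monoʳ-≤ 2 (bernoulli (2 * h) h) ⟩
  2 * ((2 * h) ^ h * (1 + 2 * h) + h * x)          ≡⟨ identity₂ h x ((2 * h) ^ h) ⟩
  2 * h * x + 2 * (2 * h) ^ h * (1 + 2 * h)        ∎))
  where
  open ≤-Reasoning
  x = (1 + 2 * h) ^ h
  identity₁ : ∀ h x → 2 * h * x + (x * (1 + 2 * h) + x) ≡ 2 * (x * (1 + 2 * h))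
  identity₁ = solve-∀
  identity₂ : ∀ h x y → 2 * (y * (1 + 2 * h) + h * x) ≡ 2 * h * x + 2 * y * (1 + 2 * h)
  identity₂ = solve-∀

^-2* : ∀ x h → x ^ (2 * h) ≡ x ^ h * x ^ h
^-2* x h = trans (cong (λ z → x ^ (h + z)) (+-identityʳ h)) (^-distribˡ-+-* x h h)

suc-power : ∀ i → (1 + 2 ^ i) ^ (2 ^ i) ≤ 4 * (2 ^ i) ^ (2 ^ i)
suc-power zero = s≤s (s≤s z≤n)
suc-power (suc i) = begin
  (1 + 2 * h) ^ (2 * h)                       ≡⟨ ^-2* (1 + 2 * h) h ⟩
  (1 + 2 * h) ^ h * (1 + 2 * h) ^ h           ≤⟨ *-mono-≤ (half-power h) (half-power h) ⟩
  2 * (2 * h) ^ h * (2 * (2 * h) ^ h)         ≡⟨ identity ((2 * h) ^ h) ⟩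
  4 * ((2 * h) ^ h * (2 * h) ^ h)             ≡⟨ cong (4 *_) (^-2* (2 * h) h) ⟨
  4 * (2 * h) ^ (2 * h)                       ∎
  where
  open ≤-Reasoning
  h = 2 ^ i
  identity : ∀ y → 2 * y * (2 * y) ≡ 4 * (y * y)
  identity = solve-∀

*-^ : ∀ a b n → (a * b) ^ n ≡ a ^ n * b ^ n
*-^ a b zero = refl
*-^ a b (suc n) rewrite *-^ a b n = identity a b (a ^ n) (b ^ n)
  where
  identity : ∀ a b x y → a * b * (x * y) ≡ a * x * (b * y)
  identity = solve-∀

-- This is (1 + κ/m)^m ≤ 4^κ for m = 2^i, by induction from 1 + (κ + 1)/m ≤ (1 + κ/m)(1 + 1/m).
shift-power : ∀ i κ → (2 ^ i + κ) ^ (2 ^ i) ≤ 4 ^ κ * (2 ^ i) ^ (2 ^ i)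
shift-power i zero = ≤-reflexive (trans (cong (_^ (2 ^ i)) (+-identityʳ (2 ^ i))) (sym (*-identityˡ _)))
shift-power i (suc κ) = *-cancelʳ-≤ ((m + suc κ) ^ m) (4 ^ suc κ * m ^ m) (m ^ m) {{m^n≢0 m m {{m^n≢0 2 i}}}} (begin
  (m + suc κ) ^ m * m ^ m             ≡⟨ *-^ (m + suc κ) m m ⟨
  ((m + suc κ) * m) ^ m               ≤⟨ ^-monoˡ-≤ m (begin
    (m + suc κ) * m                     ≤⟨ m≤m+n _ κ ⟩
    (m + suc κ) * m + κ                 ≡⟨ identity₁ m κ ⟩
    (m + κ) * (1 + m)                   ∎) ⟩
  ((m + κ) * (1 + m)) ^ m             ≡⟨ *-^ (m + κ) (1 + m) m ⟩
  (m + κ) ^ m * (1 + m) ^ m           ≤⟨ *-mono-≤ (shift-power i κ) (suc-power i) ⟩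
  4 ^ κ * m ^ m * (4 * m ^ m)         ≡⟨ identity₂ (4 ^ κ) (m ^ m) ⟩
  4 ^ suc κ * m ^ m * m ^ m           ∎)
  where
  open ≤-Reasoning
  m = 2 ^ i
  identity₁ : ∀ m κ → (m + (1 + κ)) * m + κ ≡ (m + κ) * (1 + m)
  identity₁ = solve-∀
  identity₂ : ∀ t x → t * x * (4 * x) ≡ 4 * t * x * x
  identity₂ = solve-∀

∏ : (ℕ → ℕ) → List ℕ → ℕ
∏ f ps = product (map f ps)

∏-++ : ∀ f ps qs → ∏ f (ps ++ qs) ≡ ∏ f ps * ∏ f qs
∏-++ f ps qs = trans (cong product (map-++ f ps qs)) (product-++ (map f ps) (map f qs))

shifted-product : ∀ m κ ps → All (m <_) ps → ∏ (_+ κ) ps * m ^ length ps ≤ product ps * (m + κ) ^ length ps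
shifted-product m κ [] [] = ≤-refl
shifted-product m κ (p ∷ ps) (m<p ∷ ps>) = begin
  (p + κ) * ∏ (_+ κ) ps * (m * m ^ length ps)                 ≡⟨ identity (p + κ) _ m _ ⟩
  (p + κ) * m * (∏ (_+ κ) ps * m ^ length ps)                 ≤⟨ *-mono-≤ one (shifted-product m κ ps ps>) ⟩
  p * (m + κ) * (product ps * (m + κ) ^ length ps)            ≡⟨ identity p (product ps) (m + κ) ((m + κ) ^ length ps) ⟨
  p * product ps * ((m + κ) * (m + κ) ^ length ps)            ∎
  where
  open ≤-Reasoning
  identity : ∀ a b c d → a * b * (c * d) ≡ a * c * (b * d)
  identity = solve-∀
  one : (p + κ) * m ≤ p * (m + κ)
  one = begin
    (p + κ) * m     ≡⟨ *-distribʳ-+ m p κ ⟩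
    p * m + κ * m   ≤⟨ +-monoʳ-≤ (p * m) (≤-trans (*-monoʳ-≤ κ (<⇒≤ m<p)) (≤-reflexive (*-comm κ p))) ⟩
    p * m + p * κ   ≡⟨ *-distribˡ-+ p m κ ⟨
    p * (m + κ)     ∎

-- With N · a ≤ c · m the ratio ((m + κ)/m)^(N a) is at most ((m + κ)/m)^(c m) ≤ 4^(c κ).
dyadic-power : ∀ i κ a c → length (dyadic i) * a ≤ c * 2 ^ i →
               ∏ (_+ κ) (dyadic i) ^ a ≤ product (dyadic i) ^ a * 4 ^ (c * κ)
dyadic-power i κ a c le = *-cancelʳ-≤ (A ^ a) (B ^ a * 4 ^ (c * κ)) (m ^ (c * m)) {{m^n≢0 m (c * m) {{m^n≢0 2 i}}}} (begin
  A ^ a * m ^ (c * m)                                   ≡⟨ cong (λ z → A ^ a * m ^ z) (m+[n∸m]≡n le) ⟨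
  A ^ a * m ^ (N * a + r)                               ≡⟨ cong (A ^ a *_) (^-distribˡ-+-* m (N * a) r) ⟩
  A ^ a * (m ^ (N * a) * m ^ r)                         ≡⟨ *-assoc (A ^ a) (m ^ (N * a)) (m ^ r) ⟨
  A ^ a * m ^ (N * a) * m ^ r                           ≡⟨ cong (_* m ^ r) (trans (cong (A ^ a *_) (sym (^-*-assoc m N a))) (sym (*-^ A (m ^ N) a))) ⟩
  (A * m ^ N) ^ a * m ^ r                               ≤⟨ *-mono-≤ (^-monoˡ-≤ a (shifted-product m κ (dyadic i) (All.map proj₁ (dyadic-bounds i)))) (^-monoˡ-≤ r (m≤m+n m κ)) ⟩
  (B * (m + κ) ^ N) ^ a * (m + κ) ^ r                   ≡⟨ cong (_* (m + κ) ^ r) (trans (*-^ B ((m + κ) ^ N) a) (cong (B ^ a *_) (^-*-assoc (m + κ) N a))) ⟩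
  B ^ a * (m + κ) ^ (N * a) * (m + κ) ^ r               ≡⟨ *-assoc (B ^ a) _ _ ⟩
  B ^ a * ((m + κ) ^ (N * a) * (m + κ) ^ r)             ≡⟨ cong (B ^ a *_) (^-distribˡ-+-* (m + κ) (N * a) r) ⟨
  B ^ a * (m + κ) ^ (N * a + r)                         ≡⟨ cong (λ z → B ^ a * (m + κ) ^ z) (m+[n∸m]≡n le) ⟩
  B ^ a * (m + κ) ^ (c * m)                             ≡⟨ cong (λ z → B ^ a * (m + κ) ^ z) (*-comm c m) ⟩
  B ^ a * (m + κ) ^ (m * c)                             ≡⟨ cong (B ^ a *_) (^-*-assoc (m + κ) m c) ⟨
  B ^ a * ((m + κ) ^ m) ^ c                             ≤⟨ *-monoʳ-≤ (B ^ a) (^-monoˡ-≤ c (shift-power i κ)) ⟩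
  B ^ a * (4 ^ κ * m ^ m) ^ c                           ≡⟨ cong (B ^ a *_) (trans (*-^ (4 ^ κ) (m ^ m) c)
                                                             (cong₂ _*_ (trans (^-*-assoc 4 κ c) (cong (4 ^_) (*-comm κ c))) (trans (^-*-assoc m m c) (cong (m ^_) (*-comm m c))))) ⟩
  B ^ a * (4 ^ (c * κ) * m ^ (c * m))                   ≡⟨ *-assoc (B ^ a) _ _ ⟨
  B ^ a * 4 ^ (c * κ) * m ^ (c * m)                     ∎)
  where
  open ≤-Reasoning
  m = 2 ^ i
  N = length (dyadic i)
  A = ∏ (_+ κ) (dyadic i)
  B = product (dyadic i)
  r = c * m ∸ N * a

-- For i ≥ a the i-th dyadic interval has at most 2 · 2^i / a primes, hence contributes at most
-- 4^(2κ). The a-th power replaces the division by a; `a` stays fixed while `b` moves through the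
-- induction.
span-power : ∀ a b l κ → a ≤ b → ∏ (_+ κ) (span b l) ^ a ≤ product (span b l) ^ a * (4 ^ (2 * κ)) ^ l
span-power a b zero κ a≤b = ≤-reflexive (sym (*-identityʳ _))
span-power a b (suc l) κ a≤b = begin
  ∏ (_+ κ) (dyadic b ++ span (suc b) l) ^ a               ≡⟨ cong (_^ a) (∏-++ (_+ κ) (dyadic b) (span (suc b) l)) ⟩
  (A * A′) ^ a                                            ≡⟨ *-^ A A′ a ⟩
  A ^ a * A′ ^ a                                          ≤⟨ *-mono-≤ (dyadic-power b κ a 2 (≤-trans (*-monoʳ-≤ (length (dyadic b)) a≤b)
                                                               (≤-trans (≤-reflexive (*-comm (length (dyadic b)) b)) (chebyshev b))))
                                                             (span-power a (suc b) l κ (m≤n⇒m≤1+n a≤b)) ⟩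
  B ^ a * c * (B′ ^ a * c ^ l)                            ≡⟨ identity (B ^ a) c (B′ ^ a) (c ^ l) ⟩
  B ^ a * B′ ^ a * (c * c ^ l)                            ≡⟨ cong (_* (c * c ^ l)) (*-^ B B′ a) ⟨
  (B * B′) ^ a * c ^ suc l                                ≡⟨ cong (λ z → z ^ a * c ^ suc l) (product-++ (dyadic b) (span (suc b) l)) ⟨
  product (dyadic b ++ span (suc b) l) ^ a * c ^ suc l    ∎
  where
  open ≤-Reasoning
  A = ∏ (_+ κ) (dyadic b)
  A′ = ∏ (_+ κ) (span (suc b) l)
  B = product (dyadic b)
  B′ = product (span (suc b) l)
  c = 4 ^ (2 * κ)
  identity : ∀ x c y d → x * c * (y * d) ≡ x * y * (c * d)
  identity = solve-∀

-- The 3a dyadic intervals contribute 4^(6κa) to the a-th power, and the a-th root 2^(12κ) no longer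
-- depends on `a`. So ∑ 1/p is bounded when the exponent range is quadrupled.
mertens : ∀ a κ → 0 < a → ∏ (_+ κ) (span a (3 * a)) ≤ 2 ^ (12 * κ) * product (span a (3 * a))
mertens a κ a>0 = ^-cancelˡ-≤ a a>0 (begin
  A ^ a                                   ≤⟨ span-power a a (3 * a) κ ≤-refl ⟩
  B ^ a * (4 ^ (2 * κ)) ^ (3 * a)         ≡⟨ cong (B ^ a *_) (^-*-assoc (4 ^ (2 * κ)) 3 a) ⟨
  B ^ a * ((4 ^ (2 * κ)) ^ 3) ^ a         ≡⟨ *-^ B ((4 ^ (2 * κ)) ^ 3) a ⟨
  (B * (4 ^ (2 * κ)) ^ 3) ^ a             ≡⟨ cong (_^ a) (trans (*-comm B _) (cong (_* B) powers)) ⟩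
  (2 ^ (12 * κ) * B) ^ a                  ∎)
  where
  open ≤-Reasoning
  A = ∏ (_+ κ) (span a (3 * a))
  B = product (span a (3 * a))
  powers : (4 ^ (2 * κ)) ^ 3 ≡ 2 ^ (12 * κ)
  powers = trans (^-*-assoc 4 (2 * κ) 3) (trans (^-*-assoc 2 2 (2 * κ * 3)) (cong (2 ^_) (identity κ)))
    where
    identity : ∀ κ → 2 * (2 * κ * 3) ≡ 12 * κ
    identity = solve-∀

-- Uses only that the interval has 2^i members, so it covers i = 0 as well, where Chebyshev's bound
-- is empty. The generous exponent matches that of `mertens`.
dyadic-trivial : ∀ i κ → ∏ (_+ κ) (dyadic i) ≤ 2 ^ (12 * κ) * product (dyadic i)
dyadic-trivial i κ = begin
  ∏ (_+ κ) (dyadic i)                     ≡⟨ ^-identityʳ _ ⟨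
  ∏ (_+ κ) (dyadic i) ^ 1                 ≤⟨ dyadic-power i κ 1 1 (≤-trans (≤-reflexive (*-identityʳ _)) (≤-trans (length-filter prime? (interval (2 ^ i) (2 ^ i)))
                                             (≤-reflexive (trans (length-interval (2 ^ i) (2 ^ i)) (sym (*-identityˡ _)))))) ⟩
  product (dyadic i) ^ 1 * 4 ^ (1 * κ)    ≡⟨ cong₂ _*_ (^-identityʳ (product (dyadic i))) (^-*-assoc 2 2 (1 * κ)) ⟩
  product (dyadic i) * 2 ^ (2 * (1 * κ))  ≤⟨ *-monoʳ-≤ (product (dyadic i)) (^-monoʳ-≤ 2 (*-mono-≤ {2} {12} (s≤s (s≤s z≤n)) (≤-reflexive (*-identityˡ κ)))) ⟩
  product (dyadic i) * 2 ^ (12 * κ)       ≡⟨ *-comm (product (dyadic i)) _ ⟩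
  2 ^ (12 * κ) * product (dyadic i)       ∎
  where open ≤-Reasoning

open Model
open Removal

-- The sieving blocks

n<2^n : ∀ n → n < 2 ^ n
n<2^n zero = s≤s z≤n
n<2^n (suc n) = ≤-trans (+-mono-≤ (m^n>0 2 n) (n<2^n n)) (≤-reflexive (double n))

-- At depth j there are κ = 2^(j+1) classes, and 25κ stands for the order 50κ + 1. Tameness asks for
-- 48κ + 3 + j, and 2 + j ≤ 2κ.
Goods : ℕ → List Block → Set
Goods j [] = ⊤
Goods j (b ∷ bs) = (proj₁ b ≡ 25 * 2 ^ suc j × Good (2 ^ suc j) (proj₂ b)) × Goods (suc j) bs

goods⇒tame : ∀ j bs → Goods j bs → Tame j bs
goods⇒tame j [] _ = tt
goods⇒tame j ((_ , is) ∷ bs) ((refl , good) , goods) = elem≤void good _ (3 + j) order≥ , goods⇒tame (suc j) bs goods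
  where
  κ = 2 ^ suc j
  order≥ : 48 * κ + (3 + j) ≤ suc (25 * κ + 25 * κ)
  order≥ = begin
    48 * κ + (3 + j)           ≡⟨ identity₁ κ j ⟩
    suc (48 * κ + (1 + (1 + j))) ≤⟨ s≤s (+-monoʳ-≤ (48 * κ) (≤-trans (n<2^n (suc j)) (m≤m+n κ κ))) ⟩
    suc (48 * κ + (κ + κ))     ≡⟨ identity₂ κ ⟩
    suc (25 * κ + 25 * κ)      ∎
    where
    open ≤-Reasoning
    identity₁ : ∀ κ j → 48 * κ + (3 + j) ≡ 1 + (48 * κ + (1 + (1 + j)))
    identity₁ = solve-∀
    identity₂ : ∀ κ → 1 + (48 * κ + (κ + κ)) ≡ 1 + (25 * κ + 25 * κ)
    identity₂ = solve-∀

goods-keep : ∀ qs j bs → Goods j bs → Goods j (keep qs bs)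
goods-keep [] j bs gs = gs
goods-keep (q ∷ qs) j bs gs = go j (keep qs bs) (goods-keep qs j bs gs)
  where
  go : ∀ j bs → Goods j bs → Goods j (removeB q bs)
  go j [] _ = tt
  go j (b ∷ bs) ((eq , g) , gs) = (eq , good-remove q g) , go (suc j) bs gs

modulus-++ : ∀ is js → modulus (is ++ js) ≡ modulus is * modulus js
modulus-++ [] js = sym (*-identityˡ _)
modulus-++ ((p , κ) ∷ is) js = trans (cong (p *_) (modulus-++ is js)) (sym (*-assoc p (modulus is) (modulus js)))

-- The exponents 24 · 2^(j+1) of the successive blocks form a geometric series.
goods⇒modulus≤void : ∀ j bs → Goods j bs →
  2 ^ (24 * 2 ^ suc j) * modulus (flat bs) ≤ 2 ^ (24 * 2 ^ suc (j + length bs)) * void (flat bs)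
goods⇒modulus≤void j [] _ = ≤-reflexive (cong (λ z → 2 ^ (24 * 2 ^ suc z) * 1) (sym (+-identityʳ j)))
goods⇒modulus≤void j ((m , is) ∷ bs) ((_ , good) , goods) = begin
  t * modulus (is ++ flat bs)                                           ≡⟨ cong (t *_) (modulus-++ is (flat bs)) ⟩
  t * (modulus is * Q)                                                  ≤⟨ *-monoʳ-≤ t (*-monoˡ-≤ Q (modulus≤void good)) ⟩
  t * (t * void is * Q)                                                 ≡⟨ identity t (void is) Q ⟩
  void is * (t * t * Q)                                                 ≡⟨ cong (λ z → void is * (z * Q)) square ⟩
  void is * (2 ^ (24 * 2 ^ suc (suc j)) * Q)                            ≤⟨ *-monoʳ-≤ (void is) (goods⇒modulus≤void (suc j) bs goods) ⟩
  void is * (2 ^ (24 * 2 ^ suc (suc j + length bs)) * void (flat bs))   ≡⟨ cong (λ z → void is * (2 ^ (24 * 2 ^ suc z) * void (flat bs))) (+-suc j (length bs)) ⟨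
  void is * (u * void (flat bs))                                        ≡⟨ identity′ (void is) u (void (flat bs)) ⟩
  u * (void is * void (flat bs))                                        ≡⟨ cong (u *_) (void-++ is (flat bs)) ⟨
  u * void (is ++ flat bs)                                              ∎
  where
  open ≤-Reasoning
  t = 2 ^ (24 * 2 ^ suc j)
  u = 2 ^ (24 * 2 ^ suc (j + suc (length bs)))
  Q = modulus (flat bs)
  identity : ∀ t v q → t * (t * v * q) ≡ v * (t * t * q)
  identity = solve-∀
  identity′ : ∀ v u w → v * (u * w) ≡ u * (v * w)
  identity′ = solve-∀
  square : t * t ≡ 2 ^ (24 * 2 ^ suc (suc j))
  square = trans (sym (^-distribˡ-+-* 2 (24 * 2 ^ suc j) (24 * 2 ^ suc j))) (cong (2 ^_) (dbl (2 ^ suc j)))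
    where
    dbl : ∀ x → 24 * x + 24 * x ≡ 24 * (2 * x)
    dbl = solve-∀

cap : List Block → ℕ
cap [] = 1
cap (b ∷ bs) = (1 + load (proj₂ b)) ^ order b * cap bs

size-W : ∀ bs → size (W bs) ≤ cap bs
size-W [] = ≤-refl
size-W (b@(_ , is) ∷ bs) = ≤-trans (size-U (order b) is (W bs)) (*-monoʳ-≤ ((1 + load is) ^ order b) (size-W bs))

size-H : ∀ bs → size (H bs) ≤ length bs * cap bs
size-H [] = ≤-refl
size-H (b@(_ , is) ∷ bs) = begin
  size (E (order b) is (W bs)) + size (U (order b) is (H bs)) ≤⟨ +-mono-≤ (size-E (order b) is (W bs)) (size-U (order b) is (H bs)) ⟩
  x * size (W bs) + x * size (H bs)                           ≤⟨ +-mono-≤ (*-monoʳ-≤ x (size-W bs)) (*-monoʳ-≤ x (size-H bs)) ⟩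
  x * cap bs + x * (length bs * cap bs)                       ≡⟨ identity x (cap bs) (length bs) ⟩
  suc (length bs) * (x * cap bs)                              ∎
  where
  open ≤-Reasoning
  x = (1 + load is) ^ order b
  identity : ∀ x c n → x * c + x * (n * c) ≡ (1 + n) * (x * c)
  identity = solve-∀

load-remove : ∀ q is → load (remove q is) ≤ load is
load-remove q [] = z≤n
load-remove q ((p , κ) ∷ is) with p ≟ q
... | yes p≡q rewrite filter-reject (λ i → ¬? (proj₁ i ≟ q)) {x = p , κ} {xs = is} (λ p≢q → p≢q p≡q) = ≤-trans (load-remove q is) (m≤n+m _ κ)
... | no p≢q rewrite filter-accept (λ i → ¬? (proj₁ i ≟ q)) {x = p , κ} {xs = is} p≢q = +-monoʳ-≤ κ (load-remove q is)

cap-keep : ∀ qs bs → cap (keep qs bs) ≤ cap bs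
cap-keep [] bs = ≤-refl
cap-keep (q ∷ qs) bs = ≤-trans (go (keep qs bs)) (cap-keep qs bs)
  where
  go : ∀ bs → cap (removeB q bs) ≤ cap bs
  go [] = ≤-refl
  go (b@(_ , is) ∷ bs) = *-mono-≤ (^-monoˡ-≤ (order b) (s≤s (load-remove q is))) (go bs)

Wide : List Item → Set
Wide = All (λ i → 0 < proj₁ i × 4 * proj₂ i ≤ proj₁ i)

Distinct : List Item → Set
Distinct = AllPairs (λ i j → proj₁ i ≢ proj₁ j)

-- Each entry of `qs` is allowed a factor 4/3 in the void density. This remains valid for a repeated
-- entry or one outside the sieve, which removes nothing.
keep-void : ∀ qs bs → Wide (flat bs) → Distinct (flat bs) →
  3 ^ length qs * (void (flat (keep qs bs)) * modulus (flat bs)) ≤ 4 ^ length qs * (void (flat bs) * modulus (flat (keep qs bs)))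
keep-void [] bs _ _ = ≤-refl
keep-void (q ∷ qs) bs wd ds = *-cancelʳ-≤ (3 ^ suc n * (V″ * Q)) (4 ^ suc n * (V * Q″)) Q′
    {{>-nonZero (modulus>0 (All.map proj₁ (All-keep qs bs wd)))}} (begin
  3 * 3 ^ n * (V″ * Q) * Q′          ≡⟨ identity₁ 3 (3 ^ n) V″ Q Q′ ⟩
  3 * (V″ * Q′) * (3 ^ n * Q)        ≤⟨ *-monoˡ-≤ (3 ^ n * Q) one ⟩
  4 * (V′ * Q″) * (3 ^ n * Q)        ≡⟨ identity₂ 4 V′ Q″ (3 ^ n) Q ⟩
  4 * Q″ * (3 ^ n * (V′ * Q))        ≤⟨ *-monoʳ-≤ (4 * Q″) (keep-void qs bs wd ds) ⟩
  4 * Q″ * (4 ^ n * (V * Q′))        ≡⟨ identity₃ 4 Q″ (4 ^ n) V Q′ ⟩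
  4 * 4 ^ n * (V * Q″) * Q′          ∎)
  where
  open ≤-Reasoning
  n = length qs
  V = void (flat bs)
  V′ = void (flat (keep qs bs))
  V″ = void (flat (keep (q ∷ qs) bs))
  Q = modulus (flat bs)
  Q′ = modulus (flat (keep qs bs))
  Q″ = modulus (flat (keep (q ∷ qs) bs))
  one : 3 * (V″ * Q′) ≤ 4 * (V′ * Q″)
  one = subst (λ z → 3 * (void z * Q′) ≤ 4 * (V′ * modulus z)) (sym (flat-removeB q (keep qs bs)))
    (remove-void q (flat (keep qs bs)) (All.map proj₂ (All-keep qs bs wd)) (AllPairs-keep qs bs ds))
  identity₁ : ∀ a b c d e → a * b * (c * d) * e ≡ a * (c * e) * (b * d)
  identity₁ = solve-∀
  identity₂ : ∀ a b c d e → a * (b * c) * (d * e) ≡ a * c * (d * (b * e))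
  identity₂ = solve-∀
  identity₃ : ∀ a b c d e → a * b * (c * (d * e)) ≡ a * c * (d * b) * e
  identity₃ = solve-∀

items : ℕ → List ℕ → List Item
items κ = map (_, κ)

modulus-items : ∀ κ ps → modulus (items κ ps) ≡ product ps
modulus-items κ [] = refl
modulus-items κ (p ∷ ps) = cong (p *_) (modulus-items κ ps)

grow-items : ∀ κ ps → grow (items κ ps) ≡ ∏ (_+ 2 * κ) ps
grow-items κ [] = refl
grow-items κ (p ∷ ps) = cong ((p + 2 * κ) *_) (grow-items κ ps)

load-items : ∀ κ ps → load (items κ ps) ≡ length ps * κ
load-items κ [] = refl
load-items κ (p ∷ ps) = cong (_+_ κ) (load-items κ ps)

layer : ℕ → ℕ → List ℕ
layer s i = span (s * 4 ^ i) (3 * (s * 4 ^ i))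

-- Listed from the top: `i` counts the layers still to come and `j` those already passed, so each
-- step down doubles the number of classes.
blocks : ℕ → ℕ → ℕ → List Block
blocks s zero j = []
blocks s (suc i) j = (25 * 2 ^ suc j , items (2 ^ suc j) (layer s i)) ∷ blocks s i (suc j)

length-blocks : ∀ s i j → length (blocks s i j) ≡ i
length-blocks s zero j = refl
length-blocks s (suc i) j = cong suc (length-blocks s i (suc j))

s≤s4^i : ∀ s i → s ≤ s * 4 ^ i
s≤s4^i s i = m≤m*n s (4 ^ i) {{m^n≢0 4 i}}

quadruple : ∀ s i → s * 4 ^ i + 3 * (s * 4 ^ i) ≡ s * 4 ^ suc i
quadruple s i = identity s (4 ^ i)
  where
  identity : ∀ s x → s * x + 3 * (s * x) ≡ s * (4 * x)
  identity = solve-∀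

layer-bounds : ∀ s i → All (λ p → 2 ^ (s * 4 ^ i) < p × p ≤ 2 ^ (s * 4 ^ suc i)) (layer s i)
layer-bounds s i = subst (λ z → All (λ p → 2 ^ (s * 4 ^ i) < p × p ≤ 2 ^ z) (layer s i)) (quadruple s i) (span-bounds (s * 4 ^ i) (3 * (s * 4 ^ i)))

blocks-prime : ∀ s i j → All (λ it → Prime (proj₁ it)) (flat (blocks s i j))
blocks-prime s zero j = []
blocks-prime s (suc i) j = Allₚ.++⁺ (Allₚ.map⁺ (span-primes (s * 4 ^ i) (3 * (s * 4 ^ i)))) (blocks-prime s i (suc j))

blocks-upper : ∀ s i j → All (λ it → proj₁ it ≤ 2 ^ (s * 4 ^ i)) (flat (blocks s i j))
blocks-upper s zero j = []
blocks-upper s (suc i) j = Allₚ.++⁺ (Allₚ.map⁺ (All.map proj₂ (layer-bounds s i)))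
  (All.map (λ le → ≤-trans le (^-monoʳ-≤ 2 (*-monoʳ-≤ s (^-monoʳ-≤ 4 (n≤1+n i))))) (blocks-upper s i (suc j)))

blocks-lower : ∀ s i j → All (λ it → 2 ^ s < proj₁ it) (flat (blocks s i j))
blocks-lower s zero j = []
blocks-lower s (suc i) j = Allₚ.++⁺
  (Allₚ.map⁺ (All.map (λ (lo , _) → ≤-<-trans (^-monoʳ-≤ 2 (s≤s4^i s i)) lo) (layer-bounds s i))) (blocks-lower s i (suc j))

blocks-distinct : ∀ s i j → Distinct (flat (blocks s i j))
blocks-distinct s zero j = []
blocks-distinct s (suc i) j = AllPairsₚ.++⁺
  (AllPairsₚ.map⁺ (AllPairs.map <⇒≢ (span-increasing (s * 4 ^ i) (3 * (s * 4 ^ i)))))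
  (blocks-distinct s i (suc j))
  (Allₚ.map⁺ (All.map (λ (lo , _) → All.map (λ hi eq → <⇒≱ lo (≤-trans (≤-reflexive eq) hi)) (blocks-upper s i (suc j))) (layer-bounds s i)))

-- The condition on `s` gives 4κ = 2^(j+3) ≤ 2^s, and every prime of the layer exceeds 2^s.
layer-good : ∀ s i j → j + 3 ≤ s → Good (2 ^ suc j) (items (2 ^ suc j) (layer s i))
layer-good s i j j+3≤s = record
  { wide = Allₚ.map⁺ (All.map (λ (lo , _) → ≤-<-trans z≤n lo , ≤-trans 4κ≤ (<⇒≤ lo)) (layer-bounds s i))
  ; growth = begin
      grow (items κ (layer s i))                     ≡⟨ grow-items κ (layer s i) ⟩
      ∏ (_+ 2 * κ) (layer s i)                       ≤⟨ mertens (s * 4 ^ i) (2 * κ) a>0 ⟩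
      2 ^ (12 * (2 * κ)) * product (layer s i)       ≡⟨ cong₂ _*_ (cong (2 ^_) (identity κ)) (sym (modulus-items κ (layer s i))) ⟩
      2 ^ (24 * κ) * modulus (items κ (layer s i))   ∎ }
  where
  open ≤-Reasoning
  κ = 2 ^ suc j
  identity : ∀ κ → 12 * (2 * κ) ≡ 24 * κ
  identity = solve-∀
  j+3≤a : j + 3 ≤ s * 4 ^ i
  j+3≤a = ≤-trans j+3≤s (s≤s4^i s i)
  a>0 : 0 < s * 4 ^ i
  a>0 = ≤-trans (≤-trans (s≤s z≤n) (m≤n+m 3 j)) j+3≤a
  4κ≤ : 4 * κ ≤ 2 ^ (s * 4 ^ i)
  4κ≤ = ≤-trans (≤-reflexive (trans (sym (^-distribˡ-+-* 2 2 (suc j))) (cong (2 ^_) (+-comm 3 j)))) (^-monoʳ-≤ 2 j+3≤a)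

blocks-goods : ∀ s i j → i + j + 2 ≤ s → Goods j (blocks s i j)
blocks-goods s zero j _ = tt
blocks-goods s (suc i) j le = (refl , layer-good s i j (≤-trans (≤-trans (≤-reflexive (+-suc j 2)) (s≤s (+-monoˡ-≤ 2 (m≤n+m j i)))) le))
  , blocks-goods s i (suc j) (≤-trans (≤-reflexive (cong (_+ 2) (+-suc i j))) le)

goods-wide : ∀ j bs → Goods j bs → Wide (flat bs)
goods-wide j [] _ = []
goods-wide j (b ∷ bs) ((_ , g) , gs) = Allₚ.++⁺ (wide g) (goods-wide (suc j) bs gs)

length-span : ∀ a l → length (span a l) + 2 ^ a ≤ 2 ^ (a + l)
length-span a zero = ≤-reflexive (cong (2 ^_) (sym (+-identityʳ a)))
length-span a (suc l) = begin
  length (dyadic a ++ span (suc a) l) + 2 ^ a         ≡⟨ cong (_+ 2 ^ a) (trans (length-++ (dyadic a)) (+-comm (length (dyadic a)) _)) ⟩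
  length (span (suc a) l) + length (dyadic a) + 2 ^ a ≤⟨ +-monoˡ-≤ (2 ^ a) (+-monoʳ-≤ (length (span (suc a) l))
                                                          (≤-trans (length-filter _ (interval (2 ^ a) (2 ^ a))) (≤-reflexive (length-interval (2 ^ a) (2 ^ a))))) ⟩
  length (span (suc a) l) + 2 ^ a + 2 ^ a             ≡⟨ trans (+-assoc _ (2 ^ a) (2 ^ a)) (cong (_+_ (length (span (suc a) l))) (double a)) ⟩
  length (span (suc a) l) + 2 ^ suc a                 ≤⟨ length-span (suc a) l ⟩
  2 ^ (suc a + l)                                     ≡⟨ cong (2 ^_) (+-suc a l) ⟨
  2 ^ (a + suc l)                                     ∎
  where open ≤-Reasoning

-- With a = s 4^i, the top block costs 8a · 51κ = 816 a 2^j in the exponent. One level down κ has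
-- doubled but the exponents of the primes are four times smaller, so all remaining blocks cost 816
-- a 2^j once more; the sum is 408 · 4a · 2^j.
cap-blocks : ∀ s i j → i + j + 2 ≤ s → cap (blocks s i j) ≤ 2 ^ (408 * (s * 4 ^ i * 2 ^ j))
cap-blocks s zero j _ = m^n>0 2 (408 * (s * 1 * 2 ^ j))
cap-blocks s (suc i) j le = begin
  (1 + load (items κ (layer s i))) ^ suc (25 * κ + 25 * κ) * cap (blocks s i (suc j)) ≤⟨ *-mono-≤ (^-monoˡ-≤ (suc (25 * κ + 25 * κ)) load≤) (cap-blocks s i (suc j) le′) ⟩
  (2 ^ (2 * (4 * a))) ^ suc (25 * κ + 25 * κ) * 2 ^ (408 * (a * κ))                   ≤⟨ *-monoˡ-≤ (2 ^ (408 * (a * κ))) (^-monoʳ-≤ (2 ^ (2 * (4 * a))) {{m^n≢0 2 (2 * (4 * a))}} order≤) ⟩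
  (2 ^ (2 * (4 * a))) ^ (51 * κ) * 2 ^ (408 * (a * κ))                                ≡⟨ cong (_* 2 ^ (408 * (a * κ))) (^-*-assoc 2 (2 * (4 * a)) (51 * κ)) ⟩
  2 ^ (2 * (4 * a) * (51 * κ)) * 2 ^ (408 * (a * κ))                                  ≡⟨ ^-distribˡ-+-* 2 (2 * (4 * a) * (51 * κ)) (408 * (a * κ)) ⟨
  2 ^ (2 * (4 * a) * (51 * κ) + 408 * (a * κ))                                        ≡⟨ cong (2 ^_) (identity s (4 ^ i) (2 ^ j)) ⟩
  2 ^ (408 * (s * 4 ^ suc i * 2 ^ j))                                                 ∎
  where
  open ≤-Reasoning
  κ = 2 ^ suc j
  a = s * 4 ^ i
  identity : ∀ s x t → 2 * (4 * (s * x)) * (51 * (2 * t)) + 408 * (s * x * (2 * t)) ≡ 408 * (s * (4 * x) * t)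
  identity = solve-∀
  le′ : i + suc j + 2 ≤ s
  le′ = ≤-trans (≤-reflexive (cong (_+ 2) (+-suc i j))) le
  order≤ : suc (25 * κ + 25 * κ) ≤ 51 * κ
  order≤ = ≤-trans (+-monoˡ-≤ (25 * κ + 25 * κ) (m^n>0 2 (suc j))) (≤-reflexive (identity′ κ))
    where
    identity′ : ∀ κ → κ + (25 * κ + 25 * κ) ≡ 51 * κ
    identity′ = solve-∀
  N = length (layer s i)
  N< : N + 1 ≤ 2 ^ (4 * a)
  N< = ≤-trans (+-monoʳ-≤ N (m^n>0 2 a)) (length-span a (3 * a))
  j< : suc j ≤ 4 * a
  j< = ≤-trans (≤-trans (m≤n+m (suc j) i) (m≤m+n _ 2)) (≤-trans le′ (≤-trans (s≤s4^i s i) (m≤m+n a _)))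
  load≤ : 1 + load (items κ (layer s i)) ≤ 2 ^ (2 * (4 * a))
  load≤ = begin
    1 + load (items κ (layer s i))  ≡⟨ cong suc (load-items κ (layer s i)) ⟩
    1 + N * κ                       ≤⟨ +-monoˡ-≤ (N * κ) (m^n>0 2 (suc j)) ⟩
    κ + N * κ                       ≡⟨ cong (_* κ) (+-comm 1 N) ⟩
    (N + 1) * κ                     ≤⟨ *-mono-≤ N< (^-monoʳ-≤ 2 j<) ⟩
    2 ^ (4 * a) * 2 ^ (4 * a)       ≡⟨ ^-2* 2 (4 * a) ⟨
    2 ^ (2 * (4 * a))               ∎

unhit-suffix : ∀ n s i ℓ j → Unhit n (flat (blocks s (ℓ + i) j)) → Unhit n (flat (blocks s i (ℓ + j)))
unhit-suffix n s i zero j u = u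
unhit-suffix n s i (suc ℓ) j u = subst (λ z → Unhit n (flat (blocks s i z))) (+-suc ℓ j)
  (unhit-suffix n s i ℓ (suc j) (Allₚ.++⁻ʳ (items (2 ^ suc j) (layer s (ℓ + i))) u))

-- Lower blocks avoid even more classes, so k ≤ 2^(j+1) is covered by every block of the list.
unhit-avoids : ∀ n s i j {p k} → Unhit n (flat (blocks s i j)) → Prime p → 2 ^ s < p → p ≤ 2 ^ (s * 4 ^ i) →
               1 ≤ k → k ≤ 2 ^ suc j → ¬ p ∣ n + (p ∸ k)
unhit-avoids n s zero j u pr lo hi 1≤k k≤ = contradiction (≤-trans hi (≤-reflexive (cong (2 ^_) (*-identityʳ s)))) (<⇒≱ lo)
unhit-avoids n s (suc i) j {p} {k} u pr lo hi 1≤k k≤ with p ≤? 2 ^ (s * 4 ^ i)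
... | yes le = unhit-avoids n s i (suc j) (Allₚ.++⁻ʳ (items (2 ^ suc j) (layer s i)) u) pr lo le 1≤k (≤-trans k≤ (^-monoʳ-≤ 2 (n≤1+n (suc j))))
... | no gt = hit≡0⇒∤ n p (2 ^ suc j) k
    (All.lookup (Allₚ.++⁻ˡ (items (2 ^ suc j) (layer s i)) u) (∈-map⁺ (_, 2 ^ suc j) (∈-span (s * 4 ^ i) (3 * (s * 4 ^ i)) pr (≰⇒> gt)
      (≤-trans hi (≤-reflexive (cong (2 ^_) (sym (quadruple s i)))))))) 1≤k k≤

-- Candidate primes and their Euler products

tower : ℕ → ℕ → ℕ → List ℕ
tower s i zero = []
tower s i (suc m) = layer s i ++ tower s (suc i) m

tower-prime : ∀ s i m → All Prime (tower s i m)
tower-prime s i zero = []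
tower-prime s i (suc m) = Allₚ.++⁺ (span-primes (s * 4 ^ i) (3 * (s * 4 ^ i))) (tower-prime s (suc i) m)

∈-tower : ∀ {p} s i m → Prime p → 2 ^ (s * 4 ^ i) < p → p ≤ 2 ^ (s * 4 ^ (i + m)) → p ∈ tower s i m
∈-tower s i zero pr lo hi = contradiction (≤-trans hi (≤-reflexive (cong (λ z → 2 ^ (s * 4 ^ z)) (+-identityʳ i)))) (<⇒≱ lo)
∈-tower {p} s i (suc m) pr lo hi with p ≤? 2 ^ (s * 4 ^ suc i)
... | yes le = ∈-++⁺ˡ (∈-span (s * 4 ^ i) (3 * (s * 4 ^ i)) pr lo (≤-trans le (≤-reflexive (cong (2 ^_) (sym (quadruple s i))))))
... | no gt = ∈-++⁺ʳ (layer s i) (∈-tower s (suc i) m pr (≰⇒> gt) (≤-trans hi (≤-reflexive (cong (λ z → 2 ^ (s * 4 ^ z)) (+-suc i m)))))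

-- ∏ (1 - 3/(2p))⁻¹ ≤ 2^t
Thin : ℕ → List ℕ → Set
Thin t ps = ∏ (2 *_) ps ≤ 2 ^ t * ∏ (λ p → 2 * p ∸ 3) ps

thin-++ : ∀ t u ps qs → Thin t ps → Thin u qs → Thin (t + u) (ps ++ qs)
thin-++ t u ps qs x y = begin
  ∏ (2 *_) (ps ++ qs)                         ≡⟨ ∏-++ (2 *_) ps qs ⟩
  ∏ (2 *_) ps * ∏ (2 *_) qs                   ≤⟨ *-mono-≤ x y ⟩
  2 ^ t * ∏ f ps * (2 ^ u * ∏ f qs)           ≡⟨ identity (2 ^ t) (∏ f ps) (2 ^ u) (∏ f qs) ⟩
  2 ^ t * 2 ^ u * (∏ f ps * ∏ f qs)           ≡⟨ cong₂ _*_ (^-distribˡ-+-* 2 t u) (∏-++ f ps qs) ⟨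
  2 ^ (t + u) * ∏ f (ps ++ qs)                ∎
  where
  open ≤-Reasoning
  f = λ p → 2 * p ∸ 3
  identity : ∀ a b c d → a * b * (c * d) ≡ a * c * (b * d)
  identity = solve-∀

prime≥2 : ∀ {p} → Prime p → 2 ≤ p
prime≥2 {p} pr = nonTrivial⇒n>1 p {{prime⇒nonTrivial pr}}

-- 2p / (2p - 3) ≤ (p + 6) / p
thin-ratio : ∀ ps → All Prime ps → ∏ (2 *_) ps * product ps ≤ ∏ (λ p → 2 * p ∸ 3) ps * ∏ (_+ 6) ps
thin-ratio [] [] = ≤-refl
thin-ratio (p ∷ ps) (pr ∷ prs) = begin
  2 * p * ∏ (2 *_) ps * (p * product ps)             ≡⟨ identity (2 * p) (∏ (2 *_) ps) p (product ps) ⟩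
  2 * p * p * (∏ (2 *_) ps * product ps)             ≤⟨ *-mono-≤ (one p (prime≥2 pr)) (thin-ratio ps prs) ⟩
  (2 * p ∸ 3) * (p + 6) * (∏ f ps * ∏ (_+ 6) ps)     ≡⟨ identity (2 * p ∸ 3) (∏ f ps) (p + 6) (∏ (_+ 6) ps) ⟨
  (2 * p ∸ 3) * ∏ f ps * ((p + 6) * ∏ (_+ 6) ps)     ∎
  where
  open ≤-Reasoning
  f = λ p → 2 * p ∸ 3
  identity : ∀ a b c d → a * b * (c * d) ≡ a * c * (b * d)
  identity = solve-∀
  one : ∀ p → 2 ≤ p → 2 * p * p ≤ (2 * p ∸ 3) * (p + 6)
  one (suc zero) (s≤s ())
  one (suc (suc r)) _ = begin
    2 * (2 + r) * (2 + r)                          ≤⟨ m≤m+n _ (9 * r) ⟩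
    2 * (2 + r) * (2 + r) + 9 * r                  ≡⟨ identity₁ r ⟩
    (1 + 2 * r) * (2 + r + 6)                      ≡⟨ cong (λ z → (z ∸ 3) * (2 + r + 6)) (identity₂ r) ⟩
    (2 * (2 + r) ∸ 3) * (2 + r + 6)                ∎
    where
    identity₁ : ∀ r → 2 * (2 + r) * (2 + r) + 9 * r ≡ (1 + 2 * r) * (2 + r + 6)
    identity₁ = solve-∀
    identity₂ : ∀ r → 4 + 2 * r ≡ 2 * (2 + r)
    identity₂ = solve-∀

product-primes>0 : ∀ {ps} → All Prime ps → 0 < product ps
product-primes>0 [] = s≤s z≤n
product-primes>0 (pr ∷ prs) = *-mono-≤ (≤-trans (s≤s z≤n) (prime≥2 pr)) (product-primes>0 prs)

thin : ∀ t ps → All Prime ps → ∏ (_+ 6) ps ≤ 2 ^ t * product ps → Thin t ps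
thin t ps prs le = *-cancelʳ-≤ (∏ (2 *_) ps) (2 ^ t * ∏ f ps) (product ps) {{>-nonZero (product-primes>0 prs)}} (begin
  ∏ (2 *_) ps * product ps              ≤⟨ thin-ratio ps prs ⟩
  ∏ f ps * ∏ (_+ 6) ps                  ≤⟨ *-monoʳ-≤ (∏ f ps) le ⟩
  ∏ f ps * (2 ^ t * product ps)        ≡⟨ identity (∏ f ps) (2 ^ t) (product ps) ⟩
  2 ^ t * ∏ f ps * product ps          ∎)
  where
  open ≤-Reasoning
  f = λ p → 2 * p ∸ 3
  identity : ∀ a b c → a * (b * c) ≡ b * a * c
  identity = solve-∀

-- Since 2p/(2p - 3) ≤ 1 + 6/p, any κ ≥ 6 serves. A single dyadic interval and a whole layer are
-- both charged the factor 2^(12κ).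
module Thinness (κ : ℕ) (6≤κ : 6 ≤ κ) where

  t₀ : ℕ
  t₀ = 12 * κ

  weaken : ∀ ps → ∏ (_+ 6) ps ≤ ∏ (_+ κ) ps
  weaken [] = ≤-refl
  weaken (p ∷ ps) = *-mono-≤ (+-monoʳ-≤ p 6≤κ) (weaken ps)

  thin-span : ∀ a l → Thin (l * t₀) (span a l)
  thin-span a zero = ≤-refl
  thin-span a (suc l) = thin-++ t₀ (l * t₀) (dyadic a) (span (suc a) l)
    (thin t₀ (dyadic a) (Allₚ.++⁻ˡ (dyadic a) (span-primes a (suc l))) (≤-trans (weaken (dyadic a)) (dyadic-trivial a κ))) (thin-span (suc a) l)

  thin-tower : ∀ s i m → 0 < s → Thin (m * t₀) (tower s i m)
  thin-tower s i zero s>0 = ≤-refl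
  thin-tower s i (suc m) s>0 = thin-++ t₀ (m * t₀) (layer s i) (tower s (suc i) m)
    (thin t₀ (layer s i) (span-primes (s * 4 ^ i) (3 * (s * 4 ^ i)))
      (≤-trans (weaken (layer s i)) (mertens (s * 4 ^ i) κ (≤-trans s>0 (s≤s4^i s i))))) (thin-tower s (suc i) m s>0)

lg : ℕ → ℕ
lg zero = 0
lg (suc n) with 2 ^ suc (lg n) ≤? suc n
... | yes _ = suc (lg n)
... | no _ = lg n

lg-upper : ∀ n → n < 2 ^ suc (lg n)
lg-upper zero = s≤s z≤n
lg-upper (suc n) with 2 ^ suc (lg n) ≤? suc n
... | yes _ = ≤-trans (s≤s (lg-upper n)) (≤-trans (+-monoˡ-≤ (2 ^ suc (lg n)) (m^n>0 2 (suc (lg n)))) (≤-reflexive (double (suc (lg n)))))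
... | no gt = ≰⇒> gt

lg-lower : ∀ n → 2 ^ lg (suc n) ≤ suc n
lg-lower zero = ≤-refl
lg-lower (suc n) with 2 ^ suc (lg (suc n)) ≤? suc (suc n)
... | yes le = le
... | no _ = m≤n⇒m≤1+n (lg-lower n)

lg-positive : ∀ n → 2 ≤ n → 1 ≤ lg n
lg-positive n 2≤n with lg n in eq
... | suc _ = s≤s z≤n
... | zero = contradiction (subst (λ z → n < 2 ^ suc z) eq (lg-upper n)) (≤⇒≯ 2≤n)

-- Multisets of primes

sumOver : {A : Set} → (A → ℕ) → List A → ℕ
sumOver f xs = sum (map f xs)

sumOver-++ : ∀ {A : Set} (f : A → ℕ) xs ys → sumOver f (xs ++ ys) ≡ sumOver f xs + sumOver f ys
sumOver-++ f xs ys = trans (cong sum (map-++ f xs ys)) (sum-++ (map f xs) (map f ys))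

sumOver-map : ∀ {A B : Set} (f : B → ℕ) (g : A → B) xs → sumOver f (map g xs) ≡ sumOver (f ∘ g) xs
sumOver-map f g xs = cong sum (sym (map-∘ xs))

sumOver-* : ∀ {A : Set} c (f : A → ℕ) xs → sumOver (λ x → c * f x) xs ≡ c * sumOver f xs
sumOver-* c f [] = sym (*-zeroʳ c)
sumOver-* c f (x ∷ xs) = trans (cong (_+_ (c * f x)) (sumOver-* c f xs)) (sym (*-distribˡ-+ c (f x) (sumOver f xs)))

sumOver≡0 : ∀ {A : Set} (f : A → ℕ) {x xs} → x ∈ xs → sumOver f xs ≡ 0 → f x ≡ 0
sumOver≡0 f {xs = x ∷ xs} (here refl) eq = m+n≡0⇒m≡0 (f x) eq
sumOver≡0 f {xs = x ∷ xs} (there x∈) eq = sumOver≡0 f x∈ (m+n≡0⇒n≡0 (f x) eq)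

∑-cong : ∀ a l {f g} → (∀ n → f n ≡ g n) → ∑ a l f ≡ ∑ a l g
∑-cong a zero eq = refl
∑-cong a (suc l) eq = cong₂ _+_ (eq a) (∑-cong (suc a) l eq)

∑-mono : ∀ a l {f g} → (∀ n → a ≤ n → f n ≤ g n) → ∑ a l f ≤ ∑ a l g
∑-mono a zero le = z≤n
∑-mono a (suc l) le = +-mono-≤ (le a ≤-refl) (∑-mono (suc a) l (λ n a<n → le n (<⇒≤ a<n)))

∑-0 : ∀ a l → ∑ a l (λ _ → 0) ≡ 0
∑-0 a zero = refl
∑-0 a (suc l) = ∑-0 (suc a) l

∑-+ : ∀ a l f g → ∑ a l (λ n → f n + g n) ≡ ∑ a l f + ∑ a l g
∑-+ a zero f g = refl
∑-+ a (suc l) f g rewrite ∑-+ (suc a) l f g = identity (f a) (g a) (∑ (suc a) l f) (∑ (suc a) l g)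
  where
  identity : ∀ x y u v → (x + y) + (u + v) ≡ (x + u) + (y + v)
  identity = solve-∀

∑-sumOver : ∀ {A : Set} a l (f : A → ℕ → ℕ) xs → ∑ a l (λ n → sumOver (λ x → f x n) xs) ≡ sumOver (λ x → ∑ a l (f x)) xs
∑-sumOver a l f [] = ∑-0 a l
∑-sumOver a l f (x ∷ xs) = trans (∑-+ a l (f x) _) (cong (_+_ (∑ a l (f x))) (∑-sumOver a l f xs))

∑-witness : ∀ a l f → ∑ a l f ≡ 0 ⊎ ∃ λ n → a ≤ n × f n ≢ 0
∑-witness a zero f = inj₁ refl
∑-witness a (suc l) f with f a in eq
... | suc _ = inj₂ (a , ≤-refl , λ z → 0≢1+n (trans (sym z) eq))
... | zero with ∑-witness (suc a) l f
...   | inj₁ z = inj₁ z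
...   | inj₂ (n , a<n , ne) = inj₂ (n , <⇒≤ a<n , ne)

∑-<-witness : ∀ a l f g → ∑ a l f < ∑ a l g → ∃ λ n → a ≤ n × n < a + l × f n < g n
∑-<-witness a (suc l) f g lt with f a <? g a
... | yes fa<ga = a , ≤-refl , m<m+n a (s≤s z≤n) , fa<ga
... | no fa≮ga with ∑-<-witness (suc a) l f g (+-cancelˡ-< (f a) _ _ (<-≤-trans lt (+-monoˡ-≤ _ (≮⇒≥ fa≮ga))))
...   | n , a<n , n< , lt′ = n , <⇒≤ a<n , <-≤-trans n< (≤-reflexive (sym (+-suc a l))) , lt′

-- The telescoping bound ∑ 1/(k(k - 1)) ≤ 1/a over k > a, free of fractions.
telescope : ∀ A (g : ℕ → ℕ) a l → (∀ k → a < k → k ≤ a + l → k * pred k * g k ≤ A) → a * sumOver g (interval a l) ≤ A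
telescope A g a zero _ = ≤-trans (≤-reflexive (*-zeroʳ a)) z≤n
telescope A g a (suc l) le = *-cancelˡ-≤ (suc a) (begin
  suc a * (a * (g (suc a) + S))               ≡⟨ identity a (g (suc a)) S ⟩
  suc a * a * g (suc a) + a * (suc a * S)     ≤⟨ +-mono-≤ (le (suc a) ≤-refl (m<m+n a (s≤s z≤n))) (*-monoʳ-≤ a (telescope A g (suc a) l (λ k lt k≤ → le k (<⇒≤ lt) (≤-trans k≤ (≤-reflexive (sym (+-suc a l))))))) ⟩
  A + a * A                                   ∎)
  where
  open ≤-Reasoning
  S = sumOver g (interval (suc a) l)
  identity : ∀ a x s → (1 + a) * (a * (x + s)) ≡ (1 + a) * a * x + a * ((1 + a) * s)
  identity = solve-∀

multisets : ℕ → List ℕ → List (List ℕ)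
multisets zero ps = [] ∷ []
multisets (suc T) [] = []
multisets (suc T) (p ∷ ps) = multisets (suc T) ps ++ map (p ∷_) (multisets T (p ∷ ps))

thin≤ : ∀ ps → ∏ (λ p → 2 * p ∸ 3) ps ≤ ∏ (2 *_) ps
thin≤ [] = ≤-refl
thin≤ (p ∷ ps) = *-mono-≤ (m∸n≤m (2 * p) 3) (thin≤ ps)

-- A multiset omits p or is p together with a smaller multiset. With d = 2p - 3 the two bounds add
-- up as 1 + 3/d = 2p/d, exactly the new Euler factor.
rankin-step : ∀ T p ps (G : List ℕ → ℕ) B → Prime p →
  3 ^ suc T * ∏ (λ p → 2 * p ∸ 3) ps * sumOver G (multisets (suc T) ps) ≤ 2 ^ suc T * ∏ (2 *_) ps * B →
  3 ^ T * ∏ (λ p → 2 * p ∸ 3) (p ∷ ps) * sumOver (λ qs → p * G (p ∷ qs)) (multisets T (p ∷ ps)) ≤ 2 ^ T * ∏ (2 *_) (p ∷ ps) * B →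
  3 ^ suc T * ∏ (λ p → 2 * p ∸ 3) (p ∷ ps) * sumOver G (multisets (suc T) (p ∷ ps)) ≤ 2 ^ suc T * ∏ (2 *_) (p ∷ ps) * B
rankin-step T p ps G B pr first second′ = begin
  3 * t * (d * α) * sumOver G (multisets (suc T) ps ++ map (p ∷_) (multisets T (p ∷ ps)))
    ≡⟨ cong (3 * t * (d * α) *_) (trans (sumOver-++ G (multisets (suc T) ps) _) (cong (_+_ S₁) (sumOver-map G (p ∷_) (multisets T (p ∷ ps))))) ⟩
  3 * t * (d * α) * (S₁ + S₂)                      ≡⟨ identity₁ t d α S₁ S₂ ⟩
  d * (3 * t * α * S₁) + 3 * (t * (d * α) * S₂)    ≤⟨ +-mono-≤ (*-monoʳ-≤ d first) (*-monoʳ-≤ 3 second) ⟩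
  d * (2 * u * β * B) + 3 * (2 * u * β * B)        ≡⟨ *-distribʳ-+ (2 * u * β * B) d 3 ⟨
  (d + 3) * (2 * u * β * B)                        ≡⟨ cong (_* (2 * u * β * B)) (m∸n+n≡m (≤-trans (s≤s (s≤s (s≤s z≤n))) (*-monoʳ-≤ 2 (prime≥2 pr)))) ⟩
  2 * p * (2 * u * β * B)                          ≡⟨ identity₂ p u β B ⟩
  2 * u * (2 * p * β) * B                          ∎
  where
  open ≤-Reasoning
  t = 3 ^ T
  u = 2 ^ T
  d = 2 * p ∸ 3
  α = ∏ (λ p → 2 * p ∸ 3) ps
  β = ∏ (2 *_) ps
  S₁ = sumOver G (multisets (suc T) ps)
  S₂ = sumOver (G ∘ (p ∷_)) (multisets T (p ∷ ps))
  identity₁ : ∀ t d α x y → 3 * t * (d * α) * (x + y) ≡ d * (3 * t * α * x) + 3 * (t * (d * α) * y)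
  identity₁ = solve-∀
  identity₂ : ∀ p u β B → 2 * p * (2 * u * β * B) ≡ 2 * u * (2 * p * β) * B
  identity₂ = solve-∀
  second : t * (d * α) * S₂ ≤ 2 * u * β * B
  second = *-cancelˡ-≤ p {{prime⇒nonZero pr}} (begin
    p * (t * (d * α) * S₂)                        ≡⟨ identity p (t * (d * α)) S₂ ⟩
    t * (d * α) * (p * S₂)                        ≡⟨ cong (t * (d * α) *_) (sumOver-* p (G ∘ (p ∷_)) (multisets T (p ∷ ps))) ⟨
    t * (d * α) * sumOver (λ qs → p * G (p ∷ qs)) (multisets T (p ∷ ps)) ≤⟨ second′ ⟩
    u * (2 * p * β) * B                           ≡⟨ identity₃ p u β B ⟩
    p * (2 * u * β * B)                           ∎)
    where
    identity : ∀ a b c → a * (b * c) ≡ b * (a * c)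
    identity = solve-∀
    identity₃ : ∀ p u β B → u * (2 * p * β) * B ≡ p * (2 * u * β * B)
    identity₃ = solve-∀

-- Rankin's trick: ∑ 1/∏qs over multisets of size T is at most (2/3)^T ∏ (1 - 3/(2p))⁻¹.
rankin : ∀ T ps (G : List ℕ → ℕ) B → All Prime ps →
  (∀ qs → length qs ≡ T → All Prime qs → product qs * G qs ≤ B) →
  3 ^ T * ∏ (λ p → 2 * p ∸ 3) ps * sumOver G (multisets T ps) ≤ 2 ^ T * ∏ (2 *_) ps * B
rankin zero ps G B prs le = *-mono-≤ (*-monoʳ-≤ 1 (thin≤ ps))
  (≤-trans (≤-reflexive (trans (+-identityʳ (G [])) (sym (*-identityˡ (G []))))) (le [] refl []))
rankin (suc T) [] G B prs le = ≤-trans (≤-reflexive (*-zeroʳ (3 ^ suc T * 1))) z≤n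
rankin (suc T) (p ∷ ps) G B (pr ∷ prs) le = rankin-step T p ps G B pr (rankin (suc T) ps G B prs le)
  (rankin T (p ∷ ps) (λ qs → p * G (p ∷ qs)) B (pr ∷ prs) (λ qs len qs-prime →
    ≤-trans (≤-reflexive (identity (product qs) p (G (p ∷ qs)))) (le (p ∷ qs) (cong suc len) (pr ∷ qs-prime))))
  where
  identity : ∀ a b c → a * (b * c) ≡ b * a * c
  identity = solve-∀

-- `multisets` orders its members as in `ps`, so a given list is found only up to permutation; the
-- product is all that matters later.
IsMultiset : ℕ → List ℕ → Set
IsMultiset T ps = ∀ qs → length qs ≡ T → All (_∈ ps) qs → ∃ λ qs′ → qs′ ∈ multisets T ps × product qs′ ≡ product qs

∈-multisets-step : ∀ T p ps → IsMultiset (suc T) ps → IsMultiset T (p ∷ ps) → IsMultiset (suc T) (p ∷ ps)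
∈-multisets-step T p ps without with-p qs len all with p ∈? qs
... | no p∉qs with without qs len (All.tabulate λ q∈qs → case All.lookup all q∈qs of λ where
        (here refl) → contradiction q∈qs p∉qs
        (there q∈ps) → q∈ps)
...   | qs′ , ∈ms , eq = qs′ , ∈-++⁺ˡ ∈ms , eq
∈-multisets-step T p ps without with-p qs len all | yes p∈qs with ∈-∃++ p∈qs
... | ys , zs , refl with with-p (ys ++ zs)
        (suc-injective (trans (sym (↭-length (shift p ys zs))) len))
        (Allₚ.++⁺ (Allₚ.++⁻ˡ ys all) (All.tail (Allₚ.++⁻ʳ ys all)))
...   | qs′ , ∈ms , eq = p ∷ qs′ , ∈-++⁺ʳ (multisets (suc T) ps) (∈-map⁺ (p ∷_) ∈ms) ,
        trans (cong (p *_) eq) (sym (product-↭ (shift p ys zs)))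

∈-multisets : ∀ T ps → IsMultiset T ps
∈-multisets zero ps [] len all = [] , here refl , refl
∈-multisets (suc T) [] (q ∷ qs) len (() ∷ _)
∈-multisets (suc T) (p ∷ ps) = ∈-multisets-step T p ps (∈-multisets (suc T) ps) (∈-multisets T (p ∷ ps))

-- Pigeonhole: if each of `q` consecutive chunks of length `T` had product above `D`, the whole
-- product would reach D^q.
small-chunk : ∀ (P : ℕ → Set) q T D ms → All P ms → All (1 ≤_) ms → q * T ≤ length ms → product ms < D ^ q →
  ∃ λ cs → length cs ≡ T × All P cs × product cs ∣ product ms × product cs ≤ D
small-chunk P zero T D ms all pos len lt = contradiction lt (≤⇒≯ (go pos))
  where
  go : ∀ {ms} → All (1 ≤_) ms → 1 ≤ product ms
  go [] = ≤-refl
  go (x ∷ xs) = *-mono-≤ x (go xs)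
small-chunk P (suc q) T D ms all pos len lt with product (take T ms) ≤? D
... | yes le = take T ms , trans (length-take T ms) (m≤n⇒m⊓n≡m (≤-trans (m≤m+n T (q * T)) len)) , Allₚ.take⁺ T all
             , subst (product (take T ms) ∣_) split (m∣m*n (product (drop T ms))) , le
  where
  split : product (take T ms) * product (drop T ms) ≡ product ms
  split = trans (sym (product-++ (take T ms) (drop T ms))) (cong product (take++drop≡id T ms))
... | no gt with small-chunk P q T D (drop T ms) (Allₚ.drop⁺ T all) (Allₚ.drop⁺ T pos)
      (≤-trans (≤-trans (≤-reflexive (sym (m+n∸m≡n T (q * T)))) (∸-monoˡ-≤ T len)) (≤-reflexive (sym (length-drop T ms))))
      (*-cancelˡ-< D (product (drop T ms)) (D ^ q) (≤-<-trans (≤-trans (*-monoˡ-≤ (product (drop T ms)) (<⇒≤ (≰⇒> gt))) (≤-reflexive split)) lt))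
  where
  split : product (take T ms) * product (drop T ms) ≡ product ms
  split = trans (sym (product-++ (take T ms) (drop T ms))) (cong product (take++drop≡id T ms))
...   | cs , len′ , all′ , d , le = cs , len′ , all′ , ∣-trans d (subst (product (drop T ms) ∣_)
        (trans (sym (product-++ (take T ms) (drop T ms))) (cong product (take++drop≡id T ms))) (n∣m*n (product (take T ms)))) , le

Ω-product : ∀ {n} qs → 0 < n → All Prime qs → n ≡ product qs → Ω n ≡ length qs
Ω-product {suc n} qs _ prs eq = ↭-length (factorisationUnique (factorise (suc n))
  (record { factors = qs ; isFactorisation = eq ; factorsPrime = prs }))

prime-factors : ∀ n → 0 < n → ∃ λ qs → All Prime qs × n ≡ product qs × Ω n ≡ length qs
prime-factors (suc n) _ = factors f , PrimeFactorisation.factorsPrime f , PrimeFactorisation.isFactorisation f , refl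
  where f = factorise (suc n)

Ω-* : ∀ m n → 0 < m → 0 < n → Ω (m * n) ≡ Ω m + Ω n
Ω-* m n m>0 n>0 with prime-factors m m>0 | prime-factors n n>0
... | ps , ps-prime , m≡ , Ωm | qs , qs-prime , n≡ , Ωn =
  trans (Ω-product (ps ++ qs) (*-mono-≤ m>0 n>0) (Allₚ.++⁺ ps-prime qs-prime) (trans (cong₂ _*_ m≡ n≡) (sym (product-++ ps qs))))
    (trans (length-++ ps) (sym (cong₂ _+_ Ωm Ωn)))

2^length≤product : ∀ {qs} → All Prime qs → 2 ^ length qs ≤ product qs
2^length≤product [] = ≤-refl
2^length≤product (pr ∷ prs) = *-mono-≤ (prime≥2 pr) (2^length≤product prs)

2^Ω≤ : ∀ n → 0 < n → 2 ^ Ω n ≤ n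
2^Ω≤ n n>0 with prime-factors n n>0
... | qs , prs , n≡ , Ωn = ≤-trans (≤-reflexive (cong (2 ^_) Ωn)) (≤-trans (2^length≤product prs) (≤-reflexive (sym n≡)))

ω≤Ω : ∀ n → ω n ≤ Ω n
ω≤Ω zero = z≤n
ω≤Ω (suc n) = length-deduplicate _≟_ (factors (factorise (suc n)))

-- Existence of a surviving n

∣-∣-bounds : ∀ x y {c} → ∣ + x ℤ.- + y ∣ ≤ c → x ≤ y + c × y ≤ x + c
∣-∣-bounds x y {c} le rewrite ℤₚ.m-n≡m⊖n x y with ≤-total x y
... | inj₁ x≤y rewrite ℤₚ.∣⊖∣-≤ x≤y = ≤-trans x≤y (m≤m+n y c) , ≤-trans (≤-reflexive (sym (m+[n∸m]≡n x≤y))) (+-monoʳ-≤ x le)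
... | inj₂ y≤x rewrite ℤₚ.⊖-≥ y≤x = ≤-trans (≤-reflexive (sym (m+[n∸m]≡n y≤x))) (+-monoʳ-≤ y le) , ≤-trans y≤x (m≤m+n x c)

Ranked : List Item → Set
Ranked = All (λ (p , κ) → κ < p)

wide⇒ranked : ∀ {is} → Wide is → Ranked is
wide⇒ranked = All.map (λ {i} (p>0 , le) → go (proj₂ i) p>0 le)
  where
  go : ∀ {p} κ → 0 < p → 4 * κ ≤ p → κ < p
  go zero p>0 _ = p>0
  go κ@(suc _) _ le = <-≤-trans (m<m+n κ (s≤s z≤n)) le

module Counting (a l : ℕ) where
  open Count a l

  module _ (bs : List Block) (D c : ℕ) (D>0 : 0 < D) (sieving : Sieving (flat bs))
           (coprime : CoprimeTo D (flat bs)) (ranked : Ranked (flat bs)) where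

    private
      q = modulus (flat bs) * D

    poly-count : (e : Poly (flat bs)) (f : ℕ → ℕ) (M : ℕ) →
      (∀ n → eval (at n) e ≡ + f n) → eval model e ≡ + M →
      let S = ∑ a l (λ n → ⟦ D ∣? n + c ⟧ * f n) in
      q * S ≤ l * M + q * size e × l * M ≤ q * S + q * size e
    poly-count e f M f≡ M≡ = ∣-∣-bounds (q * S) (l * M) (subst (λ z → ∣ z ∣ ≤ q * size e) eq (count e D c D>0 sieving coprime))
      where
      S = ∑ a l (λ n → ⟦ D ∣? n + c ⟧ * f n)
      sums : class-sum D c (λ n → eval (at n) e) ≡ + S
      sums = trans (∑ℤ-cong a l (λ n → trans (cong (+ ⟦ D ∣? n + c ⟧ ℤ.*_) (f≡ n)) (sym (ℤₚ.pos-* ⟦ D ∣? n + c ⟧ (f n))))) (∑-∑ℤ a l _)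
      eq : discrepancy D c e ≡ + (q * S) ℤ.- + (l * M)
      eq = cong₂ ℤ._-_ (trans (cong (+ q ℤ.*_) sums) (sym (ℤₚ.pos-* q S))) (trans (cong (+ l ℤ.*_) M≡) (sym (ℤₚ.pos-* l M)))

    weight-count :
      let S = ∑ a l (λ n → ⟦ D ∣? n + c ⟧ * BlockValues.weight (at n) bs) in
      q * S ≤ l * weight bs + q * cap bs × l * weight bs ≤ q * S + q * cap bs
    weight-count with poly-count (W bs) (λ n → BlockValues.weight (at n) bs) (weight bs)
        (λ n → BlockValues.eval-W (at n) bs (proper-at n ranked)) (eval-W bs (proper-model ranked))
    ... | lo , hi = ≤-trans lo (+-monoʳ-≤ _ (*-monoʳ-≤ q (size-W bs))) , ≤-trans hi (+-monoʳ-≤ _ (*-monoʳ-≤ q (size-W bs)))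

    defect-count :
      let S = ∑ a l (λ n → ⟦ D ∣? n + c ⟧ * BlockValues.defect (at n) bs) in
      q * S ≤ l * defect bs + q * (length bs * cap bs)
    defect-count with poly-count (H bs) (λ n → BlockValues.defect (at n) bs) (defect bs)
        (λ n → BlockValues.eval-H (at n) bs (proper-at n ranked)) (eval-H bs (proper-model ranked))
    ... | lo , _ = ≤-trans lo (+-monoʳ-≤ _ (*-monoʳ-≤ q (size-H bs)))

distinct-primes⇒coprime : ∀ {p q} → Prime p → Prime q → p ≢ q → Coprime p q
distinct-primes⇒coprime pr pr′ p≢q = prime∤⇒coprime pr λ p∣q → case prime⇒irreducible pr′ p∣q of λ where
  (inj₁ refl) → ¬prime[1] pr
  (inj₂ p≡q) → p≢q p≡q

sieving : ∀ {is} → All (λ i → Prime (proj₁ i)) is → Distinct is → Sieving is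
sieving prs ds = All.map (λ pr → <-trans (s≤s z≤n) (prime≥2 pr)) prs , go prs ds
  where
  go : ∀ {is} → All (λ i → Prime (proj₁ i)) is → Distinct is → AllPairs (λ i j → Coprime (proj₁ i) (proj₁ j)) is
  go [] [] = []
  go (pr ∷ prs) (d ∷ ds) = All.zipWith (λ {j} (pr′ , ne) {_} → distinct-primes⇒coprime pr pr′ ne) (prs , d) ∷ go prs ds

-- {n : P ∣ n, g d ∣ n - k} with g = gcd(P, k) lies in a single class modulo P d: if it is
-- nonempty then d is coprime to P / g, because P/g and k/g are coprime.
single-class : ∀ P k d n₁ → 0 < P → 0 < d → k ≤ n₁ → P ∣ n₁ → gcd P k * d ∣ n₁ ∸ k →
  ∃ λ c → ∀ n → k ≤ n → P ∣ n → gcd P k * d ∣ n ∸ k → P * d ∣ n + c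
single-class P k d n₁ P>0 d>0 k≤n₁ P∣n₁ gd∣ with next-multiple (P * d) n₁ (*-mono-≤ P>0 d>0)
... | c , _ , Pd∣ = c , inclusion
  where
  g = gcd P k
  instance
    g≢0 : NonZero g
    g≢0 = ≢-nonZero (λ eq → <⇒≢ P>0 (sym (gcd[m,n]≡0⇒m≡0 eq)))
  P′ = P / g
  k′ = k / g
  P≡ : g * P′ ≡ P
  P≡ = m*[n/m]≡n (gcd[m,n]∣m P k)
  k≡ : g * k′ ≡ k
  k≡ = m*[n/m]≡n (gcd[m,n]∣n P k)
  d⊥P′ : Coprime d P′
  d⊥P′ {e} (e∣d , e∣P′) = coprime-/gcd P k (e∣P′ , ∣m+n∣m⇒∣n (subst (e ∣_) (sym n₁′≡) (∣-trans e∣P′ (m∣m*n w))) (∣-trans e∣d (m∣m*n v)))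
    where
    v = quotient gd∣
    w = quotient P∣n₁
    n₁′≡ : d * v + k′ ≡ P′ * w
    n₁′≡ = *-cancelˡ-≡ (d * v + k′) (P′ * w) g (begin
      g * (d * v + k′)          ≡⟨ *-distribˡ-+ g (d * v) k′ ⟩
      g * (d * v) + g * k′      ≡⟨ cong₂ _+_ (sym (*-assoc g d v)) k≡ ⟩
      g * d * v + k             ≡⟨ cong (_+ k) (m∣n⇒n≡m*quotient gd∣) ⟨
      n₁ ∸ k + k                ≡⟨ m∸n+n≡m k≤n₁ ⟩
      n₁                        ≡⟨ m∣n⇒n≡m*quotient P∣n₁ ⟩
      P * w                     ≡⟨ cong (_* w) P≡ ⟨
      g * P′ * w                ≡⟨ *-assoc g P′ w ⟩
      g * (P′ * w)              ∎)
      where open ≡-Reasoning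
  P∣c : P ∣ c
  P∣c = ∣m+n∣m⇒∣n (∣-trans (m∣m*n d) Pd∣) P∣n₁
  gd∣Pd : g * d ∣ P * d
  gd∣Pd = *-monoˡ-∣ d (gcd[m,n]∣m P k)
  gd∣k+c : g * d ∣ k + c
  gd∣k+c = ∣m+n∣m⇒∣n (subst (g * d ∣_) (trans (cong (_+ c) (sym (m∸n+n≡m k≤n₁))) (+-assoc (n₁ ∸ k) k c)) (∣-trans gd∣Pd Pd∣)) gd∣
  inclusion : ∀ n → k ≤ n → P ∣ n → g * d ∣ n ∸ k → P * d ∣ n + c
  inclusion n k≤n P∣n gd∣n = subst₂ _∣_ Pd≡ (sym z≡) (*-monoʳ-∣ g (coprime⇒*∣ d⊥P′ d∣z P′∣z))
    where
    gd∣n+c : g * d ∣ n + c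
    gd∣n+c = subst (g * d ∣_) (trans (sym (+-assoc (n ∸ k) k c)) (cong (_+ c) (m∸n+n≡m k≤n))) (∣m∣n⇒∣m+n gd∣n gd∣k+c)
    g∣n+c : g ∣ n + c
    g∣n+c = ∣-trans (m∣m*n d) gd∣n+c
    z = quotient g∣n+c
    z≡ : n + c ≡ g * z
    z≡ = m∣n⇒n≡m*quotient g∣n+c
    d∣z : d ∣ z
    d∣z = *-cancelˡ-∣ g (subst (g * d ∣_) z≡ gd∣n+c)
    P′∣z : P′ ∣ z
    P′∣z = *-cancelˡ-∣ g (subst₂ _∣_ (sym P≡) z≡ (∣m∣n⇒∣m+n P∣n P∣c))
    Pd≡ : g * (d * P′) ≡ P * d
    Pd≡ = trans (identity g d P′) (cong (_* d) P≡)
      where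
      identity : ∀ g d p → g * (d * p) ≡ g * p * d
      identity = solve-∀

∤-product : ∀ {p} qs → Prime p → All Prime qs → All (p ≢_) qs → ¬ p ∣ product qs
∤-product qs pr prs ne d = All.lookup ne (factorisationHasAllPrimeFactors pr d prs) refl

-- Six primes, each saving 8/9, gain a factor 2, because 2 · 8^6 = 524288 and 9^6 = 531441.
power-gap : ∀ T → 2 ^ T * 8 ^ (6 * T) ≤ 9 ^ (6 * T)
power-gap T = begin
  2 ^ T * 8 ^ (6 * T)     ≡⟨ cong (2 ^ T *_) (^-*-assoc 8 6 T) ⟨
  2 ^ T * (8 ^ 6) ^ T     ≡⟨ *-^ 2 (8 ^ 6) T ⟨
  (2 * 8 ^ 6) ^ T         ≤⟨ ^-monoˡ-≤ T (≤ᵇ⇒≤ (2 * 8 ^ 6) (9 ^ 6) _) ⟩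
  (9 ^ 6) ^ T             ≡⟨ ^-*-assoc 9 6 T ⟩
  9 ^ (6 * T)             ∎
  where open ≤-Reasoning

module Sieve (κ₆ : ℕ) (6≤κ₆ : 6 ≤ κ₆) (J P X : ℕ) where

  open Thinness κ₆ 6≤κ₆

  -- The lowest block has depth j = J - 1 and needs j + 3 ≤ s.
  s = J + 2
  D₀ = 2 ^ (s * 4 ^ J)
  bs = blocks s J 0
  Q = modulus (flat bs)
  V = void (flat bs)

  goods : Goods 0 bs
  goods = blocks-goods s J 0 (≤-reflexive (cong (_+ 2) (+-identityʳ J)))

  wides : Wide (flat bs)
  wides = goods-wide 0 bs goods

  candidates : ℕ → List ℕ
  candidates k with lg k <? J
  ... | yes _ = tower s (J ∸ lg k) (lg k)
  ... | no _ = span 0 s ++ tower s 0 J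

  -- T k = 6 τ lg k is chosen so that 2^(T/6) beats the loss 2^(4 t₀ lg k) from the
  -- candidate primes by the factor 2^(10 lg k), which sums over k.
  τ : ℕ
  τ = 4 * t₀ + 10

  T : ℕ → ℕ
  T k = 6 * (τ * lg k)

  -- The sieve is stripped of the primes in `qs`, so that its items are coprime to the modulus
  -- imposed by `qs`; at an unhit n the stripped weight is still 1.
  term : ℕ → ℕ → List ℕ → ℕ
  term n k qs = ⟦ product qs ≤? D₀ ⟧ * ⟦ gcd P k * product qs ∣? n ∸ k ⟧ * BlockValues.weight (at n) (keep qs bs)

  -- By `level`, an error of `cap bs` is at most 1/(16(J + 1)) of X V / (Q P D₀), the least main
  -- term for a class modulo P d with d ≤ D₀. The factor J + 1 pays for the J blocks in the defect
  -- and for the weight itself.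
  module Bounds (P>0 : 0 < P) (P⊥ : CoprimeTo P (flat bs)) (D₀<X : D₀ < X)
                (level : Q * P * (16 * (J + 1) * (D₀ * cap bs)) ≤ X * V) where

    G : ℕ → List ℕ → ℕ
    G k qs = ∑ X X (λ n → ⟦ P ∣? n + 0 ⟧ * term n k qs)

    level₁ : Q * P * (D₀ * cap bs) ≤ X * V
    level₁ = ≤-trans (*-monoʳ-≤ (Q * P) (m≤n*m (D₀ * cap bs) (16 * (J + 1)) {{>-nonZero (*-mono-≤ {1} {16} (s≤s z≤n) (m≤n+m 1 J))}})) level

    -- In units of (4/3)^T X V / (P Q d), with T = `length qs` and d = `product qs`, the main term
    -- is at most 3/2 (`weight≤void` at j = 0, then `keep-void`) and the counting error at most 1;
    -- the sum is rounded up to 3.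
    class-bound : ∀ qs c → All Prime qs → product qs ≤ D₀ →
      product qs * (P * Q * 3 ^ length qs * ∑ X X (λ n → ⟦ P * product qs ∣? n + c ⟧ * BlockValues.weight (at n) (keep qs bs)))
      ≤ 3 * 4 ^ length qs * (X * V)
    class-bound qs c prs d≤D₀ = *-cancelˡ-≤ (2 * Q′) {{>-nonZero (*-mono-≤ {1} {2} (s≤s z≤n) Q′>0)}} (begin
      2 * Q′ * (d * (P * Q * u * S))                        ≡⟨ identity₁ Q′ d P Q u S ⟩
      2 * (Q * u) * (Q′ * (P * d) * S)                      ≤⟨ *-monoʳ-≤ (2 * (Q * u)) counted ⟩
      2 * (Q * u) * (X * M′ + Q′ * (P * d) * cap bs′)       ≡⟨ identity₂ Q u X M′ Q′ P d (cap bs′) ⟩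
      X * (u * Q) * (2 * 1 * M′) + 2 * Q′ * u * (Q * P * (d * cap bs′))
        ≤⟨ +-mono-≤ (*-monoʳ-≤ (X * (u * Q)) (weight≤void 0 bs′ (goods⇒tame 0 bs′ (goods-keep qs 0 bs goods))))
                    (*-mono-≤ (*-monoʳ-≤ (2 * Q′) (^-monoˡ-≤ (length qs) {3} {4} (s≤s (s≤s (s≤s z≤n)))))
                      (≤-trans (*-monoʳ-≤ (Q * P) (*-mono-≤ d≤D₀ (cap-keep qs bs))) level₁)) ⟩
      X * (u * Q) * (3 * V′) + 2 * Q′ * f * (X * V)         ≡⟨ cong (_+ 2 * Q′ * f * (X * V)) (identity₃ X u Q V′) ⟩
      3 * X * (u * (V′ * Q)) + 2 * Q′ * f * (X * V)         ≤⟨ +-monoˡ-≤ (2 * Q′ * f * (X * V)) (*-monoʳ-≤ (3 * X) (keep-void qs bs wides (blocks-distinct s J 0))) ⟩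
      3 * X * (f * (V * Q′)) + 2 * Q′ * f * (X * V)         ≤⟨ +-monoʳ-≤ (3 * X * (f * (V * Q′))) (m≤n+m _ (Q′ * f * (X * V))) ⟩
      3 * X * (f * (V * Q′)) + (Q′ * f * (X * V) + 2 * Q′ * f * (X * V)) ≡⟨ identity₄ X f V Q′ ⟩
      2 * Q′ * (3 * f * (X * V))                            ∎)
      where
      open ≤-Reasoning
      d = product qs
      bs′ = keep qs bs
      Q′ = modulus (flat bs′)
      V′ = void (flat bs′)
      M′ = weight bs′
      u = 3 ^ length qs
      f = 4 ^ length qs
      S = ∑ X X (λ n → ⟦ P * d ∣? n + c ⟧ * BlockValues.weight (at n) bs′)
      wides′ : Wide (flat bs′)
      wides′ = All-keep qs bs wides
      primes′ = All-keep qs bs (blocks-prime s J 0)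
      Q′>0 : 0 < Q′
      Q′>0 = modulus>0 (All.map proj₁ wides′)
      d⊥ : CoprimeTo d (flat bs′)
      d⊥ = All.zipWith (λ (pr , ne) {_} (e∣d , e∣p) → prime∤⇒coprime pr (∤-product qs pr prs ne) (e∣p , e∣d)) (primes′ , keep-avoids qs bs)
      counted : Q′ * (P * d) * S ≤ X * M′ + Q′ * (P * d) * cap bs′
      counted = proj₁ (Counting.weight-count X X bs′ (P * d) c (*-mono-≤ P>0 (product-primes>0 prs))
        (sieving primes′ (AllPairs-keep qs bs (blocks-distinct s J 0)))
        (coprimeTo-* (All-keep qs bs P⊥) d⊥) (wide⇒ranked wides′))
      identity₁ : ∀ q d p r u s → 2 * q * (d * (p * r * u * s)) ≡ 2 * (r * u) * (q * (p * d) * s)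
      identity₁ = solve-∀
      identity₂ : ∀ r u x m q p d c → 2 * (r * u) * (x * m + q * (p * d) * c) ≡ x * (u * r) * (2 * 1 * m) + 2 * q * u * (r * p * (d * c))
      identity₂ = solve-∀
      identity₃ : ∀ x u q v → x * (u * q) * (3 * v) ≡ 3 * x * (u * (v * q))
      identity₃ = solve-∀
      identity₄ : ∀ x f v q → 3 * x * (f * (v * q)) + (q * f * (x * v) + 2 * q * f * (x * v)) ≡ 2 * q * (3 * f * (x * v))
      identity₄ = solve-∀

    -- Either nothing contributes, or a contributing n₁ is the base point from which `single-class`
    -- finds the class modulo P d containing all contributions.
    G-bound : ∀ k qs → k ≤ X → All Prime qs → product qs * (P * Q * 3 ^ length qs * G k qs) ≤ 3 * 4 ^ length qs * (X * V)
    G-bound k qs k≤X prs with ∑-witness X X (λ n → ⟦ P ∣? n + 0 ⟧ * term n k qs)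
    ... | inj₁ G≡0 = ≤-trans (≤-reflexive (trans (cong (λ z → product qs * (P * Q * 3 ^ length qs * z)) G≡0)
                       (trans (cong (product qs *_) (*-zeroʳ (P * Q * 3 ^ length qs))) (*-zeroʳ (product qs))))) z≤n
    ... | inj₂ (n₁ , X≤n₁ , ne) = go (P ∣? n₁ + 0) (product qs ≤? D₀) (gcd P k * product qs ∣? n₁ ∸ k) ne
      where
      d = product qs
      go : (a? : Dec (P ∣ n₁ + 0)) (b? : Dec (d ≤ D₀)) (c? : Dec (gcd P k * d ∣ n₁ ∸ k)) →
           ⟦ a? ⟧ * (⟦ b? ⟧ * ⟦ c? ⟧ * BlockValues.weight (at n₁) (keep qs bs)) ≢ 0 →
           d * (P * Q * 3 ^ length qs * G k qs) ≤ 3 * 4 ^ length qs * (X * V)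
      go (no _) _ _ ne = contradiction refl ne
      go (yes _) (no _) _ ne = contradiction refl ne
      go (yes _) (yes _) (no _) ne = contradiction refl ne
      go (yes P∣n₁) (yes d≤D₀) (yes gd∣n₁) _
        with single-class P k d n₁ P>0 (product-primes>0 prs) (≤-trans k≤X X≤n₁) (subst (P ∣_) (+-identityʳ n₁) P∣n₁) gd∣n₁
      ... | c , inclusion = ≤-trans (*-monoʳ-≤ d (*-monoʳ-≤ (P * Q * 3 ^ length qs) (∑-mono X X below))) (class-bound qs c prs d≤D₀)
        where
        below : ∀ n → X ≤ n → ⟦ P ∣? n + 0 ⟧ * term n k qs ≤ ⟦ P * d ∣? n + c ⟧ * BlockValues.weight (at n) (keep qs bs)
        below n X≤n = pointwise (P ∣? n + 0) (d ≤? D₀) (gcd P k * d ∣? n ∸ k) (P * d ∣? n + c) (BlockValues.weight (at n) (keep qs bs))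
            (λ P∣ gd∣ → inclusion n (≤-trans k≤X X≤n) (subst (P ∣_) (+-identityʳ n) P∣) gd∣)
          where
          pointwise : ∀ {A B C D : Set} (a? : Dec A) (b? : Dec B) (c? : Dec C) (d? : Dec D) w → (A → C → D) →
                      ⟦ a? ⟧ * (⟦ b? ⟧ * ⟦ c? ⟧ * w) ≤ ⟦ d? ⟧ * w
          pointwise (no _) _ _ _ w f = z≤n
          pointwise (yes _) (no _) _ _ w f = z≤n
          pointwise (yes _) (yes _) (no _) _ w f = z≤n
          pointwise (yes a) (yes _) (yes c) d? w f rewrite ⟦⟧-true d? (f a c) = ≤-reflexive (+-identityʳ (w + 0))

    candidates-prime : ∀ k → All Prime (candidates k)
    candidates-prime k with lg k <? J
    ... | yes _ = tower-prime s (J ∸ lg k) (lg k)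
    ... | no _ = Allₚ.++⁺ (span-primes 0 s) (tower-prime s 0 J)

    thin-mono : ∀ {t u} ps → t ≤ u → Thin t ps → Thin u ps
    thin-mono ps t≤u th = ≤-trans th (*-monoˡ-≤ (∏ (λ p → 2 * p ∸ 3) ps) (^-monoʳ-≤ 2 t≤u))

    -- The 4 comes from large k: s dyadic intervals and J layers make 2J + 2 charges, and J ≤ lg k,
    -- 1 ≤ lg k.
    candidates-thin : ∀ k → 1 < k → Thin (4 * t₀ * lg k) (candidates k)
    candidates-thin k 1<k with lg k <? J
    ... | yes _ = thin-mono (tower s (J ∸ lg k) (lg k)) (≤-trans (≤-reflexive (*-comm (lg k) t₀)) (*-monoˡ-≤ (lg k) (m≤m+n t₀ _)))
                    (thin-tower s (J ∸ lg k) (lg k) s>0)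
      where
      s>0 : 0 < s
      s>0 = ≤-trans (s≤s z≤n) (m≤n+m 2 J)
    ... | no ≮J = thin-mono (span 0 s ++ tower s 0 J) (begin
        s * t₀ + J * t₀          ≡⟨ *-distribʳ-+ t₀ s J ⟨
        (J + 2 + J) * t₀         ≤⟨ *-monoˡ-≤ t₀ (+-mono-≤ (+-mono-≤ J≤ℓ (*-monoʳ-≤ 2 (lg-positive k 1<k))) J≤ℓ) ⟩
        (lg k + 2 * lg k + lg k) * t₀ ≡⟨ identity (lg k) t₀ ⟩
        4 * t₀ * lg k            ∎)
        (thin-++ (s * t₀) (J * t₀) (span 0 s) (tower s 0 J) (thin-span 0 s) (thin-tower s 0 J s>0))
      where
      open ≤-Reasoning
      J≤ℓ = ≮⇒≥ ≮J
      s>0 : 0 < s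
      s>0 = ≤-trans (s≤s z≤n) (m≤n+m 2 J)
      identity : ∀ l t → (l + 2 * l + l) * t ≡ 4 * t * l
      identity = solve-∀

    Sₖ : ℕ → ℕ
    Sₖ k = sumOver (G k) (multisets (T k) (candidates k))

    thin-positive : ∀ ps → All Prime ps → 0 < ∏ (λ p → 2 * p ∸ 3) ps
    thin-positive [] [] = s≤s z≤n
    thin-positive (p ∷ ps) (pr ∷ prs) = *-mono-≤ (≤-trans (s≤s z≤n) (∸-monoˡ-≤ 3 (*-monoʳ-≤ 2 (prime≥2 pr)))) (thin-positive ps prs)

    -- The (4/3)^T of the stripped sieve meets the (2/3)^T of `rankin`; by `power-gap`, (9/8)^T is
    -- at least 2^(τ lg k), of which the candidates consume 2^(4 t₀ lg k).
    S-rankin : ∀ k → 1 < k → k ≤ X → 2 ^ (10 * lg k) * (P * Q * Sₖ k) ≤ 3 * (X * V)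
    S-rankin k 1<k k≤X = *-cancelˡ-≤ (8 ^ t * (h * α)) {{>-nonZero (*-mono-≤ (m^n>0 8 t) (*-mono-≤ (m^n>0 2 (4 * t₀ * lg k)) α>0))}} (begin
      8 ^ t * (h * α) * (2 ^ (10 * lg k) * A)       ≡⟨ identity₁ (8 ^ t) h α (2 ^ (10 * lg k)) A ⟩
      h * 2 ^ (10 * lg k) * 8 ^ t * (α * A)         ≡⟨ cong (λ z → z * 8 ^ t * (α * A)) powers ⟩
      2 ^ (τ * lg k) * 8 ^ t * (α * A)              ≤⟨ *-monoˡ-≤ (α * A) (power-gap (τ * lg k)) ⟩
      9 ^ t * (α * A)                               ≡⟨ cong (_* (α * A)) (*-^ 3 3 t) ⟩
      3 ^ t * 3 ^ t * (α * (P * Q * S))             ≡⟨ identity₂ (3 ^ t) α (P * Q) S ⟩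
      3 ^ t * α * (P * Q * 3 ^ t * S)               ≡⟨ cong (3 ^ t * α *_) (sumOver-* (P * Q * 3 ^ t) (G k) (multisets t (candidates k))) ⟨
      3 ^ t * α * sumOver (λ qs → P * Q * 3 ^ t * G k qs) (multisets t (candidates k))
        ≤⟨ rankin t (candidates k) (λ qs → P * Q * 3 ^ t * G k qs) (3 * 4 ^ t * (X * V)) (candidates-prime k)
             (λ qs len prs → subst (λ z → product qs * (P * Q * 3 ^ z * G k qs) ≤ 3 * 4 ^ z * (X * V)) len (G-bound k qs k≤X prs)) ⟩
      2 ^ t * ∏ (2 *_) (candidates k) * (3 * 4 ^ t * (X * V))  ≤⟨ *-monoˡ-≤ (3 * 4 ^ t * (X * V)) (*-monoʳ-≤ (2 ^ t) (candidates-thin k 1<k)) ⟩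
      2 ^ t * (h * α) * (3 * 4 ^ t * (X * V))       ≡⟨ identity₃ (2 ^ t) h α (4 ^ t) (X * V) ⟩
      2 ^ t * 4 ^ t * (h * α) * (3 * (X * V))       ≡⟨ cong (λ z → z * (h * α) * (3 * (X * V))) (*-^ 2 4 t) ⟨
      8 ^ t * (h * α) * (3 * (X * V))               ∎)
      where
      open ≤-Reasoning
      t = T k
      h = 2 ^ (4 * t₀ * lg k)
      α = ∏ (λ p → 2 * p ∸ 3) (candidates k)
      α>0 = thin-positive (candidates k) (candidates-prime k)
      S = Sₖ k
      A = P * Q * S
      powers : h * 2 ^ (10 * lg k) ≡ 2 ^ (τ * lg k)
      powers = trans (sym (^-distribˡ-+-* 2 (4 * t₀ * lg k) (10 * lg k))) (cong (2 ^_) (sym (*-distribʳ-+ (lg k) (4 * t₀) 10)))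
      identity₁ : ∀ e h α t A → e * (h * α) * (t * A) ≡ h * t * e * (α * A)
      identity₁ = solve-∀
      identity₂ : ∀ u α p s → u * u * (α * (p * s)) ≡ u * α * (p * u * s)
      identity₂ = solve-∀
      identity₃ : ∀ a h α b x → a * (h * α) * (3 * b * x) ≡ a * b * (h * α) * (3 * x)
      identity₃ = solve-∀

    -- Of the gain 2^(10 lg k), the part 2^(2 lg k) covers k (k - 1) up to a factor 4; the part 2^(8
    -- lg k) ≥ 256 absorbs this 4 together with 3 · 16.
    S-bound : ∀ k → 1 < k → k ≤ X → k * pred k * (16 * (P * Q * Sₖ k)) ≤ X * V
    S-bound k 1<k k≤X = *-cancelˡ-≤ 3 (begin
      3 * (k * pred k * (16 * A))      ≡⟨ identity (k * pred k) A ⟩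
      48 * (k * pred k) * A            ≤⟨ *-monoˡ-≤ A (begin
        48 * (k * pred k)                   ≤⟨ *-monoʳ-≤ 48 (*-mono-≤ k≤ (≤-trans (pred[n]≤n {k}) k≤)) ⟩
        48 * (2 * x * (2 * x))              ≡⟨ identity₂ x ⟩
        192 * (x * x)                       ≤⟨ *-monoˡ-≤ (x * x) {192} {256} (≤ᵇ⇒≤ 192 256 _) ⟩
        2 ^ 8 * (x * x)                     ≤⟨ *-monoˡ-≤ (x * x) (^-monoʳ-≤ 2 (*-monoʳ-≤ 8 (lg-positive k 1<k))) ⟩
        2 ^ (8 * lg k) * (x * x)            ≡⟨ cong (2 ^ (8 * lg k) *_) (^-2* 2 (lg k)) ⟨
        2 ^ (8 * lg k) * 2 ^ (2 * lg k)     ≡⟨ ^-distribˡ-+-* 2 (8 * lg k) (2 * lg k) ⟨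
        2 ^ (8 * lg k + 2 * lg k)           ≡⟨ cong (2 ^_) (*-distribʳ-+ (lg k) 8 2) ⟨
        2 ^ (10 * lg k)                     ∎) ⟩
      2 ^ (10 * lg k) * A              ≤⟨ S-rankin k 1<k k≤X ⟩
      3 * (X * V)                      ∎)
      where
      open ≤-Reasoning
      A = P * Q * Sₖ k
      x = 2 ^ lg k
      k≤ : k ≤ 2 * x
      k≤ = <⇒≤ (lg-upper k)
      identity : ∀ y A → 3 * (y * (16 * A)) ≡ 48 * y * A
      identity = solve-∀
      identity₂ : ∀ x → 48 * (2 * x * (2 * x)) ≡ 192 * (x * x)
      identity₂ = solve-∀

    S-total : 16 * (P * Q * sumOver Sₖ (interval 1 D₀)) ≤ X * V
    S-total = begin
      16 * (P * Q * S)                                                  ≡⟨ *-assoc 16 (P * Q) S ⟨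
      16 * (P * Q) * S                                                  ≡⟨ sumOver-* (16 * (P * Q)) Sₖ (interval 1 D₀) ⟨
      sumOver (λ k → 16 * (P * Q) * Sₖ k) (interval 1 D₀)               ≡⟨ *-identityˡ _ ⟨
      1 * sumOver (λ k → 16 * (P * Q) * Sₖ k) (interval 1 D₀)           ≤⟨ telescope (X * V) (λ k → 16 * (P * Q) * Sₖ k) 1 D₀
        (λ k 1<k k≤ → ≤-trans (≤-reflexive (cong (k * pred k *_) (*-assoc 16 (P * Q) (Sₖ k)))) (S-bound k 1<k (≤-trans k≤ D₀<X))) ⟩
      X * V                                                             ∎
      where
      open ≤-Reasoning
      S = sumOver Sₖ (interval 1 D₀)

    bad : ℕ → ℕ
    bad n = sumOver (λ k → sumOver (term n k) (multisets (T k) (candidates k))) (interval 1 D₀)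

    ∑-bad : ∑ X X (λ n → ⟦ P ∣? n + 0 ⟧ * bad n) ≡ sumOver Sₖ (interval 1 D₀)
    ∑-bad = trans (∑-cong X X (λ n → sym (sumOver-* ⟦ P ∣? n + 0 ⟧ (λ k → sumOver (term n k) (multisets (T k) (candidates k))) (interval 1 D₀))))
      (trans (∑-sumOver X X (λ k n → ⟦ P ∣? n + 0 ⟧ * sumOver (term n k) (multisets (T k) (candidates k))) (interval 1 D₀))
        (cong sum (map-cong (λ k →
          trans (∑-cong X X (λ n → sym (sumOver-* ⟦ P ∣? n + 0 ⟧ (term n k) (multisets (T k) (candidates k)))))
            (∑-sumOver X X (λ qs n → ⟦ P ∣? n + 0 ⟧ * term n k qs) (multisets (T k) (candidates k)))) (interval 1 D₀))))

    V>0 : 0 < V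
    V>0 = go wides
      where
      go : ∀ {is} → Wide is → 0 < void is
      go [] = s≤s z≤n
      go ws@(_ ∷ ws′) with wide⇒ranked ws
      ... | κ<p ∷ _ = *-mono-≤ (m<n⇒0<n∸m κ<p) (go ws′)

    private
      siev = sieving (blocks-prime s J 0) (blocks-distinct s J 0)
      S-W = ∑ X X (λ n → ⟦ P ∣? n + 0 ⟧ * BlockValues.weight (at n) bs)
      S-H = ∑ X X (λ n → ⟦ P ∣? n + 0 ⟧ * BlockValues.defect (at n) bs)
      S-B = sumOver Sₖ (interval 1 D₀)
      M = weight bs

    -- Otherwise 16 X M would be at most 4 X M from the defect, plus X V from the bad divisors, plus
    -- X V from the counting errors; since V ≤ M, this is at most 6 X M.
    main-inequality : S-H + S-B < S-W
    main-inequality with S-H + S-B <? S-W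
    ... | yes lt = lt
    ... | no ≮ = contradiction (begin
        16 * (X * M)                                              ≤⟨ *-monoʳ-≤ 16 (proj₂ counted-W) ⟩
        16 * (Q * P * S-W + Q * P * cap bs)                       ≤⟨ *-monoʳ-≤ 16 (+-monoˡ-≤ (Q * P * cap bs) (*-monoʳ-≤ (Q * P) (≮⇒≥ ≮))) ⟩
        16 * (Q * P * (S-H + S-B) + Q * P * cap bs)               ≡⟨ identity₁ Q P S-H S-B (cap bs) ⟩
        16 * (Q * P * S-H) + 16 * (P * Q * S-B) + 16 * (Q * P * cap bs) ≤⟨ +-monoˡ-≤ _ (+-mono-≤ (*-monoʳ-≤ 16 counted-H) S-total) ⟩
        16 * (X * defect bs + Q * P * (length bs * cap bs)) + X * V + 16 * (Q * P * cap bs)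
          ≡⟨ cong (λ z → 16 * (X * defect bs + Q * P * (z * cap bs)) + X * V + 16 * (Q * P * cap bs)) (length-blocks s J 0) ⟩
        16 * (X * defect bs + Q * P * (J * cap bs)) + X * V + 16 * (Q * P * cap bs)  ≡⟨ identity₂ X (defect bs) Q P J (cap bs) (X * V) ⟩
        4 * X * (4 * 1 * defect bs) + X * V + Q * P * (16 * (J + 1) * (1 * cap bs))
          ≤⟨ +-mono-≤ (+-monoˡ-≤ (X * V) (*-monoʳ-≤ (4 * X) (defect≤weight 0 bs (goods⇒tame 0 bs goods))))
                (≤-trans (*-monoʳ-≤ (Q * P) (*-monoʳ-≤ (16 * (J + 1)) (*-monoˡ-≤ (cap bs) (m^n>0 2 (s * 4 ^ J))))) level) ⟩
        4 * X * M + X * V + X * V                                 ≤⟨ +-mono-≤ (+-monoʳ-≤ (4 * X * M) (*-monoʳ-≤ X (void≤weight bs))) (*-monoʳ-≤ X (void≤weight bs)) ⟩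
        4 * X * M + X * M + X * M                                 ≡⟨ identity₃ X M ⟩
        6 * (X * M)                                               ∎)
        (<⇒≱ (*-monoˡ-< (X * M) {{>-nonZero XM>0}} {6} {16} (≤ᵇ⇒≤ 7 16 _)))
      where
      open ≤-Reasoning
      counted-W = Counting.weight-count X X bs P 0 P>0 siev P⊥ (wide⇒ranked wides)
      counted-H = Counting.defect-count X X bs P 0 P>0 siev P⊥ (wide⇒ranked wides)
      XM>0 : 0 < X * M
      XM>0 = *-mono-≤ (≤-trans (s≤s z≤n) D₀<X) (≤-trans V>0 (void≤weight bs))
      identity₁ : ∀ q p h b c → 16 * (q * p * (h + b) + q * p * c) ≡ 16 * (q * p * h) + 16 * (p * q * b) + 16 * (q * p * c)
      identity₁ = solve-∀
      identity₂ : ∀ x d q p j c v → 16 * (x * d + q * p * (j * c)) + v + 16 * (q * p * c)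
                ≡ 4 * x * (4 * 1 * d) + v + q * p * (16 * (j + 1) * (1 * c))
      identity₂ = solve-∀
      identity₃ : ∀ x m → 4 * x * m + x * m + x * m ≡ 6 * (x * m)
      identity₃ = solve-∀

    record Survivor : Set where
      field
        n       : ℕ
        X≤n     : X ≤ n
        n<2X    : n < X + X
        P∣n     : P ∣ n
        unhit   : Unhit n (flat bs)
        no-divisor : ∀ k qs → 1 < k → k ≤ D₀ → qs ∈ multisets (T k) (candidates k) → product qs ≤ D₀ →
                     ¬ gcd P k * product qs ∣ n ∸ k

    -- Where defect + bad < weight, n is unhit, because a hit would force weight ≤ defect. Then the
    -- weight is 1, so the integer `bad n` is 0, whereas a forbidden divisor would contribute a term
    -- equal to 1.
    survivor : Survivor
    survivor with ∑-<-witness X X (λ n → ⟦ P ∣? n + 0 ⟧ * (BlockValues.defect (at n) bs + bad n))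
                                  (λ n → ⟦ P ∣? n + 0 ⟧ * BlockValues.weight (at n) bs)
                                  (≤-<-trans (≤-reflexive split) main-inequality)
      where
      split : ∑ X X (λ n → ⟦ P ∣? n + 0 ⟧ * (BlockValues.defect (at n) bs + bad n)) ≡ S-H + S-B
      split = trans (∑-cong X X (λ n → *-distribˡ-+ ⟦ P ∣? n + 0 ⟧ (BlockValues.defect (at n) bs) (bad n)))
        (trans (∑-+ X X _ _) (cong (_+_ S-H) ∑-bad))
    ... | n , X≤n , n<2X , lt = go (P ∣? n + 0) lt
      where
      go : (a? : Dec (P ∣ n + 0)) → ⟦ a? ⟧ * (BlockValues.defect (at n) bs + bad n) < ⟦ a? ⟧ * BlockValues.weight (at n) bs → Survivor
      go (yes P∣n) lt = record
        { n = n ; X≤n = X≤n ; n<2X = n<2X ; P∣n = subst (P ∣_) (+-identityʳ n) P∣n ; unhit = unhit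
        ; no-divisor = λ k qs 1<k k≤D₀ qs∈ d≤D₀ gd∣ → 0≢1+n (trans (sym (term≡0 k qs 1<k k≤D₀ qs∈)) (term≡1 k qs d≤D₀ gd∣)) }
        where
        lt′ : BlockValues.defect (at n) bs + bad n < BlockValues.weight (at n) bs
        lt′ = subst₂ _<_ (+-identityʳ _) (+-identityʳ _) lt
        unhit : Unhit n (flat bs)
        unhit = defect<weight⇒unhit n bs (≤-<-trans (m≤m+n _ (bad n)) lt′)
        bad≡0 : bad n ≡ 0
        bad≡0 = n<1⇒n≡0 (≤-<-trans (m≤n+m (bad n) _) (<-≤-trans lt′ (≤-reflexive (unhit⇒weight n bs unhit))))
        term≡0 : ∀ k qs → 1 < k → k ≤ D₀ → qs ∈ multisets (T k) (candidates k) → term n k qs ≡ 0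
        term≡0 k qs 1<k k≤D₀ qs∈ = sumOver≡0 (term n k) qs∈
          (sumOver≡0 (λ k → sumOver (term n k) (multisets (T k) (candidates k))) (∈-interval 1 D₀ 1<k (m≤n⇒m≤1+n k≤D₀)) bad≡0)
        term≡1 : ∀ k qs → product qs ≤ D₀ → gcd P k * product qs ∣ n ∸ k → term n k qs ≡ 1
        term≡1 k qs d≤D₀ gd∣ rewrite ⟦⟧-true (product qs ≤? D₀) d≤D₀ | ⟦⟧-true (gcd P k * product qs ∣? n ∸ k) gd∣
          | unhit⇒weight n (keep qs bs) (All-keep qs bs unhit) = refl

    -- From a survivor to the bound on Ω

    module Endgame (P≡ : P ≡ (2 ^ s) ! * (2 ^ s) !) (q : ℕ) (2X≤D₀^q : X + X ≤ D₀ ^ q) (σ : Survivor) where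

      open Survivor σ

      private
        y = 2 ^ s

      n<D₀^q : n < D₀ ^ q
      n<D₀^q = <-≤-trans n<2X 2X≤D₀^q

      -- The 1 accounts for gcd(P, k) ≤ k, and 6 τ q for the fewer than q T(k) prime factors of the
      -- cofactor, as 2^(lg k) ≤ k.
      C : ℕ
      C = 1 + 6 * τ * q

      large-k : ∀ k → D₀ ≤ k → k < n → 2 ^ Ω (n ∸ k) ≤ k ^ C
      large-k k D₀≤k k<n = begin
        2 ^ Ω (n ∸ k)     ≤⟨ 2^Ω≤ (n ∸ k) (m<n⇒0<n∸m k<n) ⟩
        n ∸ k             ≤⟨ m∸n≤m n k ⟩
        n                 ≤⟨ <⇒≤ n<D₀^q ⟩
        D₀ ^ q            ≤⟨ ^-monoˡ-≤ q D₀≤k ⟩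
        k ^ q             ≤⟨ ^-monoʳ-≤ k {{>-nonZero k>0}} (≤-trans (m≤n*m q (6 * τ) {{>-nonZero 6τ>0}}) (n≤1+n _)) ⟩
        k ^ C             ∎
        where
        open ≤-Reasoning
        k>0 : 0 < k
        k>0 = <-≤-trans (m^n>0 2 (s * 4 ^ J)) D₀≤k
        6τ>0 : 0 < 6 * τ
        6τ>0 = *-mono-≤ {1} {6} (s≤s z≤n) (≤-trans (s≤s z≤n) (m≤n+m 10 (4 * t₀)))

      -- For k ≤ y the quotient P / k is still divisible by every prime up to y.
      no-small-prime : ∀ k m p → 0 < k → k ≤ y → n ≡ gcd P k * m + k → Prime p → p ∣ m → y < p
      no-small-prime k m p k>0 k≤y n≡ pr p∣m with p ≤? y
      ... | no p≰y = ≰⇒> p≰y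
      ... | yes p≤y = contradiction (subst Prime (∣1⇒≡1 p∣1) pr) ¬prime[1]
        where
        k∣y! : k ∣ y !
        k∣y! = n∣m! k>0 k≤y
        g≡k : gcd P k ≡ k
        g≡k = ∣-antisym (gcd[m,n]∣n P k) (gcd-greatest (subst (k ∣_) (sym P≡) (∣-trans k∣y! (m∣m*n (y !)))) ∣-refl)
        z = quotient k∣y!
        -- One factor y! of P contains k and the other survives the cancellation, so a prime p ≤ y
        -- dividing m would divide both m + 1 and m.
        kzy!∣ : k * (z * y !) ∣ k * (m + 1)
        kzy!∣ = subst₂ _∣_ (trans P≡ (trans (cong (_* y !) (m∣n⇒n≡m*quotient k∣y!)) (*-assoc k z (y !))))
          (trans n≡ (trans (cong (λ g → g * m + k) g≡k) (trans (cong (λ x → k * m + x) (sym (*-identityʳ k))) (sym (*-distribˡ-+ k m 1))))) P∣n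
        p∣1 : p ∣ 1
        p∣1 = ∣m+n∣m⇒∣n (∣-trans (∣-trans (n∣m! (<-trans (s≤s z≤n) (prime≥2 pr)) p≤y) (n∣m*n z)) (*-cancelˡ-∣ k {{>-nonZero k>0}} kzy!∣)) p∣m

      ∈-candidates : ∀ k m p → 1 < k → k < n → n ≡ gcd P k * m + k → Prime p → p ∣ m → p ≤ D₀ → p ∈ candidates k
      ∈-candidates k m p 1<k k<n n≡ pr p∣m p≤D₀ with lg k <? J
      ... | no _ with p ≤? 2 ^ s
      ...   | yes p≤y = ∈-++⁺ˡ (∈-span 0 s pr (prime≥2 pr) p≤y)
      ...   | no p≰y = ∈-++⁺ʳ (span 0 s) (∈-tower s 0 J pr (subst (λ z → 2 ^ z < p) (sym (*-identityʳ s)) (≰⇒> p≰y)) p≤D₀)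
      ∈-candidates k m p 1<k k<n n≡ pr p∣m p≤D₀ | yes ℓ<J =
          ∈-tower s (J ∸ ℓ) ℓ pr lower (≤-trans p≤D₀ (≤-reflexive (cong (λ z → 2 ^ (s * 4 ^ z)) (sym (m∸n+n≡m (<⇒≤ ℓ<J))))))
        where
        ℓ = lg k
        k≤y : k ≤ y
        k≤y = ≤-trans (<⇒≤ (lg-upper k)) (^-monoʳ-≤ 2 (≤-trans ℓ<J (m≤m+n J 2)))
        y<p : y < p
        y<p = no-small-prime k m p (<-trans (s≤s z≤n) 1<k) k≤y n≡ pr p∣m
        -- From depth ℓ on, at least 2^(ℓ+1) classes are avoided, and k < 2^(ℓ+1).
        unhit′ : Unhit n (flat (blocks s (J ∸ ℓ) ℓ))
        unhit′ = subst (λ z → Unhit n (flat (blocks s (J ∸ ℓ) z))) (+-identityʳ ℓ)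
          (unhit-suffix n s (J ∸ ℓ) ℓ 0 (subst (λ z → Unhit n (flat (blocks s z 0))) (sym (m+[n∸m]≡n (<⇒≤ ℓ<J))) unhit))
        p∣ : p ∣ n + (p ∸ k)
        p∣ = subst (p ∣_) (sym eq) (∣m∣n⇒∣m+n (∣-trans p∣m (n∣m*n (gcd P k))) ∣-refl)
          where
          eq : n + (p ∸ k) ≡ gcd P k * m + p
          eq = trans (cong (_+ (p ∸ k)) n≡) (trans (+-assoc (gcd P k * m) k (p ∸ k)) (cong (λ z → gcd P k * m + z) (m+[n∸m]≡n (≤-trans k≤y (<⇒≤ y<p)))))
        lower : 2 ^ (s * 4 ^ (J ∸ ℓ)) < p
        lower with p ≤? 2 ^ (s * 4 ^ (J ∸ ℓ))
        ... | no p≰ = ≰⇒> p≰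
        ... | yes p≤ = contradiction p∣ (unhit-avoids n s (J ∸ ℓ) ℓ unhit′ pr y<p p≤ (<⇒≤ 1<k) (<⇒≤ (lg-upper k)))

      small-k : ∀ k → 1 < k → k < D₀ → k < n → 2 ^ Ω (n ∸ k) ≤ k ^ C
      small-k k 1<k k<D₀ k<n = begin
        2 ^ Ω (n ∸ k)               ≡⟨ cong (λ z → 2 ^ Ω z) n∸k≡ ⟩
        2 ^ Ω (g * m)               ≡⟨ cong (2 ^_) (Ω-* g m g>0 m>0) ⟩
        2 ^ (Ω g + Ω m)             ≡⟨ ^-distribˡ-+-* 2 (Ω g) (Ω m) ⟩
        2 ^ Ω g * 2 ^ Ω m           ≤⟨ *-mono-≤ (≤-trans (2^Ω≤ g g>0) (∣⇒≤ {{>-nonZero k>0}} (gcd[m,n]∣n P k))) (^-monoʳ-≤ 2 (<⇒≤ Ωm<)) ⟩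
        k * 2 ^ (q * T k)           ≡⟨ cong (λ z → k * 2 ^ z) (identity q τ (lg k)) ⟩
        k * 2 ^ (lg k * (6 * τ * q)) ≡⟨ cong (k *_) (^-*-assoc 2 (lg k) (6 * τ * q)) ⟨
        k * (2 ^ lg k) ^ (6 * τ * q) ≤⟨ *-monoʳ-≤ k (^-monoˡ-≤ (6 * τ * q) (lg-lower′ k k>0)) ⟩
        k ^ C                       ∎
        where
        open ≤-Reasoning
        identity : ∀ q t l → q * (6 * (t * l)) ≡ l * (6 * t * q)
        identity = solve-∀
        lg-lower′ : ∀ k → 0 < k → 2 ^ lg k ≤ k
        lg-lower′ (suc k) _ = lg-lower k
        k>0 : 0 < k
        k>0 = <-trans (s≤s z≤n) 1<k
        g = gcd P k
        g∣ : g ∣ n ∸ k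
        g∣ = ∣m+n∣m⇒∣n (subst (g ∣_) (sym (m+[n∸m]≡n (<⇒≤ k<n))) (∣-trans (gcd[m,n]∣m P k) P∣n)) (gcd[m,n]∣n P k)
        m = quotient g∣
        n∸k≡ : n ∸ k ≡ g * m
        n∸k≡ = m∣n⇒n≡m*quotient g∣
        n≡ : n ≡ g * m + k
        n≡ = trans (sym (m∸n+n≡m (<⇒≤ k<n))) (cong (_+ k) n∸k≡)
        gm>0 : 0 < g * m
        gm>0 = <-≤-trans (m<n⇒0<n∸m k<n) (≤-reflexive n∸k≡)
        g>0 : 0 < g
        g>0 = n≢0⇒n>0 (λ g≡0 → <⇒≢ gm>0 (sym (cong (_* m) g≡0)))
        m>0 : 0 < m
        m>0 = n≢0⇒n>0 (λ m≡0 → <⇒≢ gm>0 (sym (trans (cong (g *_) m≡0) (*-zeroʳ g))))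
        m<D₀^q : m < D₀ ^ q
        m<D₀^q = ≤-<-trans (≤-trans (m≤n*m m g {{>-nonZero g>0}}) (≤-trans (≤-reflexive (sym n∸k≡)) (m∸n≤m n k))) n<D₀^q
        Ωm< : Ω m < q * T k
        -- With q T(k) prime factors, m < D₀^q would have a chunk of T(k) of them with product at
        -- most `D₀`. All its primes are candidates, so it is a divisor that the survivor excludes.
        Ωm< with Ω m <? q * T k
        ... | yes lt = lt
        ... | no ≮ with prime-factors m m>0
        ...   | ms , ms-prime , m≡ , Ωm≡
              with small-chunk (λ p → Prime p × p ∣ m) q (T k) D₀ ms
                     (All.tabulate (λ p∈ → All.lookup ms-prime p∈ , subst (_ ∣_) (sym m≡) (∈⇒∣product p∈)))
                     (All.map (λ pr → <⇒≤ (prime≥2 pr)) ms-prime)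
                     (≤-trans (≮⇒≥ ≮) (≤-reflexive Ωm≡)) (≤-<-trans (≤-reflexive (sym m≡)) m<D₀^q)
        ...     | cs , len , cs-prime , cs∣ , cs≤D₀
                with ∈-multisets (T k) (candidates k) cs len
                     (All.tabulate (λ p∈ → ∈-candidates k m _ 1<k k<n n≡ (proj₁ (All.lookup cs-prime p∈)) (proj₂ (All.lookup cs-prime p∈))
                       (≤-trans (∣⇒≤ {{>-nonZero (product-primes>0 (All.map proj₁ cs-prime))}} (∈⇒∣product p∈)) cs≤D₀)))
        ...       | qs , qs∈ , eq = contradiction
                    (subst₂ _∣_ (cong (g *_) (sym eq)) (sym n∸k≡) (*-monoʳ-∣ g (subst (product cs ∣_) (sym m≡) cs∣)))
                    (no-divisor k qs 1<k (<⇒≤ k<D₀) qs∈ (≤-trans (≤-reflexive eq) cs≤D₀))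

      bound : ∀ k → 1 < k → k < n → ω (n ∸ k) ≤ Ω (n ∸ k) × 2 ^ Ω (n ∸ k) ≤ k ^ C
      bound k 1<k k<n with D₀ ≤? k
      ... | yes D₀≤k = ω≤Ω (n ∸ k) , large-k k D₀≤k k<n
      ... | no D₀≰k = ω≤Ω (n ∸ k) , small-k k 1<k (≰⇒> D₀≰k) k<n

-- Choice of the parameters

n!≤n^n : ∀ n → n ! ≤ n ^ n
n!≤n^n zero = ≤-refl
n!≤n^n (suc n) = *-monoʳ-≤ (suc n) (≤-trans (n!≤n^n n) (^-monoˡ-≤ n (n≤1+n n)))

module Construction (κ₆ : ℕ) (6≤κ₆ : 6 ≤ κ₆) (q : ℕ) (471≤q : 471 ≤ q) (J : ℕ) where

  private
    e = (J + 2) * 4 ^ J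
    y = 2 ^ (J + 2)
    P = y ! * y !
    -- 470 = 48 + 8 + 4 + 1 + 1 + 408, the exponents for Q/V, P, 16, J + 1, D₀ and `cap bs` in
    -- `level`.
    X = 2 ^ (470 * e)

  open Sieve κ₆ 6≤κ₆ J P X

  e>0 : 0 < e
  e>0 = *-mono-≤ {1} {J + 2} (≤-trans (s≤s z≤n) (m≤n+m 2 J)) (m^n>0 4 J)

  P>0 : 0 < P
  P>0 = *-mono-≤ (1≤n! y) (1≤n! y)

  P⊥ : CoprimeTo P (flat bs)
  P⊥ = All.zipWith (λ (pr , y<p) {_} (d∣P , d∣p) → prime∤⇒coprime pr (λ p∣P → case euclidsLemma (y !) (y !) pr p∣P of λ where
        (inj₁ p∣) → <⇒≱ y<p (prime∣!⇒≤ y pr p∣)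
        (inj₂ p∣) → <⇒≱ y<p (prime∣!⇒≤ y pr p∣)) (d∣p , d∣P))
      (blocks-prime s J 0 , blocks-lower s J 0)

  D₀<X : D₀ < X
  D₀<X = ^-monoʳ-< 2 (s≤s (s≤s z≤n)) (m<m+n e (*-mono-≤ {1} {469} (s≤s z≤n) e>0))

  2^J≤e : 2 ^ J ≤ e
  2^J≤e = ≤-trans (^-monoˡ-≤ J {2} {4} (s≤s (s≤s z≤n))) (m≤n*m (4 ^ J) (J + 2) {{>-nonZero (≤-trans (s≤s z≤n) (m≤n+m 2 J))}})

  P≤ : P ≤ 2 ^ (8 * e)
  P≤ = begin
    y ! * y !                       ≤⟨ *-mono-≤ (n!≤n^n y) (n!≤n^n y) ⟩
    y ^ y * y ^ y                   ≡⟨ cong₂ _*_ (^-*-assoc 2 (J + 2) y) (^-*-assoc 2 (J + 2) y) ⟩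
    2 ^ ((J + 2) * y) * 2 ^ ((J + 2) * y)  ≡⟨ ^-distribˡ-+-* 2 ((J + 2) * y) ((J + 2) * y) ⟨
    2 ^ ((J + 2) * y + (J + 2) * y)        ≤⟨ ^-monoʳ-≤ 2 (begin
      (J + 2) * y + (J + 2) * y               ≡⟨ cong (λ z → (J + 2) * z + (J + 2) * z) (^-distribˡ-+-* 2 J 2) ⟩
      (J + 2) * (2 ^ J * 4) + (J + 2) * (2 ^ J * 4) ≡⟨ identity (J + 2) (2 ^ J) ⟩
      8 * ((J + 2) * 2 ^ J)                   ≤⟨ *-monoʳ-≤ 8 (*-monoʳ-≤ (J + 2) (^-monoˡ-≤ J {2} {4} (s≤s (s≤s z≤n)))) ⟩
      8 * e                                   ∎) ⟩
    2 ^ (8 * e)                     ∎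
    where
    open ≤-Reasoning
    identity : ∀ s x → s * (x * 4) + s * (x * 4) ≡ 8 * (s * x)
    identity = solve-∀

  Q≤ : Q ≤ 2 ^ (48 * e) * V
  Q≤ = begin
    Q                                           ≤⟨ m≤n*m Q (2 ^ (24 * 2 ^ 1)) {{m^n≢0 2 (24 * 2 ^ 1)}} ⟩
    2 ^ (24 * 2 ^ 1) * Q                        ≤⟨ goods⇒modulus≤void 0 bs goods ⟩
    2 ^ (24 * 2 ^ suc (0 + length bs)) * V      ≡⟨ cong (λ z → 2 ^ (24 * 2 ^ suc z) * V) (length-blocks s J 0) ⟩
    2 ^ (24 * 2 ^ suc J) * V                    ≤⟨ *-monoˡ-≤ V (^-monoʳ-≤ 2 (≤-trans (≤-reflexive (identity (2 ^ J))) (*-monoʳ-≤ 48 2^J≤e))) ⟩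
    2 ^ (48 * e) * V                            ∎
    where
    open ≤-Reasoning
    identity : ∀ x → 24 * (2 * x) ≡ 48 * x
    identity = solve-∀

  cap≤ : cap bs ≤ 2 ^ (408 * e)
  cap≤ = ≤-trans (cap-blocks s J 0 (≤-reflexive (cong (_+ 2) (+-identityʳ J)))) (≤-reflexive (cong (λ z → 2 ^ (408 * z)) (*-identityʳ e)))

  level : Q * P * (16 * (J + 1) * (D₀ * cap bs)) ≤ X * V
  level = begin
    Q * P * (16 * (J + 1) * (D₀ * cap bs))
      ≤⟨ *-mono-≤ (*-mono-≤ Q≤ P≤) (*-mono-≤ (*-mono-≤ 16≤ J+1≤) (*-monoʳ-≤ D₀ cap≤)) ⟩
    2 ^ (48 * e) * V * 2 ^ (8 * e) * (2 ^ (4 * e) * 2 ^ e * (2 ^ e * 2 ^ (408 * e)))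
      ≡⟨ identity (2 ^ (48 * e)) V (2 ^ (8 * e)) (2 ^ (4 * e)) (2 ^ e) (2 ^ (408 * e)) ⟩
    2 ^ (48 * e) * (2 ^ (8 * e) * (2 ^ (4 * e) * (2 ^ e * (2 ^ e * 2 ^ (408 * e))))) * V
      ≡⟨ cong (_* V) powers ⟩
    X * V ∎
    where
    open ≤-Reasoning
    16≤ : 16 ≤ 2 ^ (4 * e)
    16≤ = ^-monoʳ-≤ 2 {4} {4 * e} (*-monoʳ-≤ 4 e>0)
    J+1≤ : J + 1 ≤ 2 ^ e
    J+1≤ = ≤-trans (≤-reflexive (+-comm J 1)) (≤-trans (n<2^n J) (^-monoʳ-≤ 2 (≤-trans (<⇒≤ (n<2^n J)) 2^J≤e)))
    identity : ∀ a v b c d f → a * v * b * (c * d * (d * f)) ≡ a * (b * (c * (d * (d * f)))) * v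
    identity = solve-∀
    powers : 2 ^ (48 * e) * (2 ^ (8 * e) * (2 ^ (4 * e) * (2 ^ e * (2 ^ e * 2 ^ (408 * e))))) ≡ X
    powers = trans (cong (λ z → 2 ^ (48 * e) * (2 ^ (8 * e) * (2 ^ (4 * e) * (2 ^ e * z)))) (sym (^-distribˡ-+-* 2 e (408 * e))))
      (trans (cong (λ z → 2 ^ (48 * e) * (2 ^ (8 * e) * (2 ^ (4 * e) * z))) (sym (^-distribˡ-+-* 2 e (e + 408 * e))))
      (trans (cong (λ z → 2 ^ (48 * e) * (2 ^ (8 * e) * z)) (sym (^-distribˡ-+-* 2 (4 * e) (e + (e + 408 * e)))))
      (trans (cong (λ z → 2 ^ (48 * e) * z) (sym (^-distribˡ-+-* 2 (8 * e) (4 * e + (e + (e + 408 * e))))))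
      (trans (sym (^-distribˡ-+-* 2 (48 * e) (8 * e + (4 * e + (e + (e + 408 * e)))))) (cong (2 ^_) (exponents e))))))
      where
      exponents : ∀ e → 48 * e + (8 * e + (4 * e + (e + (e + 408 * e)))) ≡ 470 * e
      exponents = solve-∀

  private
    module B = Bounds P>0 P⊥ D₀<X level
    module S = B.Survivor

  -- This yields infinitely many n: `J` is free and will be the prescribed lower bound N.
  J<n : J < S.n B.survivor
  J<n = <-≤-trans (n<2^n J) (≤-trans (^-monoʳ-≤ 2 (≤-trans (<⇒≤ (n<2^n J)) 2^J≤e)) (≤-trans (<⇒≤ D₀<X) (S.X≤n B.survivor)))

  2X≤D₀^q : X + X ≤ D₀ ^ q
  2X≤D₀^q = begin
    -- The interval reaches up to 2X, and the extra factor 2 is paid by one more power of `D₀`,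
    -- hence 471.
    X + X                 ≡⟨ double (470 * e) ⟩
    2 ^ (1 + 470 * e)     ≤⟨ ^-monoʳ-≤ 2 (+-monoˡ-≤ (470 * e) e>0) ⟩
    2 ^ (471 * e)         ≤⟨ ^-monoʳ-≤ 2 (≤-trans (*-monoˡ-≤ e 471≤q) (≤-reflexive (*-comm q e))) ⟩
    2 ^ (e * q)           ≡⟨ ^-*-assoc 2 e q ⟨
    D₀ ^ q                ∎
    where open ≤-Reasoning

  construction : ∃[ n ] (J < n × (∀ k → 1 < k → k < n → ω (n ∸ k) ≤ Ω (n ∸ k) × 2 ^ Ω (n ∸ k) ≤ k ^ (1 + 6 * τ * q)))
  construction = S.n B.survivor , J<n , B.Endgame.bound refl q 2X≤D₀^q B.survivor

-- The constant depends on `κ₆` and `q` alone; only the construction depends on `N`, which enters as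
-- the number of blocks. The exponent bounds Ω by C times the binary logarithm of k.
bounded-Ω-below : ∀ κ₆ → 6 ≤ κ₆ → ∀ q → 471 ≤ q →
  ∃[ C ] (1 ≤ C × (∀ N → ∃[ n ] (N < n × (∀ k → 1 < k → k < n → ω (n ∸ k) ≤ Ω (n ∸ k) × 2 ^ Ω (n ∸ k) ≤ k ^ C))))
bounded-Ω-below κ₆ 6≤κ₆ q 471≤q = 1 + 6 * (4 * (12 * κ₆) + 10) * q , s≤s z≤n , Construction.construction κ₆ 6≤κ₆ q 471≤q

theorem2 : ∃[ C ] (1 ≤ C × (∀ N → ∃[ n ] (N < n × (∀ k → 1 < k → k < n → ω (n ∸ k) ≤ Ω (n ∸ k) × 2 ^ Ω (n ∸ k) ≤ k ^ C))))
theorem2 = bounded-Ω-below 6 ≤-refl 471 ≤-refl
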